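{- Fix $r\in\mathbb{N}$ and let $w=n^\alpha$ for some fixed $\alpha\in\left(\frac12,1\right)$. In addition, let $$N:=\binom{n}{w},\qquad D:=\sum_{s=0}^{w-1}\frac{w!\,(n-w)!}{(r-1)!\,s!\,[(w-s)!]^{r}\,[n-rw+(r-1)s]!},$$ where $N$ is the number of (possible) edges, and $D$ denotes the number of $r$-sunflowers containing a fixed edge. Then, as $n\to\infty$, $$\Pr\left(\mathbb{H}_{n,p,w}\text{ contains an } r\text{ -sunflower}\right)\to\begin{cases}0 & \text{if } p=o\left((ND)^{ -1/r}\right),\\ 1 & \text{if } p=\omega\left((ND)^{ -1/r}\right).\end{cases}$$
   Context: An $r$-sunflower is a collection of $r$ sets such that the intersection of any two sets in the collection is identical; here the sets are $w$-element subsets (edges) of a universe of $n$ points. $\mathbb{H}_{n,p,w}$ denotes the random $w$-uniform hypergraph on $n$ vertices in which each of the $\binom{n}{w}$ possible edges is chosen independently with probability $p$.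
   Formalization: The statement is proved for r ≥ 2 (for r = 0 the formula for D is undefined; for r = 1 it gives D = 2^w − 1 and the second case fails, e.g. p = 1/(N 2^{w/2})), with w any rounding of n^α to an integer at distance less than 1. -}

module Defs where

open import Algebra.Bundles using (CommutativeMonoid)
open import Algebra.Bundles.Raw using (RawSemiring)
import Algebra.Definitions.RawSemiring as SemiringDefinitions
open import Data.Bool.Properties using () renaming (_≟_ to _≟ᵇ_)
open import Data.Fin.Base using (Fin)
import Data.Fin.Properties as Fin
open import Data.Fin.Subset using (Subset; inside; outside; _∩_; ∣_∣)
open import Data.Fin.Subset.Properties using (anySubset?)
open import Data.Integer.Base using (+_)
open import Data.List.Base as List using (List; []; _∷_; _++_; filter; foldr; length; upTo)
open import Data.List.Membership.Propositional using (_∈_)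
import Data.List.Membership.DecPropositional as DecMembership
open import Data.Nat.Base as ℕ using (ℕ; zero; suc; _!; _∸_; NonZero)
import Data.Nat.Properties as ℕ
open import Data.Nat.Combinatorics using (_C_)
open import Data.Product.Base using (∃-syntax; _×_; _,_; proj₁; proj₂)
open import Data.Rational.Base as ℚ using (ℚ; 0ℚ; 1ℚ; ½; Positive; _/_)
import Data.Rational.Properties as ℚ
open import Algebra.Properties.CommutativeSemigroup
  (CommutativeMonoid.commutativeSemigroup ℚ.+-0-commutativeMonoid) using (interchange)
open import Data.Vec.Base using (Vec; []; _∷_; lookup)
open import Data.Vec.Properties using (≡-dec)
open import Data.Vec.Relation.Unary.All as VecAll using (All)
open import Level using (0ℓ)
open import Relation.Binary.Definitions using (DecidableEquality)
open import Relation.Binary.PropositionalEquality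
  using (_≡_; _≢_; refl; sym; trans; cong; cong₂)
open import Relation.Nullary.Decidable using (Dec; yes; no; map′; _×-dec_; _→-dec_; ¬?)
open import Relation.Unary using (Pred; Decidable)

Eventually : Pred ℕ 0ℓ → Set
Eventually P = ∃[ N ] ∀ n → N ℕ.≤ n → P n

record ℝ : Set where
  constructor mkℝ
  field
    seq    : ℕ → ℚ
    cauchy : ∀ ε → .{{Positive ε}} →
             ∃[ N ] ∀ m n → N ℕ.≤ m → N ℕ.≤ n → ℚ.∣ seq m ℚ.- seq n ∣ ℚ.≤ ε

open ℝ public

infix 4 _<_ _≤_ _≈_

_<_ : ℝ → ℝ → Set
x < y = ∃[ ε ] Positive ε × Eventually λ n → seq x n ℚ.+ ε ℚ.≤ seq y n

_≤_ : ℝ → ℝ → Set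
x ≤ y = ∀ ε → .{{Positive ε}} → Eventually λ n → seq x n ℚ.≤ seq y n ℚ.+ ε

_≈_ : ℝ → ℝ → Set
x ≈ y = x ≤ y × y ≤ x

fromℚ : ℚ → ℝ
fromℚ q = mkℝ (λ _ → q) λ ε → 0 , λ _ _ _ _ → bound ε
  where
  bound : ∀ ε → .{{Positive ε}} → ℚ.∣ q ℚ.- q ∣ ℚ.≤ ε
  bound ε rewrite ℚ.+-inverseʳ q = ℚ.<⇒≤ (ℚ.positive⁻¹ ε)

fromℕ : ℕ → ℝ
fromℕ n = fromℚ (+ n / 1)

0ℝ 1ℝ : ℝ
0ℝ = fromℚ 0ℚ
1ℝ = fromℚ 1ℚ

private
  half+half : ∀ ε → ½ ℚ.* ε ℚ.+ ½ ℚ.* ε ≡ ε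
  half+half ε = trans (sym (ℚ.*-distribʳ-+ ε ½ ½)) (ℚ.*-identityˡ ε)

  half-pos : ∀ ε → .{{Positive ε}} → Positive (½ ℚ.* ε)
  half-pos ε = ℚ.pos*pos⇒pos ½ ε

  split : ∀ a b → a ≡ (a ℚ.- b) ℚ.+ b
  split a b = sym (trans (ℚ.+-assoc a (ℚ.- b) b)
    (trans (cong (a ℚ.+_) (ℚ.+-inverseˡ b)) (ℚ.+-identityʳ a)))

infix  8 -_
infixl 7 _*_
infixl 6 _+_ _-_

_+_ : ℝ → ℝ → ℝ
x + y = mkℝ (λ n → seq x n ℚ.+ seq y n) λ ε →
  let instance _ = half-pos ε
      M , p = cauchy x (½ ℚ.* ε)
      N , q = cauchy y (½ ℚ.* ε)
  in M ℕ.⊔ N , λ m n m≥ n≥ → bound ε m n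
       (p m n (ℕ.m⊔n≤o⇒m≤o M N m≥) (ℕ.m⊔n≤o⇒m≤o M N n≥))
       (q m n (ℕ.m⊔n≤o⇒n≤o M N m≥) (ℕ.m⊔n≤o⇒n≤o M N n≥))
  where
  regroup : ∀ a b c d → (a ℚ.+ b) ℚ.- (c ℚ.+ d) ≡ (a ℚ.- c) ℚ.+ (b ℚ.- d)
  regroup a b c d = trans (cong ((a ℚ.+ b) ℚ.+_) (ℚ.neg-distrib-+ c d))
    (interchange a b (ℚ.- c) (ℚ.- d))
  bound : ∀ ε m n →
          ℚ.∣ seq x m ℚ.- seq x n ∣ ℚ.≤ ½ ℚ.* ε →
          ℚ.∣ seq y m ℚ.- seq y n ∣ ℚ.≤ ½ ℚ.* ε →
          ℚ.∣ (seq x m ℚ.+ seq y m) ℚ.- (seq x n ℚ.+ seq y n) ∣ ℚ.≤ ε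
  bound ε m n p q = begin
    ℚ.∣ (seq x m ℚ.+ seq y m) ℚ.- (seq x n ℚ.+ seq y n) ∣
      ≡⟨ cong ℚ.∣_∣ (regroup (seq x m) (seq y m) (seq x n) (seq y n)) ⟩
    ℚ.∣ (seq x m ℚ.- seq x n) ℚ.+ (seq y m ℚ.- seq y n) ∣
      ≤⟨ ℚ.∣p+q∣≤∣p∣+∣q∣ (seq x m ℚ.- seq x n) (seq y m ℚ.- seq y n) ⟩
    ℚ.∣ seq x m ℚ.- seq x n ∣ ℚ.+ ℚ.∣ seq y m ℚ.- seq y n ∣
      ≤⟨ ℚ.+-mono-≤ p q ⟩
    ½ ℚ.* ε ℚ.+ ½ ℚ.* ε
      ≡⟨ half+half ε ⟩
    ε ∎
    where open ℚ.≤-Reasoning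

-_ : ℝ → ℝ
- x = mkℝ (λ n → ℚ.- seq x n) λ ε →
  let N , p = cauchy x ε
  in N , λ m n m≥ n≥ →
       ℚ.≤-trans (ℚ.≤-reflexive (flip (seq x m) (seq x n))) (p m n m≥ n≥)
  where
  flip : ∀ a b → ℚ.∣ (ℚ.- a) ℚ.- (ℚ.- b) ∣ ≡ ℚ.∣ a ℚ.- b ∣
  flip a b = trans (cong ℚ.∣_∣ (sym (ℚ.neg-distrib-+ a (ℚ.- b)))) (ℚ.∣-p∣≡∣p∣ (a ℚ.- b))

_-_ : ℝ → ℝ → ℝ
x - y = x + (- y)

private
  eventuallyBounded : (x : ℝ) →
    ∃[ B ] Positive B × Eventually λ n → ℚ.∣ seq x n ∣ ℚ.≤ B
  eventuallyBounded x =
    let N , p = cauchy x 1ℚ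
    in 1ℚ ℚ.+ ℚ.∣ seq x N ∣
     , ℚ.positive (ℚ.+-mono-<-≤ (ℚ.positive⁻¹ 1ℚ) (ℚ.0≤∣p∣ (seq x N)))
     , N , λ n n≥ → bound N n (p n N n≥ ℕ.≤-refl)
    where
    open ℚ.≤-Reasoning
    bound : ∀ N n → ℚ.∣ seq x n ℚ.- seq x N ∣ ℚ.≤ 1ℚ →
            ℚ.∣ seq x n ∣ ℚ.≤ 1ℚ ℚ.+ ℚ.∣ seq x N ∣
    bound N n p = begin
      ℚ.∣ seq x n ∣
        ≡⟨ cong ℚ.∣_∣ (split (seq x n) (seq x N)) ⟩
      ℚ.∣ (seq x n ℚ.- seq x N) ℚ.+ seq x N ∣
        ≤⟨ ℚ.∣p+q∣≤∣p∣+∣q∣ (seq x n ℚ.- seq x N) (seq x N) ⟩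
      ℚ.∣ seq x n ℚ.- seq x N ∣ ℚ.+ ℚ.∣ seq x N ∣
        ≤⟨ ℚ.+-monoˡ-≤ ℚ.∣ seq x N ∣ p ⟩
      1ℚ ℚ.+ ℚ.∣ seq x N ∣ ∎

  *-bound : ∀ {a b B δ} → Positive B → ℚ.∣ a ∣ ℚ.≤ B → ℚ.∣ b ∣ ℚ.≤ δ → ℚ.∣ a ℚ.* b ∣ ℚ.≤ B ℚ.* δ
  *-bound {a} {b} {B} {δ} B>0 a≤B b≤δ = begin
    ℚ.∣ a ℚ.* b ∣         ≡⟨ ℚ.∣p*q∣≡∣p∣*∣q∣ a b ⟩
    ℚ.∣ a ∣ ℚ.* ℚ.∣ b ∣   ≤⟨ ℚ.*-monoʳ-≤-nonNeg ℚ.∣ b ∣ {{ℚ.∣-∣-nonNeg b}} a≤B ⟩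
    B ℚ.* ℚ.∣ b ∣         ≤⟨ ℚ.*-monoˡ-≤-nonNeg B {{ℚ.pos⇒nonNeg B {{B>0}}}} b≤δ ⟩
    B ℚ.* δ               ∎
    where open ℚ.≤-Reasoning

_*_ : ℝ → ℝ → ℝ
x * y = mkℝ (λ n → seq x n ℚ.* seq y n) product
  where
  regroup : ∀ a b c d → a ℚ.* b ℚ.- c ℚ.* d ≡ a ℚ.* (b ℚ.- d) ℚ.+ d ℚ.* (a ℚ.- c)
  regroup a b c d = begin-equality
    a ℚ.* b ℚ.- c ℚ.* d
      ≡⟨ cong (ℚ._- c ℚ.* d) (split (a ℚ.* b) (a ℚ.* d)) ⟩
    (a ℚ.* b ℚ.- a ℚ.* d) ℚ.+ a ℚ.* d ℚ.- c ℚ.* d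
      ≡⟨ ℚ.+-assoc (a ℚ.* b ℚ.- a ℚ.* d) (a ℚ.* d) (ℚ.- (c ℚ.* d)) ⟩
    (a ℚ.* b ℚ.- a ℚ.* d) ℚ.+ (a ℚ.* d ℚ.- c ℚ.* d)
      ≡⟨ cong₂ (λ e f → (a ℚ.* b ℚ.- a ℚ.* d) ℚ.+ (e ℚ.- f)) (ℚ.*-comm a d) (ℚ.*-comm c d) ⟩
    (a ℚ.* b ℚ.- a ℚ.* d) ℚ.+ (d ℚ.* a ℚ.- d ℚ.* c)
      ≡⟨ cong₂ ℚ._+_ (factor a b d) (factor d a c) ⟩
    a ℚ.* (b ℚ.- d) ℚ.+ d ℚ.* (a ℚ.- c) ∎
    where
    open ℚ.≤-Reasoning
    factor : ∀ x y z → x ℚ.* y ℚ.- x ℚ.* z ≡ x ℚ.* (y ℚ.- z)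
    factor x y z = sym (trans (ℚ.*-distribˡ-+ x y (ℚ.- z))
      (cong (x ℚ.* y ℚ.+_) (sym (ℚ.neg-distribʳ-* x z))))
  cancel : ∀ B ε .{{_ : ℚ.NonZero B}} → B ℚ.* (ℚ.1/ B ℚ.* (½ ℚ.* ε)) ≡ ½ ℚ.* ε
  cancel B ε = trans (sym (ℚ.*-assoc B (ℚ.1/ B) (½ ℚ.* ε)))
    (trans (cong (ℚ._* (½ ℚ.* ε)) (ℚ.*-inverseʳ B)) (ℚ.*-identityˡ (½ ℚ.* ε)))
  product : ∀ ε → .{{Positive ε}} →
    ∃[ N ] ∀ m n → N ℕ.≤ m → N ℕ.≤ n →
    ℚ.∣ seq x m ℚ.* seq y m ℚ.- seq x n ℚ.* seq y n ∣ ℚ.≤ ε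
  product ε with eventuallyBounded x | eventuallyBounded y
  ... | A , A>0 , K , x≤A | B , B>0 , L , y≤B =
    (M ℕ.⊔ N) ℕ.⊔ (K ℕ.⊔ L) , λ m n m≥ n≥ →
      let m≥MN = ℕ.m⊔n≤o⇒m≤o (M ℕ.⊔ N) (K ℕ.⊔ L) m≥
          n≥MN = ℕ.m⊔n≤o⇒m≤o (M ℕ.⊔ N) (K ℕ.⊔ L) n≥
          m≥KL = ℕ.m⊔n≤o⇒n≤o (M ℕ.⊔ N) (K ℕ.⊔ L) m≥
          n≥KL = ℕ.m⊔n≤o⇒n≤o (M ℕ.⊔ N) (K ℕ.⊔ L) n≥
      in begin
      ℚ.∣ seq x m ℚ.* seq y m ℚ.- seq x n ℚ.* seq y n ∣
        ≡⟨ cong ℚ.∣_∣ (regroup (seq x m) (seq y m) (seq x n) (seq y n)) ⟩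
      ℚ.∣ seq x m ℚ.* (seq y m ℚ.- seq y n) ℚ.+ seq y n ℚ.* (seq x m ℚ.- seq x n) ∣
        ≤⟨ ℚ.∣p+q∣≤∣p∣+∣q∣ (seq x m ℚ.* (seq y m ℚ.- seq y n)) (seq y n ℚ.* (seq x m ℚ.- seq x n)) ⟩
      ℚ.∣ seq x m ℚ.* (seq y m ℚ.- seq y n) ∣ ℚ.+ ℚ.∣ seq y n ℚ.* (seq x m ℚ.- seq x n) ∣
        ≤⟨ ℚ.+-mono-≤
             (*-bound A>0 (x≤A m (ℕ.m⊔n≤o⇒m≤o K L m≥KL))
               (q m n (ℕ.m⊔n≤o⇒n≤o M N m≥MN) (ℕ.m⊔n≤o⇒n≤o M N n≥MN)))
             (*-bound B>0 (y≤B n (ℕ.m⊔n≤o⇒n≤o K L n≥KL))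
               (p m n (ℕ.m⊔n≤o⇒m≤o M N m≥MN) (ℕ.m⊔n≤o⇒m≤o M N n≥MN))) ⟩
      A ℚ.* (ℚ.1/ A ℚ.* (½ ℚ.* ε)) ℚ.+ B ℚ.* (ℚ.1/ B ℚ.* (½ ℚ.* ε))
        ≡⟨ cong₂ ℚ._+_ (cancel A ε) (cancel B ε) ⟩
      ½ ℚ.* ε ℚ.+ ½ ℚ.* ε
        ≡⟨ half+half ε ⟩
      ε ∎
    where
    open ℚ.≤-Reasoning
    instance
      _ = A>0
      _ = B>0
      _ = half-pos ε
      _ = ℚ.pos⇒nonZero A
      _ = ℚ.pos⇒nonZero B
      _ = ℚ.1/pos⇒pos A
      _ = ℚ.1/pos⇒pos B
      _ = ℚ.pos*pos⇒pos (ℚ.1/ A) (½ ℚ.* ε)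
      _ = ℚ.pos*pos⇒pos (ℚ.1/ B) (½ ℚ.* ε)
    x-cauchy = cauchy x (ℚ.1/ B ℚ.* (½ ℚ.* ε))
    y-cauchy = cauchy y (ℚ.1/ A ℚ.* (½ ℚ.* ε))
    M = proj₁ x-cauchy
    p = proj₂ x-cauchy
    N = proj₁ y-cauchy
    q = proj₂ y-cauchy

ℝ-rawSemiring : RawSemiring 0ℓ 0ℓ
ℝ-rawSemiring = record
  { Carrier = ℝ ; _≈_ = _≈_ ; _+_ = _+_ ; _*_ = _*_ ; 0# = 0ℝ ; 1# = 1ℝ }

open SemiringDefinitions ℝ-rawSemiring public using (_^_)

sumℝ : List ℝ → ℝ
sumℝ = foldr _+_ 0ℝ

infix 4 _⟶_ _∈o_ _∈ω_

_⟶_ : (ℕ → ℝ) → ℝ → Set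
f ⟶ l = ∀ ε → .{{Positive ε}} →
  Eventually λ n → (l - fromℚ ε < f n) × (f n < l + fromℚ ε)

-- Both for nonnegative sequences only: no absolute values are taken.

_∈o_ : (ℕ → ℝ) → (ℕ → ℝ) → Set
f ∈o g = ∀ c → .{{Positive c}} → Eventually λ n → f n ≤ fromℚ c * g n

_∈ω_ : (ℕ → ℝ) → (ℕ → ℝ) → Set
f ∈ω g = ∀ c → .{{Positive c}} → Eventually λ n → fromℚ c * g n ≤ f n

-- y = b ^ α for a base b ≥ 1 and a real exponent α > 0.  The power with
-- exponent u / v is the v-th root of b ^ u, and b ^ α is squeezed between the
-- powers with smaller and with larger rational exponents.

record IsPower (b : ℕ) (α y : ℝ) : Set where
  field
    nonNeg : 0ℝ ≤ y
    lower  : ∀ u v .{{_ : NonZero v}} → fromℚ (+ u / v) < α → fromℕ (b ℕ.^ u) ≤ y ^ v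
    upper  : ∀ u v .{{_ : NonZero v}} → α < fromℚ (+ u / v) → y ^ v ≤ fromℕ (b ℕ.^ u)

-- w = b ^ α up to rounding: w may be the floor or the ceiling.

IsRoundedPower : (b : ℕ) (α : ℝ) (w : ℕ) → Set
IsRoundedPower b α w = ∃[ y ] IsPower b α y × y - 1ℝ < fromℕ w × fromℕ w < y + 1ℝ

-- y = x ^ (-1 / r) for x > 0 and r ≥ 1.

IsInverseRoot : (r : ℕ) (x : ℚ) (y : ℝ) → Set
IsInverseRoot r x y = 0ℝ ≤ y × y ^ r * fromℚ x ≈ 1ℝ

IsSunflower : ∀ {n r} → Vec (Subset n) r → Set
IsSunflower {r = r} S =
  (∀ (i j : Fin r) → i ≢ j → lookup S i ≢ lookup S j) ×
  (∀ (i j k l : Fin r) → i ≢ j → k ≢ l →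
     lookup S i ∩ lookup S j ≡ lookup S k ∩ lookup S l)

ContainsSunflower : ∀ {n} → ℕ → List (Subset n) → Set
ContainsSunflower {n} r H =
  ∃[ S ] All {A = Subset n} (_∈ H) {r} S × IsSunflower S

_≟ˢ_ : ∀ {n} → DecidableEquality (Subset n)
_≟ˢ_ = ≡-dec _≟ᵇ_

isSunflower? : ∀ {n r} → Decidable (IsSunflower {n} {r})
isSunflower? S =
  Fin.all? (λ i → Fin.all? λ j →
    ¬? (i Fin.≟ j) →-dec ¬? (lookup S i ≟ˢ lookup S j))
  ×-dec
  Fin.all? (λ i → Fin.all? λ j → Fin.all? λ k → Fin.all? λ l →
    ¬? (i Fin.≟ j) →-dec (¬? (k Fin.≟ l) →-dec
      ((lookup S i ∩ lookup S j) ≟ˢ (lookup S k ∩ lookup S l))))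

anyVec? : ∀ {n r} {P : Pred (Vec (Subset n) r) 0ℓ} → Decidable P → Dec (∃[ S ] P S)
anyVec? {r = zero}  P? = map′ (λ p → [] , p) (λ { ([] , p) → p }) (P? [])
anyVec? {r = suc r} P? = map′
  (λ (A , S , p) → A ∷ S , p)
  (λ { (A ∷ S , p) → A , S , p })
  (anySubset? λ A → anyVec? λ S → P? (A ∷ S))

containsSunflower? : ∀ {n} r → Decidable (ContainsSunflower {n} r)
containsSunflower? r H =
  anyVec? λ S → VecAll.all? (λ A → DecMembership._∈?_ _≟ˢ_ A H) S ×-dec isSunflower? S

allSubsets : ∀ n → List (Subset n)
allSubsets zero    = [] ∷ []
allSubsets (suc n) = List.map (outside ∷_) (allSubsets n) ++ List.map (inside ∷_) (allSubsets n)

edges : ∀ n (w : ℕ) → List (Subset n)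
edges n w = filter (λ e → ∣ e ∣ ℕ.≟ w) (allSubsets n)

sublists : ∀ {A : Set} → List A → List (List A)
sublists []       = [] ∷ []
sublists (x ∷ xs) = sublists xs ++ List.map (x ∷_) (sublists xs)

-- A hypergraph is the sublist of its edges in the duplicate-free list
-- edges n w, so sublists (edges n w) enumerates each hypergraph once.

probability : (n : ℕ) (p : ℝ) (w : ℕ) {E : Pred (List (Subset n)) 0ℓ} → Decidable E → ℝ
probability n p w E? = sumℝ (List.map weight (filter E? (sublists (edges n w))))
  where
  weight : List (Subset n) → ℝ
  weight H = p ^ length H * (1ℝ - p) ^ ((n C w) ∸ length H)

denominator : (r s t m : ℕ) → ℕ
denominator r s t m = ((r ∸ 1) !) ℕ.* (s !) ℕ.* ((t !) ℕ.^ r) ℕ.* (m !)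

denominator≢0 : ∀ r s t m → NonZero (denominator r s t m)
denominator≢0 r s t m =
    ℕ.m*n≢0 (((r ∸ 1) !) ℕ.* (s !) ℕ.* ((t !) ℕ.^ r)) (m !)
      {{ℕ.m*n≢0 (((r ∸ 1) !) ℕ.* (s !)) ((t !) ℕ.^ r)
        {{ℕ.m*n≢0 ((r ∸ 1) !) (s !) {{(r ∸ 1) ℕ.!≢0}} {{s ℕ.!≢0}}}}
        {{ℕ.m^n≢0 (t !) r {{t ℕ.!≢0}}}}}}
      {{m ℕ.!≢0}}

-- The summand is 0 when n - rw + (r - 1)s is negative, as its factorial
-- in the denominator is then read as infinite.

kernelTerm : (r n w s : ℕ) → ℚ
kernelTerm r n w s with r ℕ.* w ℕ.≤? n ℕ.+ (r ∸ 1) ℕ.* s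
... | no  _ = 0ℚ
... | yes _ = (+ ((w !) ℕ.* ((n ∸ w) !)) / denominator r s (w ∸ s) m)
                {{denominator≢0 r s (w ∸ s) m}}
  where m = (n ℕ.+ (r ∸ 1) ℕ.* s) ∸ r ℕ.* w

N : (n w : ℕ) → ℚ
N n w = + (n C w) / 1

D : (r n w : ℕ) → ℚ
D r n w = foldr ℚ._+_ 0ℚ (List.map (kernelTerm r n w) (upTo w))

{-# OPTIONS --safe #-}

-- Let T be the number of ordered r-sunflowers.  Choosing the kernel and then the petals one
-- after the other writes T as a sum over s of products of binomial coefficients, and
-- T = (r - 1)! N D.  If T pʳ is small, the union bound over the T sunflowers suffices.
--
-- If T pʳ is large, Chebyshev's inequality is applied to the number X of sunflowers present.
-- With μ = T pʳ = E[X], the variance is at most a sum over pairs of sunflowers sharing an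
-- edge.  Let d be the number of sunflowers with prescribed edges at j ≥ 1 given positions;
-- then dʳ ≤ T^(r - j).  For j ≥ 2 the kernel is determined, and d is at most a product of
-- the r - j smallest among r decreasing factors whose product is at most T.  For j = 1, the
-- degree d of an edge satisfies T = N d, and d ≤ N^(r - 1) by Vandermonde's identity.  Hence
-- if μ ≥ cʳ with c ≥ 1, then p^(r - j) d ≤ μ / c, so that Pr (X = 0) = O (1 / c).
--
-- The exponent α only serves to make N D positive for all large n.
module Submission where

open import Algebra.Bundles using (CommutativeRing; CommutativeSemiring)
import Algebra.Properties.CommutativeSemiring.Exp as CommutativeSemiringExp
import Algebra.Properties.Semiring.Exp as SemiringExp
open import Data.Empty using (⊥-elim)
open import Data.Fin.Base as Fin using (Fin)
open import Data.Fin.Properties using (suc-injective)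
open import Data.Fin.Subset using (Subset; inside; outside; _∩_; _∪_; _─_; ∁; _⊆_; ∣_∣)
  renaming (_∈_ to _∈ˢ_; _∉_ to _∉ˢ_; ⊥ to ∅)
open import Data.Fin.Subset.Properties as Subset
  using (x∈p∪q⁻; x∈p∪q⁺; x∈p∩q⁻; x∈p∩q⁺; p⊆p∪q; q⊆p∪q; p∩q⊆p; p∩q⊆q; ⊆-antisym; ⊆-refl;
         p⊆q⇒∣p∣≤∣q∣; ∣p∣≤∣p∪q∣; x∈p∧x∉q⇒x∈p─q; p─q⊆p; x∈∁p⇒x∉p; ∉⊥; ∣⊥∣≡0; ∣p∣≤n)
  renaming (_∈?_ to _∈ˢ?_)
import Data.Integer.Base as ℤ
import Data.Integer.Properties as ℤ
open import Data.List.Base as List using (List; []; _∷_; _++_; concatMap; filter; length; upTo)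
import Data.List.Membership.DecPropositional as DecMembership
open import Data.List.Membership.Propositional using (_∈_; _∉_; find)
open import Data.List.Membership.Propositional.Properties
  using (∈-++⁺ˡ; ∈-++⁺ʳ; ∈-++⁻; ∈-map⁺; ∈-map⁻; ∈-concatMap⁺; ∈-concatMap⁻; ∈-filter⁺; ∈-filter⁻;
         ∈-upTo⁺; ∈-upTo⁻)
open import Data.List.Properties
  using (length-++; length-map; filter-all; filter-accept; filter-reject; map-upTo; upTo-∷ʳ)
open import Data.List.Relation.Unary.All as All using (All; []; _∷_)
import Data.List.Relation.Unary.All.Properties as All
open import Data.List.Relation.Unary.AllPairs using ([]; _∷_)
open import Data.List.Relation.Unary.Any as Any using (here; there)
open import Data.List.Relation.Unary.Unique.Propositional using (Unique)
import Data.List.Relation.Unary.Unique.Propositional.Properties as Unique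
open import Data.Maybe.Base using (Maybe; just; nothing)
open import Data.Nat.Base as ℕ using (ℕ; zero; suc; z≤n; s≤s)
open import Data.Nat.Combinatorics
  using (_C_; nCk+nC[k+1]≡[n+1]C[k+1]; k>n⇒nCk≡0; nCk≡n!/k![n-k]!; k![n∸k]!∣n!)
open import Data.Nat.Divisibility using (_∣_)
open import Data.Nat.DivMod using (/-congʳ; m/n*n≡m)
import Data.Nat.Properties as ℕ
import Data.Nat.Solver as ℕSolver
open import Data.Product.Base using (∃-syntax; _×_; _,_; proj₁; proj₂)
open import Data.Rational.Base as ℚ using (ℚ; 0ℚ; 1ℚ)
import Data.Rational.Properties as ℚ
open import Data.Rational.Solver using (module +-*-Solver)
import Data.Rational.Unnormalised.Base as ℚᵘ
import Data.Rational.Unnormalised.Properties as ℚᵘ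
open import Data.Sum.Base using (_⊎_; inj₁; inj₂; [_,_]′)
open import Data.Unit.Base using (⊤; tt)
open import Data.Vec.Base as Vec using (Vec; []; _∷_; toList; lookup)
open import Data.Vec.Properties using (length-toList; ∷-injectiveʳ)
import Data.Vec.Relation.Unary.All as VecAll using (All)
import Data.Vec.Relation.Unary.All.Properties as VecAll
open import Function.Base using (_∘_; id)
open import Level using (0ℓ)
open import Relation.Binary.Definitions using (DecidableEquality)
open import Relation.Binary.PropositionalEquality
open import Relation.Nullary.Decidable using (Dec; yes; no; ¬?; _×-dec_)
open import Relation.Nullary.Negation using (¬_)

import Defs
open Defs using (allSubsets; edges; sublists; IsSunflower; containsSunflower?; _≟ˢ_;
  denominator; denominator≢0; kernelTerm; N; D; ℝ; seq; sumℝ; probability; fromℚ; fromℕ; 0ℝ; 1ℝ;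
  Eventually; IsPower; IsRoundedPower; IsInverseRoot; _⟶_; _∈o_; _∈ω_)

-- Reals are Cauchy sequences with termwise arithmetic, so the combinatorics runs over a rational
-- edge probability `q` in [0 , 1]. The k-th approximation of the probability is the same polynomial
-- in the k-th approximation of `p`, which may leave [0 , 1], where the polynomial is no
-- expectation. It is moved back into the interval at a cost controlled by a Lipschitz constant;
-- this constant may depend on `n`, because `n` is fixed while the approximations improve. The bound
-- dʳ ≤ T^(r - j) suffices for the following reason. Multiplied by q^(r (r - j)) it reads (q^(r - j)
-- d)ʳ ≤ μ^(r - j), and cʳ ≤ μ ≤ μ^j supplies the missing factor, so that (c q^(r - j) d)ʳ ≤ μʳ. The
-- asymptotics of the sum `D` and its dominant term are never examined: the counting estimates are
-- inequalities for each single `n`.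

-- Finite sums and indicators

module Summation (R : CommutativeSemiring 0ℓ 0ℓ) where
  open CommutativeSemiring R
    using (Carrier; _≈_; _+_; _*_; 0#; 1#; +-cong; +-congˡ; +-assoc; +-identityˡ;
           zeroʳ; distribˡ; +-commutativeSemigroup)
    renaming (refl to ≈-refl; sym to ≈-sym; trans to ≈-trans)
  open import Algebra.Properties.CommutativeSemigroup +-commutativeSemigroup using (interchange)

  ∑ : {A : Set} → List A → (A → Carrier) → Carrier
  ∑ []       f = 0#
  ∑ (x ∷ xs) f = f x + ∑ xs f

  𝟙 : {P : Set} → Dec P → Carrier
  𝟙 (yes _) = 1#
  𝟙 (no  _) = 0#

  ∑-cong : {A : Set} (xs : List A) {f g : A → Carrier} →
           (∀ x → x ∈ xs → f x ≈ g x) → ∑ xs f ≈ ∑ xs g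
  ∑-cong []       eq = ≈-refl
  ∑-cong (x ∷ xs) eq = +-cong (eq x (here refl)) (∑-cong xs λ y y∈ → eq y (there y∈))

  ∑-++ : {A : Set} (xs ys : List A) {f : A → Carrier} → ∑ (xs ++ ys) f ≈ ∑ xs f + ∑ ys f
  ∑-++ []       ys = ≈-sym (+-identityˡ _)
  ∑-++ (x ∷ xs) ys = ≈-trans (+-congˡ (∑-++ xs ys)) (≈-sym (+-assoc _ _ _))

  ∑-map : {A B : Set} (h : A → B) (xs : List A) {f : B → Carrier} →
          ∑ (List.map h xs) f ≈ ∑ xs (f ∘ h)
  ∑-map h []       = ≈-refl
  ∑-map h (x ∷ xs) = +-congˡ (∑-map h xs)

  ∑-concatMap : {A B : Set} (h : A → List B) (xs : List A) {f : B → Carrier} →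
                ∑ (concatMap h xs) f ≈ ∑ xs (λ x → ∑ (h x) f)
  ∑-concatMap h []       = ≈-refl
  ∑-concatMap h (x ∷ xs) =
    ≈-trans (∑-++ (h x) (concatMap h xs)) (+-congˡ (∑-concatMap h xs))

  ∑-zero : {A : Set} (xs : List A) → ∑ xs (λ _ → 0#) ≈ 0#
  ∑-zero []       = ≈-refl
  ∑-zero (x ∷ xs) = ≈-trans (+-identityˡ _) (∑-zero xs)

  ∑-distrib-+ : {A : Set} (xs : List A) {f g : A → Carrier} →
                ∑ xs (λ x → f x + g x) ≈ ∑ xs f + ∑ xs g
  ∑-distrib-+ []       = ≈-sym (+-identityˡ _)
  ∑-distrib-+ (x ∷ xs) = ≈-trans (+-congˡ (∑-distrib-+ xs)) (interchange _ _ _ _)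

  *-distribˡ-∑ : {A : Set} (xs : List A) (c : Carrier) {f : A → Carrier} →
                 c * ∑ xs f ≈ ∑ xs (λ x → c * f x)
  *-distribˡ-∑ []       c = zeroʳ c
  *-distribˡ-∑ (x ∷ xs) c = ≈-trans (distribˡ c _ _) (+-congˡ (*-distribˡ-∑ xs c))

  ∑-comm : {A B : Set} (xs : List A) (ys : List B) {f : A → B → Carrier} →
           ∑ xs (λ x → ∑ ys (f x)) ≈ ∑ ys (λ y → ∑ xs (λ x → f x y))
  ∑-comm []       ys = ≈-sym (∑-zero ys)
  ∑-comm (x ∷ xs) ys = ≈-trans (+-congˡ (∑-comm xs ys)) (≈-sym (∑-distrib-+ ys))

  𝟙-yes : {P : Set} (P? : Dec P) → P → 𝟙 P? ≈ 1#
  𝟙-yes (yes _) _ = ≈-refl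
  𝟙-yes (no ¬p) p = ⊥-elim (¬p p)

  𝟙-no : {P : Set} (P? : Dec P) → ¬ P → 𝟙 P? ≈ 0#
  𝟙-no (yes p) ¬p = ⊥-elim (¬p p)
  𝟙-no (no _)  _  = ≈-refl

  𝟙-cong : {P Q : Set} (P? : Dec P) (Q? : Dec Q) → (P → Q) → (Q → P) → 𝟙 P? ≈ 𝟙 Q?
  𝟙-cong (yes p) Q? P⇒Q Q⇒P = ≈-sym (𝟙-yes Q? (P⇒Q p))
  𝟙-cong (no ¬p) Q? P⇒Q Q⇒P = ≈-sym (𝟙-no Q? (¬p ∘ Q⇒P))

ℚ-commutativeSemiring : CommutativeSemiring 0ℓ 0ℓ
ℚ-commutativeSemiring = CommutativeRing.commutativeSemiring ℚ.+-*-commutativeRing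

module ∑ℕ = Summation ℕ.+-*-commutativeSemiring
module ∑ℚ = Summation ℚ-commutativeSemiring

module NatSum where
  open ∑ℕ
  open import Data.Nat.Base using (_+_; _*_; _≤_)

  ∑-mono-≤ : {A : Set} (xs : List A) {f g : A → ℕ} → (∀ x → x ∈ xs → f x ≤ g x) → ∑ xs f ≤ ∑ xs g
  ∑-mono-≤ []       _  = z≤n
  ∑-mono-≤ (x ∷ xs) le = ℕ.+-mono-≤ (le x (here refl)) (∑-mono-≤ xs λ y y∈ → le y (there y∈))

  ∑-const : {A : Set} (xs : List A) (c : ℕ) → ∑ xs (λ _ → c) ≡ length xs * c
  ∑-const []       c = refl
  ∑-const (x ∷ xs) c = cong (c ℕ.+_) (∑-const xs c)

  term≤∑ : {A : Set} {x : A} (xs : List A) {f : A → ℕ} → x ∈ xs → f x ≤ ∑ xs f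
  term≤∑ (x ∷ xs) (here refl) = ℕ.m≤m+n _ _
  term≤∑ (x ∷ xs) (there x∈)  = ℕ.≤-trans (term≤∑ xs x∈) (ℕ.m≤n+m _ _)

  ∑≢0⇒∃ : {A : Set} (xs : List A) {f : A → ℕ} → ∑ xs f ≢ 0 → ∃[ x ] x ∈ xs × f x ≢ 0
  ∑≢0⇒∃ []       ≢0 = ⊥-elim (≢0 refl)
  ∑≢0⇒∃ (x ∷ xs) {f} ≢0 with f x ℕ.≟ 0
  ... | no  fx≢0 = x , here refl , fx≢0
  ... | yes fx≡0 =
    let y , y∈ , fy≢0 = ∑≢0⇒∃ xs (λ eq → ≢0 (cong₂ _+_ fx≡0 eq)) in y , there y∈ , fy≢0

  𝟙≢0⇒ : {P : Set} (P? : Dec P) → 𝟙 P? ≢ 0 → P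
  𝟙≢0⇒ (yes p) _  = p
  𝟙≢0⇒ (no  _) ≢0 = ⊥-elim (≢0 refl)

-- Powers, sums and natural numbers in the ordered field of rationals

module Rational where
  open import Data.Integer.Base using (+_)
  open import Data.Rational.Base
    using (_+_; _*_; _-_; -_; _≤_; _<_; Positive; nonNegative; positive)
  open ∑ℚ
  open SemiringExp (CommutativeSemiring.semiring ℚ-commutativeSemiring) public
    using (_^_; ^-homo-*; ^-assocʳ)
  open CommutativeSemiringExp ℚ-commutativeSemiring public using (^-distrib-*)

  *-monoˡ : ∀ {a b c} → 0ℚ ≤ c → a ≤ b → c * a ≤ c * b
  *-monoˡ {c = c} 0≤c = ℚ.*-monoˡ-≤-nonNeg c {{nonNegative 0≤c}}

  *-monoʳ : ∀ {a b c} → 0ℚ ≤ c → a ≤ b → a * c ≤ b * c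
  *-monoʳ {c = c} 0≤c = ℚ.*-monoʳ-≤-nonNeg c {{nonNegative 0≤c}}

  *-nonNeg : ∀ {a b} → 0ℚ ≤ a → 0ℚ ≤ b → 0ℚ ≤ a * b
  *-nonNeg {a} {b} 0≤a 0≤b = subst (_≤ a * b) (ℚ.*-zeroʳ a) (*-monoˡ 0≤a 0≤b)

  *-mono : ∀ {a b c d} → 0ℚ ≤ a → 0ℚ ≤ c → a ≤ b → c ≤ d → a * c ≤ b * d
  *-mono 0≤a 0≤c a≤b c≤d =
    ℚ.≤-trans (*-monoʳ 0≤c a≤b) (*-monoˡ (ℚ.≤-trans 0≤a a≤b) c≤d)

  +-nonNeg : ∀ {a b} → 0ℚ ≤ a → 0ℚ ≤ b → 0ℚ ≤ a + b
  +-nonNeg = ℚ.+-mono-≤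

  *-pos : ∀ {a b} → 0ℚ < a → 0ℚ < b → 0ℚ < a * b
  *-pos {a} {b} 0<a 0<b =
    subst (_< a * b) (ℚ.*-zeroʳ a) (ℚ.*-monoʳ-<-pos a {{positive 0<a}} 0<b)

  *-cancelʳ-≡ : ∀ {a b c} → 0ℚ < c → a * c ≡ b * c → a ≡ b
  *-cancelʳ-≡ {c = c} 0<c eq = ℚ.≤-antisym (cancel (ℚ.≤-reflexive eq)) (cancel (ℚ.≤-reflexive (sym eq)))
    where
    cancel : ∀ {a b} → a * c ≤ b * c → a ≤ b
    cancel = ℚ.*-cancelʳ-≤-pos c {{positive 0<c}}

  square-nonNeg : ∀ a → 0ℚ ≤ a * a
  square-nonNeg a with ℚ.≤-total 0ℚ a
  ... | inj₁ 0≤a = *-nonNeg 0≤a 0≤a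
  ... | inj₂ a≤0 = subst (0ℚ ≤_) (neg*neg a) (*-nonNeg 0≤-a 0≤-a)
    where
    open +-*-Solver
    0≤-a : 0ℚ ≤ - a
    0≤-a = ℚ.neg-antimono-≤ a≤0
    neg*neg : ∀ a → (- a) * (- a) ≡ a * a
    neg*neg = solve 1 (λ a → (:- a) :* (:- a) := a :* a) refl

  0≤1 : 0ℚ ≤ 1ℚ
  0≤1 = ℚ.<⇒≤ (ℚ.positive⁻¹ 1ℚ)

  a≤b⇒0≤b-a : ∀ {a b} → a ≤ b → 0ℚ ≤ b - a
  a≤b⇒0≤b-a {a} {b} a≤b = subst (_≤ b - a) (ℚ.+-inverseʳ a) (ℚ.+-monoˡ-≤ (- a) a≤b)

  ^-nonNeg : ∀ {a} n → 0ℚ ≤ a → 0ℚ ≤ a ^ n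
  ^-nonNeg zero    0≤a = 0≤1
  ^-nonNeg (suc n) 0≤a = *-nonNeg 0≤a (^-nonNeg n 0≤a)

  ^-pos : ∀ {a} n → 0ℚ < a → 0ℚ < a ^ n
  ^-pos zero    0<a = ℚ.positive⁻¹ 1ℚ
  ^-pos (suc n) 0<a = *-pos 0<a (^-pos n 0<a)

  ^-mono : ∀ {a b} n → 0ℚ ≤ a → a ≤ b → a ^ n ≤ b ^ n
  ^-mono zero    0≤a a≤b = ℚ.≤-refl
  ^-mono (suc n) 0≤a a≤b = *-mono 0≤a (^-nonNeg n 0≤a) a≤b (^-mono n 0≤a a≤b)

  ^-mono-< : ∀ {a b} n → 0ℚ ≤ a → a < b → a ^ suc n < b ^ suc n
  ^-mono-< {a} {b} n 0≤a a<b = ℚ.≤-<-trans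
    (*-monoˡ 0≤a (^-mono n 0≤a (ℚ.<⇒≤ a<b)))
    (ℚ.*-monoˡ-<-pos (b ^ n) {{positive (^-pos n (ℚ.≤-<-trans 0≤a a<b))}} a<b)

  ^-cancel-≤ : ∀ {a b} n → 0ℚ ≤ b → a ^ suc n ≤ b ^ suc n → a ≤ b
  ^-cancel-≤ {a} {b} n 0≤b le with a ℚ.≤? b
  ... | yes a≤b = a≤b
  ... | no  a≰b = ⊥-elim (ℚ.<-irrefl refl (ℚ.<-≤-trans (^-mono-< n 0≤b (ℚ.≰⇒> a≰b)) le))

  1≤^ : ∀ {a} n → 1ℚ ≤ a → 1ℚ ≤ a ^ n
  1≤^ zero    1≤a = ℚ.≤-refl
  1≤^ {a} (suc n) 1≤a = ℚ.≤-trans 1≤a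
    (subst (_≤ a * a ^ n) (ℚ.*-identityʳ a) (*-monoˡ (ℚ.≤-trans 0≤1 1≤a) (1≤^ n 1≤a)))

  ^≤1 : ∀ {a} n → 0ℚ ≤ a → a ≤ 1ℚ → a ^ n ≤ 1ℚ
  ^≤1 zero    0≤a a≤1 = ℚ.≤-refl
  ^≤1 (suc n) 0≤a a≤1 = *-mono 0≤a (^-nonNeg n 0≤a) a≤1 (^≤1 n 0≤a a≤1)

  ∑-mono-≤ : {A : Set} (xs : List A) {f g : A → ℚ} → (∀ x → x ∈ xs → f x ≤ g x) → ∑ xs f ≤ ∑ xs g
  ∑-mono-≤ []       _  = ℚ.≤-refl
  ∑-mono-≤ (x ∷ xs) le = ℚ.+-mono-≤ (le x (here refl)) (∑-mono-≤ xs λ y y∈ → le y (there y∈))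

  ∑-nonNeg : {A : Set} (xs : List A) {f : A → ℚ} → (∀ x → x ∈ xs → 0ℚ ≤ f x) → 0ℚ ≤ ∑ xs f
  ∑-nonNeg []       _  = ℚ.≤-refl
  ∑-nonNeg (x ∷ xs) le = +-nonNeg (le x (here refl)) (∑-nonNeg xs λ y y∈ → le y (there y∈))

  term≤∑ : {A : Set} {x : A} (xs : List A) {f : A → ℚ} → (∀ x → 0ℚ ≤ f x) → x ∈ xs → f x ≤ ∑ xs f
  term≤∑ {x = x} (_ ∷ xs) {f} 0≤f (here refl) =
    subst (_≤ f x + ∑ xs f) (ℚ.+-identityʳ (f x)) (ℚ.+-monoʳ-≤ (f x) (∑-nonNeg xs λ y _ → 0≤f y))
  term≤∑ (y ∷ xs) {f} 0≤f (there x∈)  = ℚ.≤-trans (term≤∑ xs 0≤f x∈)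
    (subst (_≤ f y + ∑ xs f) (ℚ.+-identityˡ (∑ xs f)) (ℚ.+-monoˡ-≤ (∑ xs f) (0≤f y)))

  𝟙-nonNeg : {P : Set} (P? : Dec P) → 0ℚ ≤ 𝟙 P?
  𝟙-nonNeg (yes _) = 0≤1
  𝟙-nonNeg (no  _) = ℚ.≤-refl

  𝟙≤1 : {P : Set} (P? : Dec P) → 𝟙 P? ≤ 1ℚ
  𝟙≤1 (yes _) = ℚ.≤-refl
  𝟙≤1 (no  _) = 0≤1

  ι : ℕ → ℚ
  ι n = + n ℚ./ 1

  private
    ιᵘ : ℕ → ℚᵘ.ℚᵘ
    ιᵘ n = ℚᵘ.mkℚᵘ (+ n) 0

  -- Passing to unnormalised fractions removes the gcd from the quotients; with all denominators 1
  -- only an identity of integers is left.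
  ι-+ : ∀ m n → ι (m ℕ.+ n) ≡ ι m + ι n
  ι-+ m n = ℚ.toℚᵘ-injective (ℚᵘ.≃-trans (ℚ.toℚᵘ-fromℚᵘ (ιᵘ (m ℕ.+ n)))
    (ℚᵘ.≃-trans (ℚᵘ.*≡* eq)
    (ℚᵘ.≃-sym (ℚᵘ.≃-trans (ℚ.toℚᵘ-homo-+ (ι m) (ι n))
      (ℚᵘ.+-cong (ℚ.toℚᵘ-fromℚᵘ (ιᵘ m)) (ℚ.toℚᵘ-fromℚᵘ (ιᵘ n)))))))
    where
    eq : + (m ℕ.+ n) ℤ.* + 1 ≡ (+ m ℤ.* + 1 ℤ.+ + n ℤ.* + 1) ℤ.* + 1
    eq = cong (ℤ._* + 1) (cong₂ ℤ._+_ (sym (ℤ.*-identityʳ (+ m))) (sym (ℤ.*-identityʳ (+ n))))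

  ι-* : ∀ m n → ι (m ℕ.* n) ≡ ι m * ι n
  ι-* m n = ℚ.toℚᵘ-injective (ℚᵘ.≃-trans (ℚ.toℚᵘ-fromℚᵘ (ιᵘ (m ℕ.* n)))
    (ℚᵘ.≃-trans (ℚᵘ.*≡* (cong (ℤ._* + 1) (ℤ.pos-* m n)))
    (ℚᵘ.≃-sym (ℚᵘ.≃-trans (ℚ.toℚᵘ-homo-* (ι m) (ι n))
      (ℚᵘ.*-cong (ℚ.toℚᵘ-fromℚᵘ (ιᵘ m)) (ℚ.toℚᵘ-fromℚᵘ (ιᵘ n)))))))

  ι-^ : ∀ m n → ι (m ℕ.^ n) ≡ ι m ^ n
  ι-^ m zero    = refl
  ι-^ m (suc n) = trans (ι-* m (m ℕ.^ n)) (cong (ι m *_) (ι-^ m n))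

  ι-nonNeg : ∀ n → 0ℚ ≤ ι n
  ι-nonNeg n = ℚ.nonNegative⁻¹ (ι n) {{ℚ.normalize-nonNeg n 1}}

  ι-mono : ∀ {m n} → m ℕ.≤ n → ι m ≤ ι n
  ι-mono {m} {n} m≤n = subst₂ _≤_ (ℚ.+-identityʳ (ι m))
    (trans (sym (ι-+ m (n ℕ.∸ m))) (cong ι (ℕ.m+[n∸m]≡n m≤n)))
    (ℚ.+-monoʳ-≤ (ι m) (ι-nonNeg (n ℕ.∸ m)))

  ι-pos : ∀ {n} → 0 ℕ.< n → 0ℚ < ι n
  ι-pos {n} 0<n = ℚ.<-≤-trans (ℚ.positive⁻¹ 1ℚ) (ι-mono 0<n)

  ι-∑ : {A : Set} (xs : List A) (f : A → ℕ) → ι (∑ℕ.∑ xs f) ≡ ∑ xs (ι ∘ f)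
  ι-∑ []       f = refl
  ι-∑ (x ∷ xs) f = trans (ι-+ (f x) _) (cong (ℚ._+_ (ι (f x))) (ι-∑ xs f))

  ι-𝟙 : {P : Set} (P? : Dec P) → ι (∑ℕ.𝟙 P?) ≡ 𝟙 P?
  ι-𝟙 (yes _) = refl
  ι-𝟙 (no  _) = refl

  ∑-const : {A : Set} (xs : List A) (c : ℚ) → ∑ xs (λ _ → c) ≡ ι (length xs) * c
  ∑-const []       c = sym (ℚ.*-zeroˡ c)
  ∑-const (x ∷ xs) c = trans (cong₂ _+_ (sym (ℚ.*-identityˡ c)) (∑-const xs c))
    (trans (sym (ℚ.*-distribʳ-+ c 1ℚ (ι (length xs)))) (cong (_* c) (sym (ι-+ 1 (length xs)))))

-- Random sublists and the moments of a family of tuples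

-- A vector over `Maybe A` is a template for tuples: `just e` prescribes an entry, `nothing` leaves
-- it open. For templates of length r, `fixed` is the j of the overview and `free` is r - j.
fixed free : {A : Set} {k : ℕ} → Vec (Maybe A) k → ℕ
fixed []            = 0
fixed (nothing ∷ τ) = fixed τ
fixed (just _ ∷ τ)  = suc (fixed τ)
free []            = 0
free (nothing ∷ τ) = suc (free τ)
free (just _ ∷ τ)  = free τ

free+fixed : {A : Set} {k : ℕ} (τ : Vec (Maybe A) k) → free τ ℕ.+ fixed τ ≡ k
free+fixed []            = refl
free+fixed (nothing ∷ τ) = cong suc (free+fixed τ)
free+fixed (just _ ∷ τ)  = trans (ℕ.+-suc (free τ) (fixed τ)) (cong suc (free+fixed τ))

Match : {A : Set} {k : ℕ} → Vec (Maybe A) k → Vec A k → Set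
Match []            []      = ⊤
Match (nothing ∷ τ) (x ∷ S) = Match τ S
Match (just e ∷ τ)  (x ∷ S) = e ≡ x × Match τ S

module RandomSublist {A : Set} (_≟_ : DecidableEquality A) where
  open DecMembership _≟_ using (_∈?_)
  open import Data.Rational.Base using (_+_; _*_; _-_; -_; _≤_; _<_)
  open Rational
  open ∑ℚ
  open +-*-Solver using (solve; _:=_; _:+_; _:*_; _:-_; :-_; con)

  match? : ∀ {k} (τ : Vec (Maybe A) k) (S : Vec A k) → Dec (Match τ S)
  match? []            []      = yes tt
  match? (nothing ∷ τ) (x ∷ S) = match? τ S
  match? (just e ∷ τ)  (x ∷ S) = (e ≟ x) ×-dec match? τ S

  -- Expectation when each element is kept independently with probability `q`, by conditioning on
  -- the head. The recursion reduces linearity, monotonicity and continuity in `q` to inductions on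
  -- the list; `∑-sublists` identifies it with the weighted sum over all sublists.
  𝔼 : ℚ → List A → (List A → ℚ) → ℚ
  𝔼 q []       f = f []
  𝔼 q (x ∷ xs) f = (1ℚ - q) * 𝔼 q xs f + q * 𝔼 q xs (f ∘ (x ∷_))

  private
    convex : ∀ q c → (1ℚ - q) * c + q * c ≡ c
    convex = solve 2 (λ q c → (con 1ℚ :- q) :* c :+ q :* c := c) refl

  ⊆-skip : ∀ {x} {H L : List A} → (∀ {y} → y ∈ H → y ∈ L) → ∀ {y} → y ∈ H → y ∈ x ∷ L
  ⊆-skip H⊆L = there ∘ H⊆L

  ⊆-keep : ∀ {x} {H L : List A} → (∀ {y} → y ∈ H → y ∈ L) → ∀ {y} → y ∈ x ∷ H → y ∈ x ∷ L
  ⊆-keep H⊆L (here eq)  = here eq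
  ⊆-keep H⊆L (there y∈) = there (H⊆L y∈)

  -- Agreement is asked only for `H` with entries in `L`. In `𝔼-included` this is what makes the
  -- head of a duplicate-free list absent from every sublist of its tail.
  𝔼-cong : ∀ q L {f g : List A → ℚ} →
           (∀ H → (∀ {x} → x ∈ H → x ∈ L) → f H ≡ g H) → 𝔼 q L f ≡ 𝔼 q L g
  𝔼-cong q []      eq = eq [] id
  𝔼-cong q (x ∷ L) eq = cong₂ (λ a b → (1ℚ - q) * a + q * b)
    (𝔼-cong q L λ H H⊆L → eq H (⊆-skip H⊆L))
    (𝔼-cong q L λ H H⊆L → eq (x ∷ H) (⊆-keep H⊆L))

  𝔼-mono : ∀ {q} → 0ℚ ≤ q → q ≤ 1ℚ → ∀ L {f g : List A → ℚ} →
           (∀ H → (∀ {x} → x ∈ H → x ∈ L) → f H ≤ g H) → 𝔼 q L f ≤ 𝔼 q L g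
  𝔼-mono 0≤q q≤1 []      le = le [] id
  𝔼-mono 0≤q q≤1 (x ∷ L) le = ℚ.+-mono-≤
    (*-monoˡ (a≤b⇒0≤b-a q≤1) (𝔼-mono 0≤q q≤1 L λ H H⊆L → le H (⊆-skip H⊆L)))
    (*-monoˡ 0≤q (𝔼-mono 0≤q q≤1 L λ H H⊆L → le (x ∷ H) (⊆-keep H⊆L)))

  𝔼-const : ∀ q L c → 𝔼 q L (λ _ → c) ≡ c
  𝔼-const q []      c = refl
  𝔼-const q (x ∷ L) c rewrite 𝔼-const q L c = convex q c

  𝔼-+ : ∀ q L {f g : List A → ℚ} → 𝔼 q L (λ H → f H + g H) ≡ 𝔼 q L f + 𝔼 q L g
  𝔼-+ q []      = refl
  𝔼-+ q (x ∷ L) {f} {g} = trans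
    (cong₂ (λ a b → (1ℚ - q) * a + q * b) (𝔼-+ q L) (𝔼-+ q L))
    (rearrange (1ℚ - q) q (𝔼 q L f) (𝔼 q L g) (𝔼 q L (f ∘ (x ∷_))) (𝔼 q L (g ∘ (x ∷_))))
    where
    rearrange : ∀ p q a b c d → p * (a + b) + q * (c + d) ≡ (p * a + q * c) + (p * b + q * d)
    rearrange = solve 6 (λ p q a b c d →
      p :* (a :+ b) :+ q :* (c :+ d) := (p :* a :+ q :* c) :+ (p :* b :+ q :* d)) refl

  𝔼-* : ∀ q L c {f : List A → ℚ} → 𝔼 q L (λ H → c * f H) ≡ c * 𝔼 q L f
  𝔼-* q []      c = refl
  𝔼-* q (x ∷ L) c {f} = trans
    (cong₂ (λ a b → (1ℚ - q) * a + q * b) (𝔼-* q L c) (𝔼-* q L c))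
    (rearrange (1ℚ - q) q c (𝔼 q L f) (𝔼 q L (f ∘ (x ∷_))))
    where
    rearrange : ∀ p q c a b → p * (c * a) + q * (c * b) ≡ c * (p * a + q * b)
    rearrange = solve 5 (λ p q c a b →
      p :* (c :* a) :+ q :* (c :* b) := c :* (p :* a :+ q :* b)) refl

  𝔼-∑ : ∀ {B : Set} q L (xs : List B) {f : B → List A → ℚ} →
        𝔼 q L (λ H → ∑ xs (λ x → f x H)) ≡ ∑ xs (λ x → 𝔼 q L (f x))
  𝔼-∑ q L []       = 𝔼-const q L 0ℚ
  𝔼-∑ q L (x ∷ xs) {f} = trans (𝔼-+ q L) (cong (𝔼 q L (f x) +_) (𝔼-∑ q L xs))

  length-sublists : ∀ {H : List A} (L : List A) → H ∈ sublists L → length H ℕ.≤ length L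
  length-sublists []      (here refl) = z≤n
  length-sublists (x ∷ L) H∈ with ∈-++⁻ (sublists L) H∈
  ... | inj₁ H∈′ = ℕ.m≤n⇒m≤1+n (length-sublists L H∈′)
  ... | inj₂ H∈′ with ∈-map⁻ (x ∷_) H∈′
  ...   | _ , H′∈ , refl = s≤s (length-sublists L H′∈)

  -- A sublist that omits the head has one more absent element, hence a factor 1 - q; one that keeps
  -- it gains a factor q. The truncated subtraction is harmless because a sublist is never longer
  -- than the list.
  ∑-sublists : ∀ q L (f : List A → ℚ) →
    ∑ (sublists L) (λ H → q ^ length H * (1ℚ - q) ^ (length L ℕ.∸ length H) * f H) ≡ 𝔼 q L f
  ∑-sublists q []      f = trans (ℚ.+-identityʳ _) (ℚ.*-identityˡ (f []))
  ∑-sublists q (x ∷ L) f = trans (∑-++ (sublists L) (List.map (x ∷_) (sublists L)))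
    (cong₂ _+_
      (trans (∑-cong (sublists L) λ H H∈ → trans
               (cong (λ k → q ^ length H * (1ℚ - q) ^ k * f H)
                     (ℕ.+-∸-assoc 1 (length-sublists L H∈)))
               (pull₁ (q ^ length H) (1ℚ - q) ((1ℚ - q) ^ (length L ℕ.∸ length H)) (f H)))
        (trans (sym (*-distribˡ-∑ (sublists L) (1ℚ - q)))
               (cong ((1ℚ - q) *_) (∑-sublists q L f))))
      (trans (∑-map (x ∷_) (sublists L))
        (trans (∑-cong (sublists L) λ H H∈ →
                 pull₂ q (q ^ length H) ((1ℚ - q) ^ (length L ℕ.∸ length H)) (f (x ∷ H)))
        (trans (sym (*-distribˡ-∑ (sublists L) q))
               (cong (q *_) (∑-sublists q L (f ∘ (x ∷_))))))))
    where
    pull₁ : ∀ a p b c → a * (p * b) * c ≡ p * (a * b * c)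
    pull₁ = solve 4 (λ a p b c → a :* (p :* b) :* c := p :* (a :* b :* c)) refl
    pull₂ : ∀ q a b c → q * a * b * c ≡ q * (a * b * c)
    pull₂ = solve 4 (λ q a b c → q :* a :* b :* c := q :* (a :* b :* c)) refl

  included : List A → List A → ℚ
  included []      H = 1ℚ
  included (x ∷ U) H = 𝟙 (x ∈? H) * included U H

  included-++ : ∀ U V H → included (U ++ V) H ≡ included U H * included V H
  included-++ []      V H = sym (ℚ.*-identityˡ _)
  included-++ (x ∷ U) V H = trans (cong (𝟙 (x ∈? H) *_) (included-++ U V H))
    (sym (ℚ.*-assoc (𝟙 (x ∈? H)) (included U H) (included V H)))

  included-nonNeg : ∀ U H → 0ℚ ≤ included U H
  included-nonNeg []      H = 0≤1
  included-nonNeg (x ∷ U) H = *-nonNeg (𝟙-nonNeg (x ∈? H)) (included-nonNeg U H)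

  included-yes : ∀ {U H} → All (_∈ H) U → included U H ≡ 1ℚ
  included-yes []         = refl
  included-yes {x ∷ U} {H} (x∈ ∷ U⊆) =
    trans (cong₂ _*_ (𝟙-yes (x ∈? H) x∈) (included-yes U⊆)) (ℚ.*-identityˡ 1ℚ)

  included-no : ∀ {y} U {H} → y ∈ U → y ∉ H → included U H ≡ 0ℚ
  included-no (x ∷ U) {H} (here refl) y∉ =
    trans (cong (_* included U H) (𝟙-no (x ∈? H) y∉)) (ℚ.*-zeroˡ (included U H))
  included-no (x ∷ U) {H} (there y∈) y∉ =
    trans (cong (𝟙 (x ∈? H) *_) (included-no U y∈ y∉)) (ℚ.*-zeroʳ (𝟙 (x ∈? H)))

  included-dichotomy : ∀ U H → All (_∈ H) U ⊎ included U H ≡ 0ℚ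
  included-dichotomy U H with All.all? (_∈? H) U
  ... | yes U⊆H = inj₁ U⊆H
  ... | no  U⊈H =
    let x , x∈U , x∉H = find (All.¬All⇒Any¬ (_∈? H) U U⊈H) in inj₂ (included-no U x∈U x∉H)

  infixl 6 _∖_
  _∖_ : List A → A → List A
  U ∖ y = filter (λ x → ¬? (x ≟ y)) U

  ∖-absent : ∀ {y} U → y ∉ U → U ∖ y ≡ U
  ∖-absent {y} U y∉U = filter-all (λ x → ¬? (x ≟ y)) (All.tabulate λ x∈U x≡y → y∉U (subst (_∈ U) x≡y x∈U))

  -- The presence of `y` satisfies the requirement at every occurrence of `y` in `U`, so all of them
  -- drop out together.
  included-∷ : ∀ U y H → included U (y ∷ H) ≡ included (U ∖ y) H
  included-∷ []      y H = refl
  included-∷ (x ∷ U) y H = by (x ≟ y)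
    where
    drop : x ≢ y → x ∈ y ∷ H → x ∈ H
    drop x≢y (here x≡y) = ⊥-elim (x≢y x≡y)
    drop x≢y (there x∈) = x∈
    by : Dec (x ≡ y) → included (x ∷ U) (y ∷ H) ≡ included ((x ∷ U) ∖ y) H
    by (yes x≡y) = trans
      (trans (cong₂ _*_ (𝟙-yes (x ∈? y ∷ H) (here x≡y)) (included-∷ U y H)) (ℚ.*-identityˡ _))
      (cong (λ V → included V H) (sym (filter-reject (λ z → ¬? (z ≟ y)) (λ x≢y → x≢y x≡y))))
    by (no x≢y) = trans
      (cong₂ _*_ (𝟙-cong (x ∈? y ∷ H) (x ∈? H) (drop x≢y) there) (included-∷ U y H))
      (cong (λ V → included V H) (sym (filter-accept (λ z → ¬? (z ≟ y)) x≢y)))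

  unless : {P : Set} → ℚ → Dec P → ℚ
  unless q (yes _) = 1ℚ
  unless q (no  _) = q

  unless-cong : {P Q : Set} → ∀ q (P? : Dec P) (Q? : Dec Q) →
                (P → Q) → (Q → P) → unless q P? ≡ unless q Q?
  unless-cong q (yes p) (yes _) _   _   = refl
  unless-cong q (yes p) (no ¬q) P⇒Q _   = ⊥-elim (¬q (P⇒Q p))
  unless-cong q (no ¬p) (yes q′) _  Q⇒P = ⊥-elim (¬p (Q⇒P q′))
  unless-cong q (no ¬p) (no _)  _   _   = refl

  -- q to the number of distinct elements of the list
  distinctPower : ℚ → List A → ℚ
  distinctPower q []      = 1ℚ
  distinctPower q (x ∷ U) = unless q (x ∈? U) * distinctPower q U

  -- Deleting all copies of `y` loses one distinct element. A copy followed by another copy has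
  -- weight 1 and is skipped; the last one carries the factor `q`.
  distinctPower-∖ : ∀ q {y} U → y ∈ U → distinctPower q U ≡ q * distinctPower q (U ∖ y)
  distinctPower-∖ q {y} (x ∷ U) y∈ with x ≟ y
  ... | yes refl with x ∈? U
  ...   | yes x∈U = trans (ℚ.*-identityˡ _) (distinctPower-∖ q U x∈U)
  ...   | no  x∉U = cong (λ V → q * distinctPower q V) (sym (∖-absent U x∉U))
  distinctPower-∖ q {y} (x ∷ U) (here y≡x) | no x≢y = ⊥-elim (x≢y (sym y≡x))
  distinctPower-∖ q {y} (x ∷ U) (there y∈U) | no x≢y = trans
    (cong₂ _*_
      (unless-cong q (x ∈? U) (x ∈? U ∖ y)
        (λ x∈ → ∈-filter⁺ (λ z → ¬? (z ≟ y)) x∈ x≢y)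
        (λ x∈ → proj₁ (∈-filter⁻ (λ z → ¬? (z ≟ y)) {xs = U} x∈)))
      (distinctPower-∖ q U y∈U))
    (pull (unless q (x ∈? U ∖ y)) q (distinctPower q (U ∖ y)))
    where
    pull : ∀ a q b → a * (q * b) ≡ q * (a * b)
    pull = solve 3 (λ a q b → a :* (q :* b) := q :* (a :* b)) refl

  -- Induction on the ground list with head `y`. If `y` is required, the branch without it vanishes
  -- and the branch with it contributes `q` and discharges the requirement. If not, both branches
  -- agree and their weights add up to 1.
  𝔼-included : ∀ q {L} → Unique L → ∀ U → All (_∈ L) U → 𝔼 q L (included U) ≡ distinctPower q U
  𝔼-included q {[]}    []          []      []         = refl
  𝔼-included q {[]}    []          (x ∷ U) (() ∷ _)
  𝔼-included q {y ∷ L} (y∉L ∷ uniq) U U⊆ = trans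
    (cong (λ a → (1ℚ - q) * 𝔼 q L (included U) + q * a)
      (trans (𝔼-cong q L λ H _ → included-∷ U y H) (𝔼-included q uniq (U ∖ y) U∖y⊆L)))
    split
    where
    keep : ∀ {x} → x ∈ U × x ≢ y → x ∈ L
    keep (x∈U , x≢y) with All.lookup U⊆ x∈U
    ... | here x≡y = ⊥-elim (x≢y x≡y)
    ... | there x∈L = x∈L
    U∖y⊆L : All (_∈ L) (U ∖ y)
    U∖y⊆L = All.tabulate λ x∈ → keep (∈-filter⁻ (λ z → ¬? (z ≟ y)) {xs = U} x∈)
    split : (1ℚ - q) * 𝔼 q L (included U) + q * distinctPower q (U ∖ y) ≡ distinctPower q U
    split with y ∈? U
    ... | yes y∈U = trans
      (cong₂ (λ a b → (1ℚ - q) * a + b)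
        (trans (𝔼-cong q L λ H H⊆L → included-no U y∈U λ y∈H → All.lookup y∉L (H⊆L y∈H) refl)
               (𝔼-const q L 0ℚ))
        (sym (distinctPower-∖ q U y∈U)))
      (trans (cong (_+ distinctPower q U) (ℚ.*-zeroʳ (1ℚ - q))) (ℚ.+-identityˡ _))
    ... | no  y∉U = trans
      (cong₂ (λ a b → (1ℚ - q) * a + q * b)
        (𝔼-included q uniq U (subst (All (_∈ L)) (∖-absent U y∉U) U∖y⊆L))
        (cong (distinctPower q) (∖-absent U y∉U)))
      (convex q (distinctPower q U))

  distinctPower-unique : ∀ q {U} → Unique U → distinctPower q U ≡ q ^ length U
  distinctPower-unique q []             = refl
  distinctPower-unique q {x ∷ U} (x∉ ∷ uniq) with x ∈? U
  ... | yes x∈ = ⊥-elim (All.lookup x∉ x∈ refl)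
  ... | no  _  = cong (q *_) (distinctPower-unique q uniq)

  -- For a tuple of distinct entries, this is the conditional probability that it is present given
  -- that `V` is.
  outsidePower : ∀ {k} → ℚ → List A → Vec A k → ℚ
  outsidePower q V []      = 1ℚ
  outsidePower q V (x ∷ S) = unless q (x ∈? V) * outsidePower q V S

  distinctPower-++ : ∀ q {k} (S : Vec A k) V → Unique (toList S) →
    distinctPower q (toList S ++ V) ≡ outsidePower q V S * distinctPower q V
  distinctPower-++ q []      V []          = sym (ℚ.*-identityˡ _)
  distinctPower-++ q (x ∷ S) V (x∉ ∷ uniq) = trans
    (cong₂ _*_ (unless-cong q (x ∈? toList S ++ V) (x ∈? V) drop (∈-++⁺ʳ (toList S)))
               (distinctPower-++ q S V uniq))
    (sym (ℚ.*-assoc (unless q (x ∈? V)) (outsidePower q V S) (distinctPower q V)))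
    where
    drop : x ∈ toList S ++ V → x ∈ V
    drop x∈ with ∈-++⁻ (toList S) x∈
    ... | inj₁ x∈S = ⊥-elim (All.lookup x∉ x∈S refl)
    ... | inj₂ x∈V = x∈V

  templates : List (Maybe A) → (k : ℕ) → List (Vec (Maybe A) k)
  templates O zero    = [] ∷ []
  templates O (suc k) = concatMap (λ o → List.map (o ∷_) (templates O k)) O

  length-templates : ∀ O k → length (templates O k) ≡ length O ℕ.^ k
  length-templates O zero    = refl
  length-templates O (suc k) = trans (go O) (cong (length O ℕ.*_) (length-templates O k))
    where
    go : ∀ O′ → length (concatMap (λ o → List.map (o ∷_) (templates O k)) O′) ≡
                length O′ ℕ.* length (templates O k)
    go []       = refl
    go (o ∷ O′) = trans (length-++ (List.map (o ∷_) (templates O k)))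
      (cong₂ ℕ._+_ (length-map (o ∷_) (templates O k)) (go O′))

  options : List A → List (Maybe A)
  options V = nothing ∷ List.map just V

  -- The template that records the entries shared with `V`. It witnesses how a pair of tuples
  -- overlaps: `S` matches it, and its open positions are those where `S` lies outside `V`.
  traceOn : ∀ {k} → List A → Vec A k → Vec (Maybe A) k
  traceOn V []      = []
  traceOn V (x ∷ S) with x ∈? V
  ... | yes _ = just x ∷ traceOn V S
  ... | no  _ = nothing ∷ traceOn V S

  traceOn-match : ∀ {k} V (S : Vec A k) → Match (traceOn V S) S
  traceOn-match V []      = tt
  traceOn-match V (x ∷ S) with x ∈? V
  ... | yes _ = refl , traceOn-match V S
  ... | no  _ = traceOn-match V S

  ∷∈templates : ∀ {O k o} {τ : Vec (Maybe A) k} → o ∈ O → τ ∈ templates O k → o ∷ τ ∈ templates O (suc k)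
  ∷∈templates {O} {k} {o} o∈ τ∈ =
    ∈-concatMap⁺ (λ o → List.map (o ∷_) (templates O k)) (Any.map (λ { refl → ∈-map⁺ (o ∷_) τ∈ }) o∈)

  traceOn∈templates : ∀ {k} V (S : Vec A k) → traceOn V S ∈ templates (options V) k
  traceOn∈templates V []      = here refl
  traceOn∈templates V (x ∷ S) with x ∈? V
  ... | yes x∈V = ∷∈templates (there (∈-map⁺ just x∈V)) (traceOn∈templates V S)
  ... | no  _   = ∷∈templates (here refl) (traceOn∈templates V S)

  outsidePower-traceOn : ∀ {k} q V (S : Vec A k) → outsidePower q V S ≡ q ^ free (traceOn V S)
  outsidePower-traceOn q V []      = refl
  outsidePower-traceOn q V (x ∷ S) with x ∈? V
  ... | yes _ = trans (ℚ.*-identityˡ _) (outsidePower-traceOn q V S)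
  ... | no  _ = cong (q *_) (outsidePower-traceOn q V S)

  module Moments
    {q : ℚ} (0≤q : 0ℚ ≤ q) (q≤1 : q ≤ 1ℚ) {L : List A} (L-unique : Unique L) {r : ℕ}
    (𝓕 : List (Vec A r))
    (𝓕-unique : ∀ {S} → S ∈ 𝓕 → Unique (toList S))
    (𝓕⊆L : ∀ {S} → S ∈ 𝓕 → All (_∈ L) (toList S))
    where

    X : List A → ℚ
    X H = ∑ 𝓕 (λ S → included (toList S) H)

    μ : ℚ
    μ = ι (length 𝓕) * q ^ r

    distinctPower-𝓕 : ∀ {S} → S ∈ 𝓕 → distinctPower q (toList S) ≡ q ^ r
    distinctPower-𝓕 {S} S∈ = trans (distinctPower-unique q (𝓕-unique S∈)) (cong (q ^_) (length-toList S))

    𝔼X : 𝔼 q L X ≡ μ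
    𝔼X = trans (𝔼-∑ q L 𝓕) (trans
      (∑-cong 𝓕 λ S S∈ → trans (𝔼-included q L-unique (toList S) (𝓕⊆L S∈)) (distinctPower-𝓕 S∈))
      (∑-const 𝓕 (q ^ r)))

    X-nonNeg : ∀ H → 0ℚ ≤ X H
    X-nonNeg H = ∑-nonNeg 𝓕 λ S _ → included-nonNeg (toList S) H

    -- Markov's inequality pointwise: a single present tuple already contributes 1 to `X H`.
    firstMoment : {E : List A → Set} (E? : ∀ H → Dec (E H)) →
      (∀ H → (∀ {x} → x ∈ H → x ∈ L) → E H → ∃[ S ] S ∈ 𝓕 × All (_∈ H) (toList S)) →
      𝔼 q L (λ H → 𝟙 (E? H)) ≤ μ
    firstMoment {E} E? complete = subst (𝔼 q L (λ H → 𝟙 (E? H)) ≤_) 𝔼X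
      (𝔼-mono 0≤q q≤1 L λ H H⊆L → markov H H⊆L (E? H))
      where
      markov : ∀ H → (∀ {x} → x ∈ H → x ∈ L) → (e : Dec (E H)) → 𝟙 e ≤ X H
      markov H H⊆L (no _)  = X-nonNeg H
      markov H H⊆L (yes e) =
        let S , S∈ , S⊆H = complete H H⊆L e in
        subst (_≤ X H) (included-yes S⊆H)
          (term≤∑ 𝓕 (λ S′ → included-nonNeg (toList S′) H) S∈)

    -- E[X²] - E[X]² is a sum over pairs of tuples; a pair contributes only if the second
    -- tuple shares entries with the first, i.e. matches a template filled from the first.
    shared : ∀ {k} → Vec (Maybe A) k → ℚ
    shared τ = 𝟙 (1 ℕ.≤? fixed τ) * q ^ free τ

    shared-nonNeg : ∀ {k} (τ : Vec (Maybe A) k) → 0ℚ ≤ shared τ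
    shared-nonNeg τ = *-nonNeg (𝟙-nonNeg (1 ℕ.≤? fixed τ)) (^-nonNeg (free τ) 0≤q)

    -- If `S` meets `V`, the summand of its own trace equals the left side. If not, all positions
    -- are open and the left side is `q ^ k`. All other summands are nonnegative.
    outsidePower-≤ : ∀ {k} V (S : Vec A k) →
      outsidePower q V S ≤ q ^ k + ∑ (templates (options V) k) (λ τ → shared τ * 𝟙 (match? τ S))
    outsidePower-≤ {k} V S = subst (_≤ q ^ k + rest) (sym (outsidePower-traceOn q V S)) (by (1 ℕ.≤? fixed τ*))
      where
      τ* = traceOn V S
      rest = ∑ (templates (options V) k) (λ τ → shared τ * 𝟙 (match? τ S))
      term-nonNeg : ∀ (τ : Vec (Maybe A) k) → 0ℚ ≤ shared τ * 𝟙 (match? τ S)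
      term-nonNeg τ = *-nonNeg (shared-nonNeg τ) (𝟙-nonNeg (match? τ S))
      rest-nonNeg : 0ℚ ≤ rest
      rest-nonNeg = ∑-nonNeg (templates (options V) k) λ τ _ → term-nonNeg τ
      by : Dec (1 ℕ.≤ fixed τ*) → q ^ free τ* ≤ q ^ k + rest
      by (yes 1≤) = subst₂ _≤_ (ℚ.+-identityˡ (q ^ free τ*)) refl (ℚ.+-mono-≤ (^-nonNeg k 0≤q)
        (subst (_≤ rest)
          (trans (cong₂ (λ a b → a * q ^ free τ* * b)
                   (𝟙-yes (1 ℕ.≤? fixed τ*) 1≤) (𝟙-yes (match? τ* S) (traceOn-match V S)))
                 (trans (ℚ.*-identityʳ (1ℚ * q ^ free τ*)) (ℚ.*-identityˡ (q ^ free τ*))))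
          (term≤∑ (templates (options V) k) term-nonNeg (traceOn∈templates V S))))
      by (no 1≰) = subst₂ _≤_
        (trans (ℚ.+-identityʳ (q ^ k)) (cong (q ^_) (sym
          (trans (sym (ℕ.+-identityʳ (free τ*)))
            (trans (cong (free τ* ℕ.+_) (sym (ℕ.n<1⇒n≡0 (ℕ.≰⇒> 1≰)))) (free+fixed τ*))))))
        refl (ℚ.+-monoʳ-≤ (q ^ k) rest-nonNeg)

    -- The d of the overview, for the entries prescribed by the template.
    count : Vec (Maybe A) r → ℕ
    count τ = ∑ℕ.∑ 𝓕 (λ S → ∑ℕ.𝟙 (match? τ S))

    ∑-match : ∀ τ → ∑ 𝓕 (λ S → 𝟙 (match? τ S)) ≡ ι (count τ)
    ∑-match τ = trans (∑-cong 𝓕 λ S _ → sym (ι-𝟙 (match? τ S))) (sym (ι-∑ 𝓕 _))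

    pairSum : Vec A r → ℚ
    pairSum S = ∑ (templates (options (toList S)) r) (λ τ → shared τ * ι (count τ))

    -- Given that `S` is present, `S′` is present with probability `outsidePower`. The summand
    -- `q ^ r` of the bound for it adds up to μ², and the sums over templates bound the variance.
    𝔼X² : 𝔼 q L (λ H → X H * X H) ≤ μ * μ + q ^ r * ∑ 𝓕 pairSum
    𝔼X² = begin
      𝔼 q L (λ H → X H * X H)
        ≡⟨ 𝔼-cong q L (λ H _ → trans (*-distribˡ-∑ 𝓕 (X H)) (∑-cong 𝓕 λ S _ → trans
             (ℚ.*-comm (X H) (included (toList S) H))
             (trans (*-distribˡ-∑ 𝓕 (included (toList S) H)) (∑-cong 𝓕 λ S′ _ → trans
               (ℚ.*-comm (included (toList S) H) (included (toList S′) H))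
               (sym (included-++ (toList S′) (toList S) H)))))) ⟩
      𝔼 q L (λ H → ∑ 𝓕 λ S → ∑ 𝓕 λ S′ → included (toList S′ ++ toList S) H)
        ≡⟨ trans (𝔼-∑ q L 𝓕) (∑-cong 𝓕 λ S _ → 𝔼-∑ q L 𝓕) ⟩
      (∑ 𝓕 λ S → ∑ 𝓕 λ S′ → 𝔼 q L (included (toList S′ ++ toList S)))
        ≡⟨ ∑-cong 𝓕 (λ S S∈ → ∑-cong 𝓕 λ S′ S′∈ → trans
             (𝔼-included q L-unique (toList S′ ++ toList S) (All.++⁺ (𝓕⊆L S′∈) (𝓕⊆L S∈)))
             (trans (distinctPower-++ q S′ (toList S) (𝓕-unique S′∈))
               (trans (cong (outsidePower q (toList S) S′ *_) (distinctPower-𝓕 S∈))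
                      (ℚ.*-comm (outsidePower q (toList S) S′) (q ^ r))))) ⟩
      (∑ 𝓕 λ S → ∑ 𝓕 λ S′ → q ^ r * outsidePower q (toList S) S′)
        ≤⟨ ∑-mono-≤ 𝓕 (λ S _ → ∑-mono-≤ 𝓕 λ S′ _ →
             *-monoˡ (^-nonNeg r 0≤q) (outsidePower-≤ (toList S) S′)) ⟩
      (∑ 𝓕 λ S → ∑ 𝓕 λ S′ → q ^ r * (q ^ r + ∑ (templates (options (toList S)) r) (λ τ → shared τ * 𝟙 (match? τ S′))))
        ≡⟨ ∑-cong 𝓕 (λ S _ → trans (sym (*-distribˡ-∑ 𝓕 (q ^ r))) (cong (q ^ r *_) (inner S))) ⟩
      (∑ 𝓕 λ S → q ^ r * (μ + pairSum S))
        ≡⟨ trans (sym (*-distribˡ-∑ 𝓕 (q ^ r)))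
             (trans (cong (q ^ r *_) (trans (∑-distrib-+ 𝓕) (cong (_+ ∑ 𝓕 pairSum) (∑-const 𝓕 μ))))
                    (rearrange (q ^ r) (ι (length 𝓕)) μ (∑ 𝓕 pairSum))) ⟩
      μ * μ + q ^ r * ∑ 𝓕 pairSum ∎
      where
      open ℚ.≤-Reasoning
      rearrange : ∀ a b c d → a * (b * c + d) ≡ b * a * c + a * d
      rearrange = solve 4 (λ a b c d → a :* (b :* c :+ d) := b :* a :* c :+ a :* d) refl
      inner : ∀ S →
        (∑ 𝓕 λ S′ → q ^ r + ∑ (templates (options (toList S)) r) (λ τ → shared τ * 𝟙 (match? τ S′))) ≡
        μ + pairSum S
      inner S = trans (∑-distrib-+ 𝓕) (cong₂ _+_ (∑-const 𝓕 (q ^ r))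
        (trans (∑-comm 𝓕 𝒯) (∑-cong 𝒯 λ τ _ →
          trans (sym (*-distribˡ-∑ 𝓕 (shared τ))) (cong (shared τ *_) (∑-match τ)))))
        where 𝒯 = templates (options (toList S)) r

    -- Chebyshev's inequality without division. The premise bounding `count` is the only
    -- quantitative fact about the family that enters; it is dʳ ≤ T^(r - j).
    secondMoment : {E : List A → Set} (E? : ∀ H → Dec (E H)) →
      (∀ H → (∃[ S ] S ∈ 𝓕 × All (_∈ H) (toList S)) → E H) →
      1 ℕ.≤ r →
      (∀ τ → 1 ℕ.≤ fixed τ → count τ ℕ.^ r ℕ.≤ length 𝓕 ℕ.^ free τ) →
      ∀ {c} → 1ℚ ≤ c → c ^ r ≤ μ →
      c * (1ℚ - 𝔼 q L (λ H → 𝟙 (E? H))) ≤ ι (suc r ℕ.^ r)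
    secondMoment {E} E? sound (s≤s {n = r-1} _) few {c} 1≤c c^r≤μ =
      -- Both sides are compared after multiplication by μ², which is positive because 1 ≤ c ^ r ≤
      -- μ.
      ℚ.*-cancelʳ-≤-pos (μ * μ) {{ℚ.positive (*-pos 0<μ 0<μ)}} (begin
        c * (1ℚ - P) * (μ * μ)
          ≡⟨ ℚ.*-assoc c (1ℚ - P) (μ * μ) ⟩
        c * ((1ℚ - P) * (μ * μ))
          ≤⟨ *-monoˡ 0≤c chebyshev ⟩
        c * (q ^ r * ∑ 𝓕 pairSum)
          ≡⟨ rearrange c (q ^ r) (∑ 𝓕 pairSum) ⟩
        q ^ r * (c * ∑ 𝓕 pairSum)
          ≤⟨ *-monoˡ (^-nonNeg r 0≤q) pairs ⟩
        q ^ r * (ι (length 𝓕) * (ι K * μ))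
          ≡⟨ collect (q ^ r) (ι (length 𝓕)) (ι K) μ ⟩
        ι K * (μ * μ) ∎)
      where
      open ℚ.≤-Reasoning
      -- The number of templates filled from an `r`-tuple: each position is open or holds one of its
      -- `r` entries.
      K = suc r ℕ.^ r
      P = 𝔼 q L (λ H → 𝟙 (E? H))
      0≤c : 0ℚ ≤ c
      0≤c = ℚ.≤-trans 0≤1 1≤c
      1≤μ : 1ℚ ≤ μ
      1≤μ = ℚ.≤-trans (1≤^ r 1≤c) c^r≤μ
      0<μ : 0ℚ < μ
      0<μ = ℚ.<-≤-trans (ℚ.positive⁻¹ 1ℚ) 1≤μ
      0≤μ : 0ℚ ≤ μ
      0≤μ = ℚ.<⇒≤ 0<μ
      rearrange : ∀ a b d → a * (b * d) ≡ b * (a * d)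
      rearrange = solve 3 (λ a b d → a :* (b :* d) := b :* (a :* d)) refl
      collect : ∀ a b k m → a * (b * (k * m)) ≡ k * (b * a * m)
      collect = solve 4 (λ a b k m → a :* (b :* (k :* m)) := k :* (b :* a :* m)) refl

      -- The right side is (X - μ)², expanded so that linearity of `𝔼` applies. If the event holds,
      -- the left side is 0; if it fails, no tuple is present, X is 0 and both sides are μ².
      deviation : ∀ H (e : Dec (E H)) →
        (1ℚ - 𝟙 e) * (μ * μ) ≤ X H * X H + (- (μ + μ) * X H + μ * μ)
      deviation H (yes _) = subst₂ _≤_ (zero-left (μ * μ)) (square (X H) μ) (square-nonNeg (X H - μ))
        where
        zero-left : ∀ m → 0ℚ ≡ (1ℚ - 1ℚ) * m
        zero-left m = sym (ℚ.*-zeroˡ m)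
        square : ∀ x m → (x - m) * (x - m) ≡ x * x + (- (m + m) * x + m * m)
        square = solve 2 (λ x m → (x :- m) :* (x :- m) := x :* x :+ ((:- (m :+ m)) :* x :+ m :* m)) refl
      deviation H (no ¬e) = ℚ.≤-reflexive (trans (one (μ * μ)) (sym (trans
          (cong (λ x → x * x + (- (μ + μ) * x + μ * μ)) X≡0) (at-zero μ))))
        where
        one : ∀ m → (1ℚ - 0ℚ) * m ≡ m
        one m = ℚ.*-identityˡ m
        at-zero : ∀ m → 0ℚ * 0ℚ + (- (m + m) * 0ℚ + m * m) ≡ m * m
        at-zero = solve 1 (λ m → con 0ℚ :* con 0ℚ :+ ((:- (m :+ m)) :* con 0ℚ :+ m :* m) := m :* m) refl
        absent : ∀ S → S ∈ 𝓕 → included (toList S) H ≡ 0ℚ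
        absent S S∈ with included-dichotomy (toList S) H
        ... | inj₁ S⊆H = ⊥-elim (¬e (sound H (S , S∈ , S⊆H)))
        ... | inj₂ ≡0  = ≡0
        X≡0 : X H ≡ 0ℚ
        X≡0 = trans (∑-cong 𝓕 absent) (∑-zero 𝓕)

      chebyshev : (1ℚ - P) * (μ * μ) ≤ q ^ r * ∑ 𝓕 pairSum
      chebyshev = begin
        (1ℚ - P) * (μ * μ)
          ≡⟨ trans (expand P (μ * μ)) (sym (trans
               (𝔼-cong q L λ H _ → expand (𝟙 (E? H)) (μ * μ))
               (trans (𝔼-+ q L) (cong₂ _+_ (𝔼-const q L (μ * μ)) (𝔼-* q L (- (μ * μ))))))) ⟩
        𝔼 q L (λ H → (1ℚ - 𝟙 (E? H)) * (μ * μ))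
          ≤⟨ 𝔼-mono 0≤q q≤1 L (λ H _ → deviation H (E? H)) ⟩
        𝔼 q L (λ H → X H * X H + (- (μ + μ) * X H + μ * μ))
          ≡⟨ trans (𝔼-+ q L) (cong (𝔼 q L (λ H → X H * X H) +_)
               (trans (𝔼-+ q L) (cong₂ _+_
                 (trans (𝔼-* q L (- (μ + μ))) (cong (- (μ + μ) *_) 𝔼X)) (𝔼-const q L (μ * μ))))) ⟩
        𝔼 q L (λ H → X H * X H) + (- (μ + μ) * μ + μ * μ)
          ≤⟨ ℚ.+-monoˡ-≤ (- (μ + μ) * μ + μ * μ) 𝔼X² ⟩
        μ * μ + q ^ r * ∑ 𝓕 pairSum + (- (μ + μ) * μ + μ * μ)
          ≡⟨ cancel μ (q ^ r * ∑ 𝓕 pairSum) ⟩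
        q ^ r * ∑ 𝓕 pairSum ∎
        where
        expand : ∀ p m → (1ℚ - p) * m ≡ m + (- m) * p
        expand = solve 2 (λ p m → (con 1ℚ :- p) :* m := m :+ (:- m) :* p) refl
        cancel : ∀ m y → m * m + y + (- (m + m) * m + m * m) ≡ y
        cancel = solve 2 (λ m y → m :* m :+ y :+ ((:- (m :+ m)) :* m :+ m :* m) := y) refl

      c^r≤μ^ : ∀ j → 1 ℕ.≤ j → c ^ r ≤ μ ^ j
      c^r≤μ^ (suc j) _ = ℚ.≤-trans c^r≤μ
        (subst (_≤ μ * μ ^ j) (ℚ.*-identityʳ μ) (*-monoˡ 0≤μ (1≤^ j 1≤μ)))

      -- the r-th power of the left side is at most μ ^ free τ * (c ^ r) ^ fixed τ
      template-bound : ∀ τ → 1 ℕ.≤ fixed τ → c * (q ^ free τ * ι (count τ)) ≤ μ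
      template-bound τ 1≤fixed = ^-cancel-≤ r-1 0≤μ (begin
        (c * (q ^ f * d)) ^ r
          ≡⟨ trans (^-distrib-* c (q ^ f * d) r) (cong (c ^ r *_) (^-distrib-* (q ^ f) d r)) ⟩
        c ^ r * ((q ^ f) ^ r * d ^ r)
          ≤⟨ *-mono (^-nonNeg r 0≤c) (*-nonNeg (^-nonNeg r (^-nonNeg f 0≤q)) (^-nonNeg r (ι-nonNeg (count τ))))
               (c^r≤μ^ j 1≤fixed) (*-monoˡ (^-nonNeg r (^-nonNeg f 0≤q)) d^r≤T^f) ⟩
        μ ^ j * ((q ^ f) ^ r * ι (length 𝓕) ^ f)
          ≡⟨ cong (μ ^ j *_) (trans (cong (_* ι (length 𝓕) ^ f) (swap-^ q f r))
               (trans (ℚ.*-comm ((q ^ r) ^ f) (ι (length 𝓕) ^ f))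
                      (sym (^-distrib-* (ι (length 𝓕)) (q ^ r) f)))) ⟩
        μ ^ j * μ ^ f
          ≡⟨ trans (sym (^-homo-* μ j f)) (cong (μ ^_) (trans (ℕ.+-comm j f) (free+fixed τ))) ⟩
        μ ^ r ∎)
        where
        f = free τ
        j = fixed τ
        d = ι (count τ)
        swap-^ : ∀ a m n → (a ^ m) ^ n ≡ (a ^ n) ^ m
        swap-^ a m n = trans (^-assocʳ a m n) (trans (cong (a ^_) (ℕ.*-comm m n)) (sym (^-assocʳ a n m)))
        d^r≤T^f : d ^ r ≤ ι (length 𝓕) ^ f
        d^r≤T^f = subst₂ _≤_ (ι-^ (count τ) r) (ι-^ (length 𝓕) f) (ι-mono (few τ 1≤fixed))

      shared-bound : ∀ τ → c * (shared τ * ι (count τ)) ≤ μ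
      shared-bound τ = by (1 ℕ.≤? fixed τ)
        where
        by : Dec (1 ℕ.≤ fixed τ) → c * (shared τ * ι (count τ)) ≤ μ
        by (yes 1≤) = subst (_≤ μ)
          (cong (λ a → c * (a * ι (count τ))) (sym (trans
            (cong (_* q ^ free τ) (𝟙-yes (1 ℕ.≤? fixed τ) 1≤)) (ℚ.*-identityˡ (q ^ free τ)))))
          (template-bound τ 1≤)
        by (no 1≰)  = subst (_≤ μ)
          (sym (trans (cong (λ a → c * (a * ι (count τ))) (trans
              (cong (_* q ^ free τ) (𝟙-no (1 ℕ.≤? fixed τ) 1≰)) (ℚ.*-zeroˡ (q ^ free τ))))
            (trans (cong (c *_) (ℚ.*-zeroˡ (ι (count τ)))) (ℚ.*-zeroʳ c)))) 0≤μ

      pairs : c * ∑ 𝓕 pairSum ≤ ι (length 𝓕) * (ι K * μ)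
      pairs = begin
        c * ∑ 𝓕 pairSum
          ≡⟨ trans (*-distribˡ-∑ 𝓕 c) (∑-cong 𝓕 λ S _ → *-distribˡ-∑ (templates (options (toList S)) r) c) ⟩
        (∑ 𝓕 λ S → ∑ (templates (options (toList S)) r) λ τ → c * (shared τ * ι (count τ)))
          ≤⟨ ∑-mono-≤ 𝓕 (λ S _ → ∑-mono-≤ (templates (options (toList S)) r) λ τ _ → shared-bound τ) ⟩
        (∑ 𝓕 λ S → ∑ (templates (options (toList S)) r) λ _ → μ)
          ≡⟨ ∑-cong 𝓕 (λ S _ → trans (∑-const (templates (options (toList S)) r) μ)
               (cong (λ k → ι k * μ) (trans (length-templates (options (toList S)) r)
                 (cong (ℕ._^ r) (cong suc (trans (length-map just (toList S)) (length-toList S))))))) ⟩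
        (∑ 𝓕 λ _ → ι K * μ)
          ≡⟨ ∑-const 𝓕 (ι K * μ) ⟩
        ι (length 𝓕) * (ι K * μ) ∎

-- Cardinalities of unions and disjoint sets

module Disjointness where
  open import Data.Nat.Base using (_+_; _≤_)

  infix 4 _#_
  _#_ : ∀ {n} → Subset n → Subset n → Set
  P # U = ∀ {x} → x ∈ˢ P → x ∉ˢ U

  #-tail : ∀ {n} {a b} {P U : Subset n} → a ∷ P # b ∷ U → P # U
  #-tail P#U x∈P x∈U = P#U (Vec.there x∈P) (Vec.there x∈U)

  ∣p∪q∣≤∣p∣+∣q∣ : ∀ {n} (p q : Subset n) → ∣ p ∪ q ∣ ≤ ∣ p ∣ + ∣ q ∣
  ∣p∪q∣≤∣p∣+∣q∣ []            []            = z≤n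
  ∣p∪q∣≤∣p∣+∣q∣ (inside ∷ p)  (outside ∷ q) = s≤s (∣p∪q∣≤∣p∣+∣q∣ p q)
  ∣p∪q∣≤∣p∣+∣q∣ (inside ∷ p)  (inside ∷ q)  =
    s≤s (ℕ.≤-trans (∣p∪q∣≤∣p∣+∣q∣ p q) (ℕ.+-monoʳ-≤ ∣ p ∣ (ℕ.n≤1+n ∣ q ∣)))
  ∣p∪q∣≤∣p∣+∣q∣ (outside ∷ p) (outside ∷ q) = ∣p∪q∣≤∣p∣+∣q∣ p q
  ∣p∪q∣≤∣p∣+∣q∣ (outside ∷ p) (inside ∷ q)  =
    ℕ.≤-trans (s≤s (∣p∪q∣≤∣p∣+∣q∣ p q)) (ℕ.≤-reflexive (sym (ℕ.+-suc ∣ p ∣ ∣ q ∣)))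

  #⇒∣p∪q∣≡∣p∣+∣q∣ : ∀ {n} (p q : Subset n) → q # p → ∣ p ∪ q ∣ ≡ ∣ p ∣ + ∣ q ∣
  #⇒∣p∪q∣≡∣p∣+∣q∣ []            []            _   = refl
  #⇒∣p∪q∣≡∣p∣+∣q∣ (inside ∷ p)  (outside ∷ q) q#p = cong suc (#⇒∣p∪q∣≡∣p∣+∣q∣ p q (#-tail q#p))
  #⇒∣p∪q∣≡∣p∣+∣q∣ (inside ∷ p)  (inside ∷ q)  q#p = ⊥-elim (q#p Vec.here Vec.here)
  #⇒∣p∪q∣≡∣p∣+∣q∣ (outside ∷ p) (outside ∷ q) q#p = #⇒∣p∪q∣≡∣p∣+∣q∣ p q (#-tail q#p)
  #⇒∣p∪q∣≡∣p∣+∣q∣ (outside ∷ p) (inside ∷ q)  q#p =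
    trans (cong suc (#⇒∣p∪q∣≡∣p∣+∣q∣ p q (#-tail q#p))) (sym (ℕ.+-suc ∣ p ∣ ∣ q ∣))

  ∪-least : ∀ {n} {p q s : Subset n} → p ⊆ s → q ⊆ s → p ∪ q ⊆ s
  ∪-least {p = p} {q} p⊆s q⊆s x∈ = [ p⊆s , q⊆s ]′ (x∈p∪q⁻ p q x∈)

  ∈─⇒∉ : ∀ {n} (p q : Subset n) {x} → x ∈ˢ p ─ q → x ∉ˢ q
  ∈─⇒∉ (inside  ∷ p) (outside ∷ q) Vec.here      ()
  ∈─⇒∉ (_       ∷ p) (_       ∷ q) (Vec.there x∈) (Vec.there x∈q) = ∈─⇒∉ p q x∈ x∈q

  ∪-─ : ∀ {n} {p q : Subset n} → q ⊆ p → q ∪ (p ─ q) ≡ p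
  ∪-─ {p = p} {q} q⊆p = ⊆-antisym (∪-least q⊆p (p─q⊆p p q)) back
    where
    back : p ⊆ q ∪ (p ─ q)
    back {x} x∈p with x ∈ˢ? q
    ... | yes x∈q = x∈p∪q⁺ (inj₁ x∈q)
    ... | no  x∉q = x∈p∪q⁺ (inj₂ (x∈p∧x∉q⇒x∈p─q x∈p x∉q))

open Disjointness

module FiniteSums where
  open import Data.Nat.Base using (_+_; _*_; _≤_)
  open ∑ℕ
  open NatSum

  length≡∑ : {A : Set} (xs : List A) → length xs ≡ ∑ xs (λ _ → 1)
  length≡∑ xs = trans (sym (ℕ.*-identityʳ (length xs))) (sym (∑-const xs 1))

  length-filter≡∑ : {A : Set} {P : A → Set} (P? : ∀ x → Dec (P x)) (xs : List A) →
                    length (filter P? xs) ≡ ∑ xs (λ x → 𝟙 (P? x))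
  length-filter≡∑ P? []       = refl
  length-filter≡∑ P? (x ∷ xs) with P? x
  ... | yes _ = cong suc (length-filter≡∑ P? xs)
  ... | no  _ = length-filter≡∑ P? xs

  ∑-≡0 : {A : Set} (xs : List A) {f : A → ℕ} → (∀ x → x ∈ xs → f x ≡ 0) → ∑ xs f ≡ 0
  ∑-≡0 xs f≡0 = trans (∑-cong xs f≡0) (∑-zero xs)

  ∑≤length* : {A : Set} (xs : List A) {f : A → ℕ} {b : ℕ} → (∀ x → x ∈ xs → f x ≤ b) → ∑ xs f ≤ length xs * b
  ∑≤length* xs {b = b} f≤b = ℕ.≤-trans (∑-mono-≤ xs f≤b) (ℕ.≤-reflexive (∑-const xs b))

  -- Reduces a sum to its only possible nonzero term. It is applied where a prescribed edge
  -- determines the petal and where two prescribed edges determine the kernel.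
  ∑-single : {A : Set} {xs : List A} {f : A → ℕ} → Unique xs →
             (∀ {x y} → x ∈ xs → y ∈ xs → f x ≢ 0 → f y ≢ 0 → x ≡ y) →
             ∑ xs f ≡ 0 ⊎ ∃[ x ] x ∈ xs × ∑ xs f ≡ f x
  ∑-single {xs = []} _ _ = inj₁ refl
  ∑-single {xs = x ∷ xs} {f} (x∉ ∷ uniq) single with f x ℕ.≟ 0
  ... | yes fx≡0 with ∑-single uniq (λ y∈ z∈ → single (there y∈) (there z∈))
  ...   | inj₁ ≡0           = inj₁ (cong₂ _+_ fx≡0 ≡0)
  ...   | inj₂ (y , y∈ , eq) = inj₂ (y , there y∈ , cong₂ _+_ fx≡0 eq)
  ∑-single {xs = x ∷ xs} {f} (x∉ ∷ uniq) single | no fx≢0 =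
    inj₂ (x , here refl , trans (cong (f x +_) (∑-≡0 xs others)) (ℕ.+-identityʳ (f x)))
    where
    others : ∀ y → y ∈ xs → f y ≡ 0
    others y y∈ with f y ℕ.≟ 0
    ... | yes fy≡0 = fy≡0
    ... | no  fy≢0 = ⊥-elim (All.lookup x∉ y∈ (single (here refl) (there y∈) fx≢0 fy≢0))

  nC0≡1 : ∀ n → n C 0 ≡ 1
  nC0≡1 zero    = refl
  nC0≡1 (suc n) = refl

open FiniteSums

-- Enumeration of the sets of given size that avoid a given set

module Choices where
  open import Data.Nat.Base using (_+_; _*_; _∸_; _≤_)
  open ∑ℕ
  open NatSum

  -- `U` is the set to avoid, not the one to choose from, since each petal of a sunflower enlarges
  -- what the later petals have to avoid.
  choose : ∀ {n} → Subset n → ℕ → List (Subset n)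
  choose []            zero    = [] ∷ []
  choose []            (suc t) = []
  choose (inside ∷ U)  t       = List.map (outside ∷_) (choose U t)
  choose (outside ∷ U) zero    = List.map (outside ∷_) (choose U zero)
  choose (outside ∷ U) (suc t) =
    List.map (outside ∷_) (choose U (suc t)) ++ List.map (inside ∷_) (choose U t)

  choose-sound : ∀ {n} (U : Subset n) t {P} → P ∈ choose U t → P # U × ∣ P ∣ ≡ t
  choose-sound []            zero    (here refl) = (λ { () }) , refl
  choose-sound (inside ∷ U)  t       P∈ with ∈-map⁻ (outside ∷_) P∈
  ... | P′ , P′∈ , refl = let d , c = choose-sound U t P′∈ in
    (λ { (Vec.there x∈P) (Vec.there x∈U) → d x∈P x∈U }) , c
  choose-sound (outside ∷ U) zero    P∈ with ∈-map⁻ (outside ∷_) P∈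
  ... | P′ , P′∈ , refl = let d , c = choose-sound U zero P′∈ in
    (λ { (Vec.there x∈P) (Vec.there x∈U) → d x∈P x∈U }) , c
  choose-sound (outside ∷ U) (suc t) P∈ with ∈-++⁻ (List.map (outside ∷_) (choose U (suc t))) P∈
  ... | inj₁ P∈ˡ with ∈-map⁻ (outside ∷_) P∈ˡ
  ...   | P′ , P′∈ , refl = let d , c = choose-sound U (suc t) P′∈ in
    (λ { (Vec.there x∈P) (Vec.there x∈U) → d x∈P x∈U }) , c
  choose-sound (outside ∷ U) (suc t) P∈ | inj₂ P∈ʳ with ∈-map⁻ (inside ∷_) P∈ʳ
  ...   | P′ , P′∈ , refl = let d , c = choose-sound U t P′∈ in
    (λ { (Vec.there x∈P) (Vec.there x∈U) → d x∈P x∈U }) , cong suc c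

  choose-complete : ∀ {n} (U P : Subset n) → P # U → P ∈ choose U ∣ P ∣
  choose-complete []            []            _   = here refl
  choose-complete (inside ∷ U)  (inside ∷ P)  P#U = ⊥-elim (P#U Vec.here Vec.here)
  choose-complete (inside ∷ U)  (outside ∷ P) P#U = ∈-map⁺ (outside ∷_) (choose-complete U P (#-tail P#U))
  choose-complete (outside ∷ U) (inside ∷ P)  P#U =
    ∈-++⁺ʳ (List.map (outside ∷_) (choose U (suc ∣ P ∣))) (∈-map⁺ (inside ∷_) (choose-complete U P (#-tail P#U)))
  choose-complete (outside ∷ U) (outside ∷ P) P#U with ∣ P ∣ | choose-complete U P (#-tail P#U)
  ... | zero  | P∈ = ∈-map⁺ (outside ∷_) P∈
  ... | suc t | P∈ = ∈-++⁺ˡ (∈-map⁺ (outside ∷_) P∈)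

  length-choose : ∀ {n} (U : Subset n) t → length (choose U t) ≡ (n ∸ ∣ U ∣) C t
  length-choose []            zero    = refl
  length-choose []            (suc t) = refl
  length-choose (inside ∷ U)  t       = trans (length-map (outside ∷_) (choose U t)) (length-choose U t)
  length-choose {suc n} (outside ∷ U) zero = trans (length-map (outside ∷_) (choose U zero))
    (trans (length-choose U zero) (trans (nC0≡1 (n ∸ ∣ U ∣)) (sym (nC0≡1 (suc n ∸ ∣ U ∣)))))
  length-choose {suc n} (outside ∷ U) (suc t) =
    trans (length-++ (List.map (outside ∷_) (choose U (suc t))))
    (trans (cong₂ _+_ (trans (length-map (outside ∷_) (choose U (suc t))) (length-choose U (suc t)))
                      (trans (length-map (inside ∷_) (choose U t)) (length-choose U t)))
    (trans (ℕ.+-comm ((n ∸ ∣ U ∣) C suc t) ((n ∸ ∣ U ∣) C t))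
    (trans (nCk+nC[k+1]≡[n+1]C[k+1] (n ∸ ∣ U ∣) t)
           (cong (_C suc t) (sym (ℕ.+-∸-assoc 1 (∣p∣≤n U)))))))

  private
    inside-outside : ∀ {n} (P P′ : Subset n) → outside ∷ P ≢ inside ∷ P′
    inside-outside P P′ ()

    map-outside-inside : ∀ {n} {xs ys : List (Subset n)} → Unique xs → Unique ys →
                         Unique (List.map (outside ∷_) xs ++ List.map (inside ∷_) ys)
    map-outside-inside ux uy = Unique.++⁺ (Unique.map⁺ ∷-injectiveʳ ux) (Unique.map⁺ ∷-injectiveʳ uy)
      λ (v∈₁ , v∈₂) →
        let P , _ , eq = ∈-map⁻ (outside ∷_) v∈₁
            P′ , _ , eq′ = ∈-map⁻ (inside ∷_) v∈₂
        in inside-outside P P′ (trans (sym eq) eq′)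

  choose-unique : ∀ {n} (U : Subset n) t → Unique (choose U t)
  choose-unique []            zero    = [] ∷ []
  choose-unique []            (suc t) = []
  choose-unique (inside ∷ U)  t       = Unique.map⁺ ∷-injectiveʳ (choose-unique U t)
  choose-unique (outside ∷ U) zero    = Unique.map⁺ ∷-injectiveʳ (choose-unique U zero)
  choose-unique (outside ∷ U) (suc t) = map-outside-inside (choose-unique U (suc t)) (choose-unique U t)

  allSubsets-unique : ∀ n → Unique (allSubsets n)
  allSubsets-unique zero    = [] ∷ []
  allSubsets-unique (suc n) = map-outside-inside (allSubsets-unique n) (allSubsets-unique n)

  edges-unique : ∀ n w → Unique (edges n w)
  edges-unique n w = Unique.filter⁺ (λ e → ∣ e ∣ ℕ.≟ w) (allSubsets-unique n)

  ∈-allSubsets : ∀ {n} (P : Subset n) → P ∈ allSubsets n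
  ∈-allSubsets []            = here refl
  ∈-allSubsets (outside ∷ P) = ∈-++⁺ˡ (∈-map⁺ (outside ∷_) (∈-allSubsets P))
  ∈-allSubsets {suc n} (inside ∷ P)  =
    ∈-++⁺ʳ (List.map (outside ∷_) (allSubsets n)) (∈-map⁺ (inside ∷_) (∈-allSubsets P))

  ∈-edges⁺ : ∀ {n w} (P : Subset n) → ∣ P ∣ ≡ w → P ∈ edges n w
  ∈-edges⁺ {w = w} P ∣P∣≡w = ∈-filter⁺ (λ e → ∣ e ∣ ℕ.≟ w) (∈-allSubsets P) ∣P∣≡w

  ∈-edges⁻ : ∀ {n w} {P : Subset n} → P ∈ edges n w → ∣ P ∣ ≡ w
  ∈-edges⁻ {n} {w} P∈ = proj₂ (∈-filter⁻ (λ e → ∣ e ∣ ℕ.≟ w) {xs = allSubsets n} P∈)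

  length-edges : ∀ n w → length (edges n w) ≡ n C w
  length-edges n w = trans (length-filter≡∑ (λ e → ∣ e ∣ ℕ.≟ w) (allSubsets n)) (go n w)
    where
    go : ∀ n w → ∑ (allSubsets n) (λ e → 𝟙 (∣ e ∣ ℕ.≟ w)) ≡ n C w
    go zero    zero    = refl
    go zero    (suc w) = refl
    go (suc n) w = trans (∑-++ (List.map (outside ∷_) (allSubsets n)) (List.map (inside ∷_) (allSubsets n)))
      (trans (cong₂ _+_ (∑-map (outside ∷_) (allSubsets n)) (∑-map (inside ∷_) (allSubsets n)))
             (pascal w))
      where
      pascal : ∀ w → ∑ (allSubsets n) (λ e → 𝟙 (∣ e ∣ ℕ.≟ w)) +
                     ∑ (allSubsets n) (λ e → 𝟙 (suc ∣ e ∣ ℕ.≟ w)) ≡ suc n C w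
      pascal zero    = trans (cong₂ _+_ (go n zero) (∑-≡0 (allSubsets n) λ _ _ → refl))
        (trans (ℕ.+-identityʳ (n C 0)) (trans (nC0≡1 n) (sym (nC0≡1 (suc n)))))
      pascal (suc w) = trans (cong₂ _+_ (go n (suc w))
          (trans (∑-cong (allSubsets n) λ e _ →
                   𝟙-cong (suc ∣ e ∣ ℕ.≟ suc w) (∣ e ∣ ℕ.≟ w) ℕ.suc-injective (cong suc))
                 (go n w)))
        (trans (ℕ.+-comm (n C suc w) (n C w)) (nCk+nC[k+1]≡[n+1]C[k+1] n w))

  -- Choices that meet `V` contribute 0, so nothing is lost on the shorter list. Prescribed edges
  -- can thereby cut down the number of free choices made before them.
  ∑-choose-avoid : ∀ {n} (U V : Subset n) t {f : Subset n → ℕ} →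
    (∀ {P} → P ∈ choose U t → f P ≢ 0 → P # V) → ∑ (choose U t) f ≤ ∑ (choose (U ∪ V) t) f
  ∑-choose-avoid []            []            zero    avoid = ℕ.≤-refl
  ∑-choose-avoid []            []            (suc t) avoid = ℕ.≤-refl
  ∑-choose-avoid (inside ∷ U)  (v ∷ V)       t       avoid =
    map-mono (choose U t) (choose (U ∪ V) t)
      (∑-choose-avoid U V t λ P∈ f≢0 → #-tail (avoid (∈-map⁺ (outside ∷_) P∈) f≢0))
    where
    map-mono : ∀ xs ys {f} → ∑ xs (f ∘ (outside ∷_)) ≤ ∑ ys (f ∘ (outside ∷_)) →
               ∑ (List.map (outside ∷_) xs) f ≤ ∑ (List.map (outside ∷_) ys) f
    map-mono xs ys = subst₂ _≤_ (sym (∑-map (outside ∷_) xs)) (sym (∑-map (outside ∷_) ys))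
  ∑-choose-avoid (outside ∷ U) (outside ∷ V) zero    avoid =
    subst₂ _≤_ (sym (∑-map (outside ∷_) (choose U zero))) (sym (∑-map (outside ∷_) (choose (U ∪ V) zero)))
      (∑-choose-avoid U V zero λ P∈ f≢0 → #-tail (avoid (∈-map⁺ (outside ∷_) P∈) f≢0))
  ∑-choose-avoid (outside ∷ U) (inside ∷ V)  zero    avoid =
    subst₂ _≤_ (sym (∑-map (outside ∷_) (choose U zero))) (sym (∑-map (outside ∷_) (choose (U ∪ V) zero)))
      (∑-choose-avoid U V zero λ P∈ f≢0 → #-tail (avoid (∈-map⁺ (outside ∷_) P∈) f≢0))
  ∑-choose-avoid (outside ∷ U) (outside ∷ V) (suc t) avoid = subst₂ _≤_
    (sym (trans (∑-++ (List.map (outside ∷_) (choose U (suc t))) _)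
      (cong₂ _+_ (∑-map (outside ∷_) (choose U (suc t))) (∑-map (inside ∷_) (choose U t)))))
    (sym (trans (∑-++ (List.map (outside ∷_) (choose (U ∪ V) (suc t))) _)
      (cong₂ _+_ (∑-map (outside ∷_) (choose (U ∪ V) (suc t))) (∑-map (inside ∷_) (choose (U ∪ V) t)))))
    (ℕ.+-mono-≤
      (∑-choose-avoid U V (suc t) λ P∈ f≢0 → #-tail (avoid (∈-++⁺ˡ (∈-map⁺ (outside ∷_) P∈)) f≢0))
      (∑-choose-avoid U V t λ P∈ f≢0 →
        #-tail (avoid (∈-++⁺ʳ (List.map (outside ∷_) (choose U (suc t))) (∈-map⁺ (inside ∷_) P∈)) f≢0)))
  ∑-choose-avoid (outside ∷ U) (inside ∷ V)  (suc t) {f} avoid = subst₂ _≤_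
    (sym (trans (∑-++ (List.map (outside ∷_) (choose U (suc t))) _)
      (trans (cong₂ _+_ (∑-map (outside ∷_) (choose U (suc t)))
               (trans (∑-map (inside ∷_) (choose U t)) (∑-≡0 (choose U t) hit)))
             (ℕ.+-identityʳ _))))
    (sym (∑-map (outside ∷_) (choose (U ∪ V) (suc t))))
    (∑-choose-avoid U V (suc t) λ P∈ f≢0 → #-tail (avoid (∈-++⁺ˡ (∈-map⁺ (outside ∷_) P∈)) f≢0))
    where
    hit : ∀ P → P ∈ choose U t → f (inside ∷ P) ≡ 0
    hit P P∈ with f (inside ∷ P) ℕ.≟ 0
    ... | yes ≡0 = ≡0
    ... | no  ≢0 = ⊥-elim
      (avoid (∈-++⁺ʳ (List.map (outside ∷_) (choose U (suc t))) (∈-map⁺ (inside ∷_) P∈)) ≢0 Vec.here Vec.here)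

open Choices

-- Binomial coefficients and products of them that count disjoint petals

module Binomials where
  open import Data.Nat.Base using (_+_; _*_; _∸_; _^_; _≤_; _<_; _!)
  open ∑ℕ
  open NatSum

  C-monoˡ-≤ : ∀ k {m n} → m ≤ n → (m C k) ≤ (n C k)
  C-monoˡ-≤ k {m} {n} m≤n = subst (λ n → (m C k) ≤ (n C k)) (ℕ.m+[n∸m]≡n m≤n) (go k (n ∸ m))
    where
    step : ∀ n k → (n C k) ≤ (suc n C k)
    step n zero    = ℕ.≤-reflexive (trans (nC0≡1 n) (sym (nC0≡1 (suc n))))
    step n (suc k) = ℕ.≤-trans (ℕ.m≤n+m (n C suc k) (n C k)) (ℕ.≤-reflexive (nCk+nC[k+1]≡[n+1]C[k+1] n k))
    go : ∀ k d → (m C k) ≤ ((m + d) C k)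
    go k zero    = ℕ.≤-reflexive (cong (_C k) (sym (ℕ.+-identityʳ m)))
    go k (suc d) = ℕ.≤-trans (go k d) (ℕ.≤-trans (step (m + d) k) (ℕ.≤-reflexive (cong (_C k) (sym (ℕ.+-suc m d)))))

  [k+d]Ck*k!*d!≡[k+d]! : ∀ k d → ((k + d) C k) * (k ! * d !) ≡ (k + d) !
  [k+d]Ck*k!*d!≡[k+d]! k d = trans
    (cong (_* (k ! * d !)) (trans (nCk≡n!/k![n-k]! (ℕ.m≤m+n k d))
      (/-congʳ {{k ℕ.!* (k + d ∸ k) !≢0}} {{k ℕ.!* d !≢0}} (cong (λ m → k ! * m !) (ℕ.m+n∸m≡n k d)))))
    (m/n*n≡m {{k ℕ.!* d !≢0}} (subst (λ m → k ! * m ! ∣ (k + d) !) (ℕ.m+n∸m≡n k d) (k![n∸k]!∣n! (ℕ.m≤m+n k d))))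

  nCk*k!*[n∸k]!≡n! : ∀ {n k} → k ≤ n → (n C k) * (k ! * (n ∸ k) !) ≡ n !
  nCk*k!*[n∸k]!≡n! {n} {k} k≤n =
    subst (λ m → (m C k) * (k ! * (n ∸ k) !) ≡ m !) (ℕ.m+[n∸m]≡n k≤n) ([k+d]Ck*k!*d!≡[k+d]! k (n ∸ k))

  1≤nCk : ∀ {n k} → k ≤ n → 1 ≤ (n C k)
  1≤nCk {n} {k} k≤n with n C k | nCk*k!*[n∸k]!≡n! k≤n
  ... | zero  | eq = ⊥-elim (ℕ.≢-nonZero⁻¹ (n !) {{n ℕ.!≢0}} (sym eq))
  ... | suc _ | _  = s≤s z≤n

  private
    n∸s∸[w∸s] : ∀ n {s w} → s ≤ w → n ∸ s ∸ (w ∸ s) ≡ n ∸ w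
    n∸s∸[w∸s] n {s} {w} s≤w = trans (ℕ.∸-+-assoc n s (w ∸ s)) (cong (n ∸_) (ℕ.m+[n∸m]≡n s≤w))

  -- Both sides count pairs of an s-set inside a w-set. Multiplied by s! (w - s)! (n - w)!, each
  -- becomes n!.
  nCs*[n∸s]C[w∸s]≡nCw*wCs : ∀ {n w s} → s ≤ w → w ≤ n →
    (n C s) * ((n ∸ s) C (w ∸ s)) ≡ (n C w) * (w C s)
  nCs*[n∸s]C[w∸s]≡nCw*wCs {n} {w} {s} s≤w w≤n =
    ℕ.*-cancelʳ-≡ _ _ (s ! * ((w ∸ s) ! * (n ∸ w) !))
      {{ℕ.m*n≢0 (s !) _ {{s ℕ.!≢0}} {{(w ∸ s) ℕ.!* (n ∸ w) !≢0}}}}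
      (begin
        (n C s) * ((n ∸ s) C (w ∸ s)) * (s ! * ((w ∸ s) ! * (n ∸ w) !))
          ≡⟨ rearrange₁ (n C s) ((n ∸ s) C (w ∸ s)) (s !) ((w ∸ s) ! * (n ∸ w) !) ⟩
        (n C s) * (s ! * (((n ∸ s) C (w ∸ s)) * ((w ∸ s) ! * (n ∸ w) !)))
          ≡⟨ cong (λ m → (n C s) * (s ! * (((n ∸ s) C (w ∸ s)) * ((w ∸ s) ! * m !))))
               (sym (n∸s∸[w∸s] n s≤w)) ⟩
        (n C s) * (s ! * (((n ∸ s) C (w ∸ s)) * ((w ∸ s) ! * (n ∸ s ∸ (w ∸ s)) !)))
          ≡⟨ cong (λ m → (n C s) * (s ! * m)) (nCk*k!*[n∸k]!≡n! (ℕ.∸-monoˡ-≤ s w≤n)) ⟩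
        (n C s) * (s ! * (n ∸ s) !)
          ≡⟨ nCk*k!*[n∸k]!≡n! (ℕ.≤-trans s≤w w≤n) ⟩
        n !
          ≡⟨ sym (nCk*k!*[n∸k]!≡n! w≤n) ⟩
        (n C w) * (w ! * (n ∸ w) !)
          ≡⟨ cong (λ m → (n C w) * (m * (n ∸ w) !)) (sym (nCk*k!*[n∸k]!≡n! s≤w)) ⟩
        (n C w) * ((w C s) * (s ! * (w ∸ s) !) * (n ∸ w) !)
          ≡⟨ rearrange₂ (n C w) (w C s) (s !) ((w ∸ s) !) ((n ∸ w) !) ⟩
        (n C w) * (w C s) * (s ! * ((w ∸ s) ! * (n ∸ w) !)) ∎)
    where
    open ≡-Reasoning
    open ℕSolver.+-*-Solver
    rearrange₁ : ∀ a b c d → a * b * (c * d) ≡ a * (c * (b * d))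
    rearrange₁ = solve 4 (λ a b c d → a :* b :* (c :* d) := a :* (c :* (b :* d))) refl
    rearrange₂ : ∀ a b c d e → a * (b * (c * d) * e) ≡ a * b * (c * (d * e))
    rearrange₂ = solve 5 (λ a b c d e → a :* (b :* (c :* d) :* e) := a :* b :* (c :* (d :* e))) refl

  ∑-upTo-suc : ∀ k (f : ℕ → ℕ) → ∑ (upTo (suc k)) f ≡ f 0 + ∑ (upTo k) (f ∘ suc)
  ∑-upTo-suc k f = cong (f 0 +_) (trans (cong (λ xs → ∑ xs f) (sym (map-upTo suc k))) (∑-map suc (upTo k)))

  ∑-upTo-last : ∀ k (f : ℕ → ℕ) → ∑ (upTo (suc k)) f ≡ ∑ (upTo k) f + f k
  ∑-upTo-last k f = trans (cong (λ xs → ∑ xs f) (sym (upTo-∷ʳ k)))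
    (trans (∑-++ (upTo k) (k ∷ [])) (cong (∑ (upTo k) f +_) (ℕ.+-identityʳ (f k))))

  -- Induction on `a`: Pascal's rule applied to the first factor splits the sum into the identities
  -- for `k` and `suc k` with smaller `a`.
  vandermonde : ∀ a b k → ∑ (upTo (suc k)) (λ s → (a C s) * (b C (k ∸ s))) ≡ ((a + b) C k)
  vandermonde zero b k = trans (∑-upTo-suc k (λ s → (0 C s) * (b C (k ∸ s)))) (trans
    (cong₂ _+_ (ℕ.*-identityˡ (b C k)) (∑-≡0 (upTo k) λ _ _ → refl)) (ℕ.+-identityʳ (b C k)))
  vandermonde (suc a) b zero = trans
    (cong₂ (λ l m → l * m + 0) (nC0≡1 (suc a)) (nC0≡1 b)) (sym (nC0≡1 (suc a + b)))
  vandermonde (suc a) b (suc k) = begin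
    ∑ (upTo (suc (suc k))) (λ s → (suc a C s) * (b C (suc k ∸ s)))
      ≡⟨ ∑-upTo-suc (suc k) (λ s → (suc a C s) * (b C (suc k ∸ s))) ⟩
    (suc a C 0) * (b C suc k) + ∑ (upTo (suc k)) (λ s → (suc a C suc s) * (b C (k ∸ s)))
      ≡⟨ cong₂ _+_ (cong (_* (b C suc k)) (trans (nC0≡1 (suc a)) (sym (nC0≡1 a))))
           (trans (∑-cong (upTo (suc k)) λ s _ → trans
                    (cong (_* (b C (k ∸ s))) (sym (nCk+nC[k+1]≡[n+1]C[k+1] a s)))
                    (ℕ.*-distribʳ-+ (b C (k ∸ s)) (a C s) (a C suc s)))
                  (∑-distrib-+ (upTo (suc k)) {x} {y})) ⟩
    (a C 0) * (b C suc k) + (∑ (upTo (suc k)) (λ s → (a C s) * (b C (k ∸ s))) +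
                             ∑ (upTo (suc k)) (λ s → (a C suc s) * (b C (k ∸ s))))
      ≡⟨ rearrange ((a C 0) * (b C suc k)) (∑ (upTo (suc k)) x) (∑ (upTo (suc k)) y) ⟩
    ∑ (upTo (suc k)) (λ s → (a C s) * (b C (k ∸ s))) +
      ((a C 0) * (b C suc k) + ∑ (upTo (suc k)) (λ s → (a C suc s) * (b C (k ∸ s))))
      ≡⟨ cong₂ _+_ (vandermonde a b k)
          (trans (sym (∑-upTo-suc (suc k) (λ s → (a C s) * (b C (suc k ∸ s)))))
          (vandermonde a b (suc k))) ⟩
    ((a + b) C k) + ((a + b) C suc k)
      ≡⟨ nCk+nC[k+1]≡[n+1]C[k+1] (a + b) k ⟩
    (suc (a + b) C suc k) ∎
    where
    open ≡-Reasoning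
    x y : ℕ → ℕ
    x s = (a C s) * (b C (k ∸ s))
    y s = (a C suc s) * (b C (k ∸ s))
    rearrange : ∀ x y z → x + (y + z) ≡ y + (x + z)
    rearrange x y z = trans (sym (ℕ.+-assoc x y z)) (trans (cong (_+ z) (ℕ.+-comm x y)) (ℕ.+-assoc y x z))

  -- The number of ordered choices of `k` disjoint `t`-sets among `m` points, that is, m! / ((t!)ᵏ
  -- (m - kt)!) if kt ≤ m and 0 otherwise.
  packings : ℕ → ℕ → ℕ → ℕ
  packings t zero    m = 1
  packings t (suc k) m = (m C t) * packings t k (m ∸ t)

  packings≤^ : ∀ t k m → packings t k m ≤ (m C t) ^ k
  packings≤^ t zero    m = ℕ.≤-refl
  packings≤^ t (suc k) m = ℕ.*-monoʳ-≤ (m C t)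
    (ℕ.≤-trans (packings≤^ t k (m ∸ t)) (ℕ.^-monoˡ-≤ k (C-monoˡ-≤ t (ℕ.m∸n≤m m t))))

  -- The factors decrease, so each of the first `j` is at least the one that would come next.
  -- `packings≤^` is the opposite comparison with the first factor.
  ^≤packings : ∀ t j m → ((m ∸ j * t) C t) ^ j ≤ packings t j m
  ^≤packings t zero    m = ℕ.≤-refl
  ^≤packings t (suc j) m = ℕ.*-mono-≤ (C-monoˡ-≤ t (ℕ.m∸n≤m m (t + j * t)))
    (subst (λ l → (l C t) ^ j ≤ packings t j (m ∸ t)) (ℕ.∸-+-assoc m t (j * t)) (^≤packings t j (m ∸ t)))

  packings-+ : ∀ t j k m → packings t (j + k) m ≡ packings t j m * packings t k (m ∸ j * t)
  packings-+ t zero    k m = sym (ℕ.+-identityʳ (packings t k m))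
  packings-+ t (suc j) k m = trans (cong ((m C t) *_) (trans (packings-+ t j k (m ∸ t))
      (cong (λ l → packings t j (m ∸ t) * packings t k l) (ℕ.∸-+-assoc m t (j * t)))))
    (sym (ℕ.*-assoc (m C t) (packings t j (m ∸ t)) _))

  ^-distribʳ-* : ∀ k a b → (a * b) ^ k ≡ a ^ k * b ^ k
  ^-distribʳ-* zero    a b = refl
  ^-distribʳ-* (suc k) a b = trans (cong (a * b *_) (^-distribʳ-* k a b)) (swap a b (a ^ k) (b ^ k))
    where
    open ℕSolver.+-*-Solver
    swap : ∀ a b c d → a * b * (c * d) ≡ a * c * (b * d)
    swap = solve 4 (λ a b c d → a :* b :* (c :* d) := a :* c :* (b :* d)) refl

  -- A product of the k smallest of j + k factors, which decrease from left to right.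
  packings-tail-^ : ∀ t j k m → packings t k (m ∸ j * t) ^ (j + k) ≤ packings t (j + k) m ^ k
  packings-tail-^ t j k m = begin
    x ^ (j + k)                ≡⟨ ℕ.^-distribˡ-+-* x j k ⟩
    x ^ j * x ^ k              ≤⟨ ℕ.*-monoˡ-≤ (x ^ k) (begin
      x ^ j                      ≤⟨ ℕ.^-monoˡ-≤ j (packings≤^ t k (m ∸ j * t)) ⟩
      (c ^ k) ^ j                ≡⟨ ℕ.^-*-assoc c k j ⟩
      c ^ (k * j)                ≡⟨ cong (c ^_) (ℕ.*-comm k j) ⟩
      c ^ (j * k)                ≡⟨ sym (ℕ.^-*-assoc c j k) ⟩
      (c ^ j) ^ k                ≤⟨ ℕ.^-monoˡ-≤ k (^≤packings t j m) ⟩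
      packings t j m ^ k         ∎) ⟩
    packings t j m ^ k * x ^ k ≡⟨ sym (^-distribʳ-* k (packings t j m) x) ⟩
    (packings t j m * x) ^ k   ≡⟨ cong (_^ k) (sym (packings-+ t j k m)) ⟩
    packings t (j + k) m ^ k   ∎
    where
    open ℕ.≤-Reasoning
    x = packings t k (m ∸ j * t)
    -- The factor that separates the two groups: an upper bound for the `k` factors of `x` and a
    -- lower bound for the `j` factors before them.
    c = (m ∸ j * t) C t

  packings-factorial : ∀ t k m → k * t ≤ m → packings t k m * ((t !) ^ k * (m ∸ k * t) !) ≡ m !
  packings-factorial t zero    m _     = trans (ℕ.*-identityˡ _) (ℕ.*-identityˡ (m !))
  packings-factorial t (suc k) m kt≤m = begin
    (m C t) * packings t k (m ∸ t) * (t ! * (t !) ^ k * (m ∸ (t + k * t)) !)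
      ≡⟨ cong (λ l → (m C t) * packings t k (m ∸ t) * (t ! * (t !) ^ k * l !)) (sym (ℕ.∸-+-assoc m t (k * t))) ⟩
    (m C t) * packings t k (m ∸ t) * (t ! * (t !) ^ k * (m ∸ t ∸ k * t) !)
      ≡⟨ rearrange (m C t) (packings t k (m ∸ t)) (t !) ((t !) ^ k) ((m ∸ t ∸ k * t) !) ⟩
    (m C t) * (t ! * (packings t k (m ∸ t) * ((t !) ^ k * (m ∸ t ∸ k * t) !)))
      ≡⟨ cong (λ x → (m C t) * (t ! * x)) (packings-factorial t k (m ∸ t)
           (subst (_≤ m ∸ t) (ℕ.m+n∸m≡n t (k * t)) (ℕ.∸-monoˡ-≤ t kt≤m))) ⟩
    (m C t) * (t ! * (m ∸ t) !)
      ≡⟨ nCk*k!*[n∸k]!≡n! (ℕ.≤-trans (ℕ.m≤m+n t (k * t)) kt≤m) ⟩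
    m ! ∎
    where
    open ≡-Reasoning
    open ℕSolver.+-*-Solver
    rearrange : ∀ a b c d e → a * b * (c * d * e) ≡ a * (c * (b * (d * e)))
    rearrange = solve 5 (λ a b c d e → a :* b :* (c :* d :* e) := a :* (c :* (b :* (d :* e)))) refl

  packings≡0 : ∀ t k m → m < k * t → packings t k m ≡ 0
  packings≡0 t (suc k) m m<kt with t ℕ.≤? m
  ... | no  t≰m = cong (_* packings t k (m ∸ t)) (k>n⇒nCk≡0 (ℕ.≰⇒> t≰m))
  ... | yes t≤m = trans (cong ((m C t) *_) (packings≡0 t k (m ∸ t)
      (subst (m ∸ t <_) (ℕ.m+n∸m≡n t (k * t)) (ℕ.∸-monoˡ-< m<kt t≤m)))) (ℕ.*-zeroʳ (m C t))

  1≤packings : ∀ t k m → k * t ≤ m → 1 ≤ packings t k m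
  1≤packings t k m kt≤m with packings t k m | packings-factorial t k m kt≤m
  ... | zero  | eq = ⊥-elim (ℕ.≢-nonZero⁻¹ (m !) {{m ℕ.!≢0}} (sym eq))
  ... | suc _ | _  = s≤s z≤n

  -- The number of ordered sunflowers with a given edge at a given position: the kernel is chosen
  -- inside that edge, the other petals among the n - w points outside it.
  edgeDegree : (r n w : ℕ) → ℕ
  edgeDegree r n w = ∑ (upTo w) (λ s → (w C s) * packings (w ∸ s) (r ∸ 1) (n ∸ w))

  -- The T of the overview, split by the size `s` of the kernel.
  flowerCount : (r n w : ℕ) → ℕ
  flowerCount r n w = ∑ (upTo w) (λ s → (n C s) * packings (w ∸ s) r (n ∸ s))

  -- Holds term by term: a kernel with its first petal is the same as an edge with a kernel inside
  -- it, and the remaining petals avoid that edge in both counts.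
  flowerCount≡ : ∀ r n w → w ≤ n → flowerCount (suc r) n w ≡ (n C w) * edgeDegree (suc r) n w
  flowerCount≡ r n w w≤n = trans (∑-cong (upTo w) λ s s∈ →
      let s≤w = ℕ.<⇒≤ (∈-upTo⁻ s∈) in
      trans (sym (ℕ.*-assoc (n C s) ((n ∸ s) C (w ∸ s)) _))
        (trans (cong₂ _*_ (nCs*[n∸s]C[w∸s]≡nCw*wCs s≤w w≤n)
                          (cong (packings (w ∸ s) r) (n∸s∸[w∸s] n s≤w)))
               (ℕ.*-assoc (n C w) (w C s) _)))
    (sym (*-distribˡ-∑ (upTo w) (n C w)))

  -- The packing is at most the power of `y s` with exponent `suc r`. One factor stays with `w C s`,
  -- so that Vandermonde's identity bounds the sum by N; each other factor is at most N, being part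
  -- of a single term of that sum.
  edgeDegree≤ : ∀ r n w → w ≤ n → edgeDegree (suc (suc r)) n w ≤ (n C w) ^ suc r
  edgeDegree≤ r n w w≤n = begin
    edgeDegree (suc (suc r)) n w
      ≤⟨ ∑-mono-≤ (upTo w) (λ s s∈ → let s≤w = ℕ.<⇒≤ (∈-upTo⁻ s∈) in begin
           (w C s) * packings (w ∸ s) (suc r) (n ∸ w)
             ≤⟨ ℕ.*-monoʳ-≤ (w C s) (packings≤^ (w ∸ s) (suc r) (n ∸ w)) ⟩
           (w C s) * (y s * y s ^ r)
             ≡⟨ sym (ℕ.*-assoc (w C s) (y s) (y s ^ r)) ⟩
           (w C s) * y s * y s ^ r
             ≤⟨ ℕ.*-monoʳ-≤ ((w C s) * y s) (ℕ.^-monoˡ-≤ r (begin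
                  y s            ≡⟨ sym (ℕ.*-identityˡ (y s)) ⟩
                  1 * y s        ≤⟨ ℕ.*-monoˡ-≤ (y s) (1≤nCk s≤w) ⟩
                  (w C s) * y s  ≤⟨ term≤∑ (upTo w) s∈ ⟩
                  ∑ (upTo w) (λ s → (w C s) * y s) ≤⟨ total ⟩
                  (n C w)        ∎)) ⟩
           (w C s) * y s * (n C w) ^ r
             ≡⟨ ℕ.*-comm ((w C s) * y s) ((n C w) ^ r) ⟩
           (n C w) ^ r * ((w C s) * y s) ∎) ⟩
    ∑ (upTo w) (λ s → (n C w) ^ r * ((w C s) * y s))
      ≡⟨ sym (*-distribˡ-∑ (upTo w) ((n C w) ^ r)) ⟩
    (n C w) ^ r * ∑ (upTo w) (λ s → (w C s) * y s)
      ≤⟨ ℕ.*-monoʳ-≤ ((n C w) ^ r) total ⟩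
    (n C w) ^ r * (n C w)
      ≡⟨ ℕ.*-comm ((n C w) ^ r) (n C w) ⟩
    (n C w) ^ suc r ∎
    where
    open ℕ.≤-Reasoning
    y : ℕ → ℕ
    y s = (n ∸ w) C (w ∸ s)
    total : ∑ (upTo w) (λ s → (w C s) * y s) ≤ (n C w)
    total = begin
      -- The kernel is a proper subset of the edge, so the term s = w has to be added to complete
      -- Vandermonde's sum.
      ∑ (upTo w) (λ s → (w C s) * y s)               ≤⟨ ℕ.m≤m+n _ _ ⟩
      ∑ (upTo w) (λ s → (w C s) * y s) + (w C w) * y w ≡⟨ sym (∑-upTo-last w _) ⟩
      ∑ (upTo (suc w)) (λ s → (w C s) * y s)         ≡⟨ vandermonde w (n ∸ w) w ⟩
      ((w + (n ∸ w)) C w)                            ≡⟨ cong (_C w) (ℕ.m+[n∸m]≡n w≤n) ⟩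
      (n C w)                                        ∎

  -- The case j = 1 of dʳ ≤ T^(r - j): one factor d is bounded by N^(r - 1), and the product N d of
  -- the remaining factors is T.
  edgeDegree^r≤ : ∀ r n w → w ≤ n →
    edgeDegree (suc (suc r)) n w ^ suc (suc r) ≤ flowerCount (suc (suc r)) n w ^ suc r
  edgeDegree^r≤ r n w w≤n = begin
    d * d ^ suc r           ≤⟨ ℕ.*-monoˡ-≤ (d ^ suc r) (edgeDegree≤ r n w w≤n) ⟩
    (n C w) ^ suc r * d ^ suc r ≡⟨ sym (^-distribʳ-* (suc r) (n C w) d) ⟩
    ((n C w) * d) ^ suc r   ≡⟨ cong (_^ suc r) (sym (flowerCount≡ (suc r) n w w≤n)) ⟩
    flowerCount (suc (suc r)) n w ^ suc r ∎
    where
    open ℕ.≤-Reasoning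
    d = edgeDegree (suc (suc r)) n w

open Binomials

-- Sunflowers with a given kernel, built petal by petal

module Flowers where
  open import Data.Nat.Base using (_+_; _*_; _∸_; _^_; _≤_; _<_)
  open ∑ℕ
  open NatSum

  -- The tuples (K ∪ P₁ , … , K ∪ Pₖ) with disjoint t-element petals Pᵢ that avoid U.
  petals : ∀ {n} → Subset n → (k t : ℕ) → Subset n → List (Vec (Subset n) k)
  petals K zero    t U = [] ∷ []
  petals K (suc k) t U = concatMap (λ P → List.map ((K ∪ P) ∷_) (petals K k t (U ∪ P))) (choose U t)

  -- Sizes stop below `w`, because a kernel of size `w` would make all edges equal.
  kernels : ∀ {n} → ℕ → List (Subset n)
  kernels w = concatMap (choose ∅) (upTo w)

  flowers : ∀ n (r w : ℕ) → List (Vec (Subset n) r)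
  flowers n r w = concatMap (λ K → petals K r (w ∸ ∣ K ∣) K) (kernels w)

  module _ {n : ℕ} where

    petals⁺ : ∀ {K U P : Subset n} {k t S} → P ∈ choose U t → S ∈ petals K k t (U ∪ P) →
              (K ∪ P) ∷ S ∈ petals K (suc k) t U
    petals⁺ {K} {U} {P} {k} {t} P∈ S∈ =
      ∈-concatMap⁺ (λ P → List.map ((K ∪ P) ∷_) (petals K k t (U ∪ P)))
        (Any.map (λ { refl → ∈-map⁺ ((K ∪ P) ∷_) S∈ }) P∈)

    petals⁻ : ∀ {K U : Subset n} {k t e S} → e ∷ S ∈ petals K (suc k) t U →
              ∃[ P ] P ∈ choose U t × S ∈ petals K k t (U ∪ P) × e ≡ K ∪ P
    petals⁻ {K} {U} {k} {t} S∈
      with find (∈-concatMap⁻ (λ P → List.map ((K ∪ P) ∷_) (petals K k t (U ∪ P))) {xs = choose U t} S∈)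
    ... | P , P∈ , S∈′ with ∈-map⁻ ((K ∪ P) ∷_) S∈′
    ...   | S′ , S′∈ , refl = P , P∈ , S′∈ , refl

    ∣choice∪∣ : ∀ (U : Subset n) {P t} → P ∈ choose U t → ∣ U ∪ P ∣ ≡ ∣ U ∣ + t
    ∣choice∪∣ U {P} {t} P∈ = let P#U , ∣P∣≡t = choose-sound U t P∈ in
      trans (#⇒∣p∪q∣≡∣p∣+∣q∣ U P P#U) (cong (∣ U ∣ +_) ∣P∣≡t)

    length-petals : ∀ (K : Subset n) k t U → length (petals K k t U) ≡ packings t k (n ∸ ∣ U ∣)
    length-petals K zero    t U = refl
    length-petals K (suc k) t U = begin
      length (petals K (suc k) t U)
        ≡⟨ trans (length≡∑ (petals K (suc k) t U)) (∑-concatMap _ (choose U t)) ⟩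
      ∑ (choose U t) (λ P → ∑ (List.map ((K ∪ P) ∷_) (petals K k t (U ∪ P))) (λ _ → 1))
        ≡⟨ ∑-cong (choose U t) (λ P P∈ → trans (sym (length≡∑ (List.map ((K ∪ P) ∷_) (petals K k t (U ∪ P)))))
             (trans (length-map ((K ∪ P) ∷_) (petals K k t (U ∪ P))) (trans (length-petals K k t (U ∪ P))
             (cong (packings t k) (trans (cong (n ∸_) (∣choice∪∣ U P∈)) (sym (ℕ.∸-+-assoc n ∣ U ∣ t))))))) ⟩
      ∑ (choose U t) (λ _ → packings t k (n ∸ ∣ U ∣ ∸ t))
        ≡⟨ trans (∑-const (choose U t) _) (cong (_* packings t k (n ∸ ∣ U ∣ ∸ t)) (length-choose U t)) ⟩
      packings t (suc k) (n ∸ ∣ U ∣) ∎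
      where open ≡-Reasoning

    -- The last component is the invariant of the construction: `U` contains everything used so far,
    -- and later edges meet it only in the kernel. The pairwise intersections in `petals-core` rest
    -- on it.
    petals-entry : ∀ {K U : Subset n} {k t S} → K ⊆ U → S ∈ petals K k t U → ∀ i →
      K ⊆ lookup S i × ∣ lookup S i ∣ ≡ ∣ K ∣ + t × (∀ {x} → x ∈ˢ lookup S i → x ∈ˢ U → x ∈ˢ K)
    petals-entry {K} {U} {suc k} {t} {e ∷ S} K⊆U S∈ i with petals⁻ {K} {U} S∈
    petals-entry {K} {U} {suc k} {t} {e ∷ S} K⊆U S∈ Fin.zero | P , P∈ , S′∈ , refl =
      let P#U , ∣P∣≡t = choose-sound U t P∈ in
      p⊆p∪q P ,
      trans (#⇒∣p∪q∣≡∣p∣+∣q∣ K P λ x∈P x∈K → P#U x∈P (K⊆U x∈K)) (cong (∣ K ∣ +_) ∣P∣≡t) ,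
      λ x∈ x∈U → [ id , (λ x∈P → ⊥-elim (P#U x∈P x∈U)) ]′ (x∈p∪q⁻ K P x∈)
    petals-entry {K} {U} {suc k} {t} {e ∷ S} K⊆U S∈ (Fin.suc i) | P , P∈ , S′∈ , refl =
      let K⊆ , size , U∩⊆K = petals-entry (p⊆p∪q P ∘ K⊆U) S′∈ i in
      K⊆ , size , λ x∈ x∈U → U∩⊆K x∈ (p⊆p∪q P x∈U)

    petals-core : ∀ {K U : Subset n} {k t S} → K ⊆ U → S ∈ petals K k t U → ∀ i j → i ≢ j →
      lookup S i ∩ lookup S j ≡ K
    petals-core {K} {U} {k} {t} {S} K⊆U S∈ i j i≢j = ⊆-antisym
      (λ x∈ → let x∈i , x∈j = x∈p∩q⁻ (lookup S i) (lookup S j) x∈ in common K⊆U S∈ i j i≢j x∈i x∈j)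
      (λ x∈K → x∈p∩q⁺ (proj₁ (petals-entry K⊆U S∈ i) x∈K , proj₁ (petals-entry K⊆U S∈ j) x∈K))
      where
      head-common : ∀ {U : Subset n} {k P S} → K ⊆ U → S ∈ petals K k t (U ∪ P) → ∀ j {x} →
        x ∈ˢ K ∪ P → x ∈ˢ lookup S j → x ∈ˢ K
      head-common {U} {P = P} K⊆U S∈ j x∈ x∈j = [ id , (λ x∈P →
        proj₂ (proj₂ (petals-entry (p⊆p∪q P ∘ K⊆U) S∈ j)) x∈j (q⊆p∪q U P x∈P)) ]′ (x∈p∪q⁻ K P x∈)
      common : ∀ {U : Subset n} {k S} → K ⊆ U → S ∈ petals K k t U → ∀ i j → i ≢ j → ∀ {x} →
        x ∈ˢ lookup S i → x ∈ˢ lookup S j → x ∈ˢ K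
      common {U} {suc k} {e ∷ S} K⊆U S∈ i j i≢j x∈i x∈j with petals⁻ {K} {U} S∈
      common {U} {suc k} {e ∷ S} K⊆U S∈ Fin.zero Fin.zero i≢j x∈i x∈j | _ = ⊥-elim (i≢j refl)
      common {U} {suc k} {e ∷ S} K⊆U S∈ Fin.zero (Fin.suc j) i≢j x∈i x∈j | P , P∈ , S′∈ , refl =
        head-common K⊆U S′∈ j x∈i x∈j
      common {U} {suc k} {e ∷ S} K⊆U S∈ (Fin.suc i) Fin.zero i≢j x∈i x∈j | P , P∈ , S′∈ , refl =
        head-common K⊆U S′∈ i x∈j x∈i
      common {U} {suc k} {e ∷ S} K⊆U S∈ (Fin.suc i) (Fin.suc j) i≢j x∈i x∈j | P , P∈ , S′∈ , refl =
        common (p⊆p∪q P ∘ K⊆U) S′∈ i j (i≢j ∘ cong Fin.suc) x∈i x∈j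

    -- The premises are exactly what `petals-entry` and `petals-core` provide; the petal of an edge
    -- `e` is recovered as `e ─ K`.
    petals-complete : ∀ {K U : Subset n} {k t} (S : Vec (Subset n) k) → K ⊆ U →
      (∀ i → K ⊆ lookup S i × ∣ lookup S i ∣ ≡ ∣ K ∣ + t × (∀ {x} → x ∈ˢ lookup S i → x ∈ˢ U → x ∈ˢ K)) →
      (∀ i j → i ≢ j → ∀ {x} → x ∈ˢ lookup S i → x ∈ˢ lookup S j → x ∈ˢ K) →
      S ∈ petals K k t U
    petals-complete []      K⊆U entry core = here refl
    petals-complete {K} {U} {suc k} {t} (e ∷ S) K⊆U entry core =
      subst (λ e → e ∷ S ∈ petals K (suc k) t U) (∪-─ K⊆e)
          (petals⁺ {U = U} P∈ (petals-complete S (p⊆p∪q P ∘ K⊆U) entry′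
        λ i j i≢j → core (Fin.suc i) (Fin.suc j) λ { refl → i≢j refl }))
      where
      P = e ─ K
      K⊆e : K ⊆ e
      K⊆e = proj₁ (entry Fin.zero)
      P#U : P # U
      P#U x∈P x∈U = ∈─⇒∉ e K x∈P (proj₂ (proj₂ (entry Fin.zero)) (p─q⊆p e K x∈P) x∈U)
      ∣P∣≡t : ∣ P ∣ ≡ t
      ∣P∣≡t = ℕ.+-cancelˡ-≡ ∣ K ∣ ∣ P ∣ t
        (trans (sym (#⇒∣p∪q∣≡∣p∣+∣q∣ K P (∈─⇒∉ e K))) (trans (cong ∣_∣ (∪-─ K⊆e)) (proj₁ (proj₂ (entry Fin.zero)))))
      P∈ : P ∈ choose U t
      P∈ = subst (λ t → P ∈ choose U t) ∣P∣≡t (choose-complete U P P#U)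
      entry′ : ∀ i → K ⊆ lookup S i × ∣ lookup S i ∣ ≡ ∣ K ∣ + t ×
               (∀ {x} → x ∈ˢ lookup S i → x ∈ˢ U ∪ P → x ∈ˢ K)
      entry′ i = let K⊆ , size , U∩⊆K = entry (Fin.suc i) in K⊆ , size ,
        λ x∈ x∈∪ → [ U∩⊆K x∈ , (λ x∈P → core Fin.zero (Fin.suc i) (λ ()) (p─q⊆p e K x∈P) x∈) ]′ (x∈p∪q⁻ U P x∈∪)

    matches? : ∀ {k} (τ : Vec (Maybe (Subset n)) k) (S : Vec (Subset n) k) → Dec (Match τ S)
    matches? = RandomSublist.match? _≟ˢ_

    extensions : (K : Subset n) (k t : ℕ) (U : Subset n) → Vec (Maybe (Subset n)) k → ℕ
    extensions K k t U τ = ∑ (petals K k t U) (λ S → 𝟙 (matches? τ S))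

    extensions≢0⇒ : ∀ (K : Subset n) k t U (τ : Vec (Maybe (Subset n)) k) → extensions K k t U τ ≢ 0 →
                    ∃[ S ] S ∈ petals K k t U × Match τ S
    extensions≢0⇒ K k t U τ ≢0 = let S , S∈ , 𝟙≢0 = ∑≢0⇒∃ (petals K k t U) ≢0 in S , S∈ , 𝟙≢0⇒ (matches? τ S) 𝟙≢0

    ⋃fixed : ∀ {k} → Vec (Maybe (Subset n)) k → Subset n
    ⋃fixed []            = ∅
    ⋃fixed (nothing ∷ τ) = ⋃fixed τ
    ⋃fixed (just e ∷ τ)  = e ∪ ⋃fixed τ

    -- Every edge placed later avoids `U` outside the kernel, and the prescribed edges are among
    -- them.
    ⋃fixed∩⊆kernel : ∀ {K U : Subset n} {k t S} (τ : Vec (Maybe (Subset n)) k) → K ⊆ U →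
      S ∈ petals K k t U → Match τ S → ∀ {x} → x ∈ˢ ⋃fixed τ → x ∈ˢ U → x ∈ˢ K
    ⋃fixed∩⊆kernel {S = []} [] K⊆U S∈ m x∈ x∈U = ⊥-elim (∉⊥ x∈)
    ⋃fixed∩⊆kernel {K} {U} {S = e ∷ S} (nothing ∷ τ) K⊆U S∈ m x∈ x∈U with petals⁻ {K} {U} S∈
    ... | P , P∈ , S′∈ , refl = ⋃fixed∩⊆kernel τ (p⊆p∪q P ∘ K⊆U) S′∈ m x∈ (p⊆p∪q P x∈U)
    ⋃fixed∩⊆kernel {K} {U} {S = e ∷ S} (just e ∷ τ) K⊆U S∈ (refl , m) x∈ x∈U with x∈p∪q⁻ e (⋃fixed τ) x∈
    ... | inj₁ x∈e = proj₂ (proj₂ (petals-entry K⊆U S∈ Fin.zero)) x∈e x∈U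
    ... | inj₂ x∈τ with petals⁻ {K} {U} S∈
    ...   | P , P∈ , S′∈ , refl = ⋃fixed∩⊆kernel τ (p⊆p∪q P ∘ K⊆U) S′∈ m x∈τ (p⊆p∪q P x∈U)

    -- Each prescribed edge brings a petal of `t` new points. A free petal in between is carried
    -- along in `U` and cancelled afterwards, as it accounts for at most `t` points of the union.
    ∣U∪⋃fixed∣≥ : ∀ {K U : Subset n} {k t S} (τ : Vec (Maybe (Subset n)) k) → K ⊆ U →
      S ∈ petals K k t U → Match τ S → ∣ U ∣ + fixed τ * t ≤ ∣ U ∪ ⋃fixed τ ∣
    ∣U∪⋃fixed∣≥ {U = U} {S = []} [] K⊆U S∈ m =
      ℕ.≤-trans (ℕ.≤-reflexive (ℕ.+-identityʳ ∣ U ∣)) (∣p∣≤∣p∪q∣ U ∅)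
    ∣U∪⋃fixed∣≥ {K} {U} {t = t} {S = e ∷ S} (nothing ∷ τ) K⊆U S∈ m with petals⁻ {K} {U} S∈
    ... | P , P∈ , S′∈ , refl = ℕ.+-cancelʳ-≤ t _ _ (begin
      ∣ U ∣ + fixed τ * t + t         ≡⟨ shift ∣ U ∣ (fixed τ * t) t ⟩
      ∣ U ∣ + t + fixed τ * t         ≡⟨ cong (_+ fixed τ * t) (sym (∣choice∪∣ U P∈)) ⟩
      ∣ U ∪ P ∣ + fixed τ * t         ≤⟨ ∣U∪⋃fixed∣≥ τ (p⊆p∪q P ∘ K⊆U) S′∈ m ⟩
      ∣ (U ∪ P) ∪ ⋃fixed τ ∣          ≤⟨ p⊆q⇒∣p∣≤∣q∣ swap ⟩
      ∣ (U ∪ ⋃fixed τ) ∪ P ∣          ≤⟨ ∣p∪q∣≤∣p∣+∣q∣ (U ∪ ⋃fixed τ) P ⟩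
      ∣ U ∪ ⋃fixed τ ∣ + ∣ P ∣        ≡⟨ cong (∣ U ∪ ⋃fixed τ ∣ +_) (proj₂ (choose-sound U t P∈)) ⟩
      ∣ U ∪ ⋃fixed τ ∣ + t            ∎)
      where
      open ℕ.≤-Reasoning
      shift : ∀ a b c → a + b + c ≡ a + c + b
      shift a b c = trans (ℕ.+-assoc a b c) (trans (cong (a +_) (ℕ.+-comm b c)) (sym (ℕ.+-assoc a c b)))
      swap : (U ∪ P) ∪ ⋃fixed τ ⊆ (U ∪ ⋃fixed τ) ∪ P
      swap = ∪-least (∪-least (p⊆p∪q P ∘ p⊆p∪q (⋃fixed τ)) (q⊆p∪q (U ∪ ⋃fixed τ) P))
                     (p⊆p∪q P ∘ q⊆p∪q U (⋃fixed τ))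
    ∣U∪⋃fixed∣≥ {K} {U} {t = t} {S = e ∷ S} (just e ∷ τ) K⊆U S∈ (refl , m) with petals⁻ {K} {U} S∈
    ... | P , P∈ , S′∈ , refl = begin
      ∣ U ∣ + (t + fixed τ * t)       ≡⟨ sym (ℕ.+-assoc ∣ U ∣ t (fixed τ * t)) ⟩
      ∣ U ∣ + t + fixed τ * t         ≡⟨ cong (_+ fixed τ * t) (sym (∣choice∪∣ U P∈)) ⟩
      ∣ U ∪ P ∣ + fixed τ * t         ≤⟨ ∣U∪⋃fixed∣≥ τ (p⊆p∪q P ∘ K⊆U) S′∈ m ⟩
      ∣ (U ∪ P) ∪ ⋃fixed τ ∣          ≤⟨ p⊆q⇒∣p∣≤∣q∣ absorb ⟩
      ∣ U ∪ ((K ∪ P) ∪ ⋃fixed τ) ∣    ∎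
      where
      open ℕ.≤-Reasoning
      rest = (K ∪ P) ∪ ⋃fixed τ
      absorb : (U ∪ P) ∪ ⋃fixed τ ⊆ U ∪ rest
      absorb = ∪-least (∪-least (p⊆p∪q rest) (q⊆p∪q U rest ∘ p⊆p∪q (⋃fixed τ) ∘ q⊆p∪q K P))
                       (q⊆p∪q U rest ∘ q⊆p∪q (K ∪ P) (⋃fixed τ))

    -- The bound is the one for a template whose prescribed positions all come first. It holds for
    -- any order, because a free petal must also avoid the prescribed petals that come later, and
    -- these occupy `fixed τ * t` points outside `U`.
    extensions≤ : ∀ (K : Subset n) k t U (τ : Vec (Maybe (Subset n)) k) → K ⊆ U →
      extensions K k t U τ ≤ packings t (free τ) (n ∸ (∣ U ∣ + fixed τ * t))
    extensions≤ K zero    t U [] K⊆U = ℕ.≤-refl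
    extensions≤ K (suc k) t U (nothing ∷ τ) K⊆U with extensions K (suc k) t U (nothing ∷ τ) ℕ.≟ 0
    ... | yes ≡0 = subst (_≤ _) (sym ≡0) z≤n
    ... | no  ≢0 = begin
      extensions K (suc k) t U (nothing ∷ τ)
        ≡⟨ unfold ⟩
      ∑ (choose U t) (λ P → extensions K k t (U ∪ P) τ)
        -- A petal that meets a later prescribed edge outside the kernel admits no matching
        -- completion. A nonzero count supplies the match from which the size of `U ∪ V` is bounded.
        ≤⟨ ∑-choose-avoid U V t avoid ⟩
      ∑ (choose (U ∪ V) t) (λ P → extensions K k t (U ∪ P) τ)
        ≤⟨ ∑≤length* (choose (U ∪ V) t) (λ P P∈ → ℕ.≤-trans (extensions≤ K k t (U ∪ P) τ (p⊆p∪q P ∘ K⊆U))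
             (ℕ.≤-reflexive (cong (packings t (free τ)) (shrink P∈)))) ⟩
      length (choose (U ∪ V) t) * packings t (free τ) (m ∸ t)
        ≡⟨ cong (_* packings t (free τ) (m ∸ t)) (length-choose (U ∪ V) t) ⟩
      ((n ∸ ∣ U ∪ V ∣) C t) * packings t (free τ) (m ∸ t)
        ≤⟨ ℕ.*-monoˡ-≤ (packings t (free τ) (m ∸ t)) (C-monoˡ-≤ t (ℕ.∸-monoʳ-≤ n size)) ⟩
      packings t (suc (free τ)) m ∎
      where
      open ℕ.≤-Reasoning
      V = ⋃fixed τ
      m = n ∸ (∣ U ∣ + fixed τ * t)
      unfold : extensions K (suc k) t U (nothing ∷ τ) ≡ ∑ (choose U t) (λ P → extensions K k t (U ∪ P) τ)
      unfold = trans (∑-concatMap _ (choose U t))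
          (∑-cong (choose U t) λ P _ → ∑-map ((K ∪ P) ∷_) (petals K k t (U ∪ P)))
      avoid : ∀ {P} → P ∈ choose U t → extensions K k t (U ∪ P) τ ≢ 0 → P # V
      avoid {P} P∈ ≢0 x∈P x∈V = let S , S∈ , match = extensions≢0⇒ K k t (U ∪ P) τ ≢0 in
        proj₁ (choose-sound U t P∈) x∈P
          (K⊆U (⋃fixed∩⊆kernel τ (p⊆p∪q P ∘ K⊆U) S∈ match x∈V (q⊆p∪q U P x∈P)))
      shrink : ∀ {P} → P ∈ choose (U ∪ V) t → n ∸ (∣ U ∪ P ∣ + fixed τ * t) ≡ m ∸ t
      shrink {P} P∈ = trans (cong (n ∸_)
          (trans (cong (_+ fixed τ * t)
              (trans (#⇒∣p∪q∣≡∣p∣+∣q∣ U P λ x∈P x∈U → P#UV x∈P (p⊆p∪q V x∈U))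
              (cong (∣ U ∣ +_) ∣P∣≡t)))
            (trans (ℕ.+-assoc ∣ U ∣ t _) (trans (cong (∣ U ∣ +_) (ℕ.+-comm t _)) (sym (ℕ.+-assoc ∣ U ∣ _ t))))))
        (sym (ℕ.∸-+-assoc n (∣ U ∣ + fixed τ * t) t))
        where
        P#UV = proj₁ (choose-sound (U ∪ V) t P∈)
        ∣P∣≡t = proj₂ (choose-sound (U ∪ V) t P∈)
      size : ∣ U ∣ + fixed τ * t ≤ ∣ U ∪ V ∣
      size = let S , S∈ , match = extensions≢0⇒ K (suc k) t U (nothing ∷ τ) ≢0 in
        ∣U∪⋃fixed∣≥ (nothing ∷ τ) K⊆U S∈ match
    -- Since e = K ∪ P with `P` disjoint from `K`, at most one petal `P` contributes.
    extensions≤ K (suc k) t U (just e ∷ τ) K⊆U = ℕ.≤-trans (ℕ.≤-reflexive unfold)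
      (by (∑-single (choose-unique U t) same))
      where
      f : Subset n → ℕ
      f P = ∑ (petals K k t (U ∪ P)) (λ S → 𝟙 (matches? (just e ∷ τ) ((K ∪ P) ∷ S)))
      unfold : extensions K (suc k) t U (just e ∷ τ) ≡ ∑ (choose U t) f
      unfold = trans (∑-concatMap _ (choose U t))
          (∑-cong (choose U t) λ P _ → ∑-map ((K ∪ P) ∷_) (petals K k t (U ∪ P)))
      head≡ : ∀ {P} → f P ≢ 0 → e ≡ K ∪ P
      head≡ {P} ≢0 = let S , _ , 𝟙≢0 = ∑≢0⇒∃ (petals K k t (U ∪ P)) ≢0 in
        proj₁ (𝟙≢0⇒ (matches? (just e ∷ τ) ((K ∪ P) ∷ S)) 𝟙≢0)
      half : ∀ {P P′} → P ∈ choose U t → K ∪ P ≡ K ∪ P′ → P ⊆ P′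
      half {P} {P′} P∈ eq {x} x∈P with x∈p∪q⁻ K P′ (subst (x ∈ˢ_) eq (q⊆p∪q K P x∈P))
      ... | inj₁ x∈K  = ⊥-elim (proj₁ (choose-sound U t P∈) x∈P (K⊆U x∈K))
      ... | inj₂ x∈P′ = x∈P′
      same : ∀ {P P′} → P ∈ choose U t → P′ ∈ choose U t → f P ≢ 0 → f P′ ≢ 0 → P ≡ P′
      same P∈ P′∈ ≢0 ≢0′ = let eq = trans (sym (head≡ ≢0)) (head≡ ≢0′) in
        ⊆-antisym (half P∈ eq) (half P′∈ (sym eq))
      by : ∑ (choose U t) f ≡ 0 ⊎ (∃[ P ] P ∈ choose U t × ∑ (choose U t) f ≡ f P) →
           ∑ (choose U t) f ≤ packings t (free τ) (n ∸ (∣ U ∣ + (t + fixed τ * t)))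
      by (inj₁ ≡0) = subst (_≤ _) (sym ≡0) z≤n
      by (inj₂ (P , P∈ , eq)) = begin
        ∑ (choose U t) f
          ≡⟨ eq ⟩
        f P
          ≤⟨ ∑-mono-≤ (petals K k t (U ∪ P)) (λ S _ → 𝟙-×≤ (e ≟ˢ (K ∪ P)) (matches? τ S)) ⟩
        extensions K k t (U ∪ P) τ
          ≤⟨ extensions≤ K k t (U ∪ P) τ (p⊆p∪q P ∘ K⊆U) ⟩
        packings t (free τ) (n ∸ (∣ U ∪ P ∣ + fixed τ * t))
          ≡⟨ cong (λ l → packings t (free τ) (n ∸ l))
               (trans (cong (_+ fixed τ * t) (∣choice∪∣ U P∈)) (ℕ.+-assoc ∣ U ∣ t _)) ⟩
        packings t (free τ) (n ∸ (∣ U ∣ + (t + fixed τ * t))) ∎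
        where
        open ℕ.≤-Reasoning
        𝟙-×≤ : {P Q : Set} (P? : Dec P) (Q? : Dec Q) → 𝟙 (P? ×-dec Q?) ≤ 𝟙 Q?
        𝟙-×≤ (yes _) (yes _) = ℕ.≤-refl
        𝟙-×≤ (yes _) (no _)  = ℕ.≤-refl
        𝟙-×≤ (no _)  (yes _) = z≤n
        𝟙-×≤ (no _)  (no _)  = ℕ.≤-refl

open Flowers

All-toList : ∀ {A : Set} {P : A → Set} {k} (S : Vec A k) → (∀ i → P (lookup S i)) → All P (toList S)
All-toList []      p = []
All-toList (x ∷ S) p = p Fin.zero ∷ All-toList S (p ∘ Fin.suc)

Unique-toList : ∀ {A : Set} {k} (S : Vec A k) → (∀ i j → i ≢ j → lookup S i ≢ lookup S j) → Unique (toList S)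
Unique-toList []      distinct = []
Unique-toList (x ∷ S) distinct =
  All-toList S (λ i → distinct Fin.zero (Fin.suc i) λ ()) ∷
  Unique-toList S (λ i j i≢j → distinct (Fin.suc i) (Fin.suc j) λ { refl → i≢j refl })

fixed≥1⇒position : ∀ {A : Set} {k} (τ : Vec (Maybe A) k) → 1 ℕ.≤ fixed τ →
  ∃[ i ] ∃[ e ] (∀ S → Match τ S → lookup S i ≡ e)
fixed≥1⇒position (nothing ∷ τ) 1≤ = let i , e , at = fixed≥1⇒position τ 1≤ in
  Fin.suc i , e , λ { (x ∷ S) m → at S m }
fixed≥1⇒position (just e ∷ τ)  _  = Fin.zero , e , λ { (x ∷ S) (e≡x , _) → sym e≡x }

fixed≥2⇒positions : ∀ {A : Set} {k} (τ : Vec (Maybe A) k) → 2 ℕ.≤ fixed τ →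
  ∃[ i ] ∃[ j ] ∃[ e ] ∃[ e′ ] i ≢ j × (∀ S → Match τ S → lookup S i ≡ e × lookup S j ≡ e′)
fixed≥2⇒positions (nothing ∷ τ) 2≤ = let i , j , e , e′ , i≢j , at = fixed≥2⇒positions τ 2≤ in
  Fin.suc i , Fin.suc j , e , e′ , i≢j ∘ suc-injective , λ { (x ∷ S) m → at S m }
fixed≥2⇒positions (just e ∷ τ) (s≤s 1≤) = let j , e′ , at = fixed≥1⇒position τ 1≤ in
  Fin.zero , Fin.suc j , e , e′ , (λ ()) , λ { (x ∷ S) (e≡x , m) → sym e≡x , at S m }

-- Correctness of the enumeration, and counts with prescribed edges

module SunflowerCounts where
  open import Data.Nat.Base using (_+_; _*_; _∸_; _^_; _≤_; _<_)
  open ∑ℕ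
  open NatSum

  ∈-choose∅ : ∀ {n} (K : Subset n) → K ∈ choose ∅ ∣ K ∣
  ∈-choose∅ K = choose-complete ∅ K λ _ x∈∅ → ∉⊥ x∈∅

  kernels⁺ : ∀ {n w} (K : Subset n) → ∣ K ∣ < w → K ∈ kernels w
  kernels⁺ K ∣K∣<w = ∈-concatMap⁺ (choose ∅) (Any.map (λ { refl → ∈-choose∅ K }) (∈-upTo⁺ ∣K∣<w))

  kernels⁻ : ∀ {n w} {K : Subset n} → K ∈ kernels w → ∣ K ∣ < w
  kernels⁻ {w = w} K∈ =
    let s , s∈ , K∈s = find (∈-concatMap⁻ (choose ∅) {xs = upTo w} K∈) in
    subst (_< w) (sym (proj₂ (choose-sound ∅ s K∈s))) (∈-upTo⁻ s∈)

  module _ {n : ℕ} where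

    flowers⁺ : ∀ {r w S} (K : Subset n) → ∣ K ∣ < w → S ∈ petals K r (w ∸ ∣ K ∣) K → S ∈ flowers n r w
    flowers⁺ {r} {w} K ∣K∣<w S∈ = ∈-concatMap⁺ (λ K → petals K r (w ∸ ∣ K ∣) K)
      (Any.map (λ { refl → S∈ }) (kernels⁺ K ∣K∣<w))

    flowers⁻ : ∀ {r w S} → S ∈ flowers n r w → ∃[ K ] ∣ K ∣ < w × S ∈ petals K r (w ∸ ∣ K ∣) K
    flowers⁻ {r} {w} S∈ =
      let K , K∈ , S∈′ = find (∈-concatMap⁻ (λ K → petals K r (w ∸ ∣ K ∣) K) {xs = kernels w} S∈) in
      K , kernels⁻ K∈ , S∈′

    flowers-size : ∀ {r w S} → S ∈ flowers n r w → ∀ i → ∣ lookup S i ∣ ≡ w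
    flowers-size {r} {w} {S} S∈ i = let K , ∣K∣<w , S∈′ = flowers⁻ {r} {w} {S} S∈ in
      trans (proj₁ (proj₂ (petals-entry {K = K} ⊆-refl S∈′ i))) (ℕ.m+[n∸m]≡n (ℕ.<⇒≤ ∣K∣<w))

    flowers-sunflower : ∀ {r w S} → S ∈ flowers n r w → IsSunflower S
    flowers-sunflower {r} {w} {S} S∈ with flowers⁻ {r} {w} {S} S∈
    ... | K , ∣K∣<w , S∈′ =
      distinct , λ i j k l i≢j k≢l → trans (core i j i≢j) (sym (core k l k≢l))
      where
      core = petals-core {K = K} ⊆-refl S∈′
      -- Two equal edges would be contained in their intersection `K`, which has fewer than `w`
      -- points.
      distinct : ∀ i j → i ≢ j → lookup S i ≢ lookup S j
      distinct i j i≢j eq = ℕ.<-irrefl refl (ℕ.<-≤-trans ∣K∣<w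
        (subst (_≤ ∣ K ∣) (flowers-size S∈ i) (p⊆q⇒∣p∣≤∣q∣ {p = lookup S i} {q = K} λ {x} x∈i →
          subst (x ∈ˢ_) (core i j i≢j) (x∈p∩q⁺ (x∈i , subst (x ∈ˢ_) eq x∈i)))))

    -- With at least two edges the kernel can be read off as the intersection of the first two. It
    -- has fewer than `w` points, as otherwise both of these edges would equal it.
    flowers-complete : ∀ {r w} (S : Vec (Subset n) (suc (suc r))) → (∀ i → ∣ lookup S i ∣ ≡ w) →
                       IsSunflower S → S ∈ flowers n (suc (suc r)) w
    flowers-complete {r} {w} S@(e₀ ∷ e₁ ∷ _) size (distinct , meet) = flowers⁺ K ∣K∣<w
      (petals-complete S ⊆-refl
        (λ i → K⊆ i , trans (size i) (sym (ℕ.m+[n∸m]≡n (ℕ.<⇒≤ ∣K∣<w))) , λ _ x∈K → x∈K)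
        (λ i j i≢j {x} x∈i x∈j → subst (x ∈ˢ_) (meet i j Fin.zero (Fin.suc Fin.zero) i≢j λ ()) (x∈p∩q⁺ (x∈i , x∈j))))
      where
      K = e₀ ∩ e₁
      K⊆ : ∀ i → K ⊆ lookup S i
      K⊆ i {x} x∈K = proj₁ (x∈p∩q⁻ (lookup S i) (lookup S (other i))
        (subst (x ∈ˢ_) (meet Fin.zero (Fin.suc Fin.zero) i (other i) (λ ()) (other≢ i)) x∈K))
        where
        -- Some index different from `i`: then `K` is also the intersection of edge `i` with another
        -- edge, hence contained in edge `i`.
        other : Fin (suc (suc r)) → Fin (suc (suc r))
        other Fin.zero    = Fin.suc Fin.zero
        other (Fin.suc _) = Fin.zero
        other≢ : ∀ i → i ≢ other i
        other≢ Fin.zero    ()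
        other≢ (Fin.suc _) ()
      ∣K∣<w : ∣ K ∣ < w
      ∣K∣<w = ℕ.≤∧≢⇒< (subst (∣ K ∣ ≤_) (size Fin.zero) (p⊆q⇒∣p∣≤∣q∣ (p∩q⊆p e₀ e₁))) λ ∣K∣≡w →
        distinct Fin.zero (Fin.suc Fin.zero) (λ ())
          (trans (sym (full (p∩q⊆p e₀ e₁) (trans (size Fin.zero) (sym ∣K∣≡w))))
                 (full (p∩q⊆q e₀ e₁) (trans (size (Fin.suc Fin.zero)) (sym ∣K∣≡w))))
        where
        full : ∀ {n} {p q : Subset n} → p ⊆ q → ∣ q ∣ ≡ ∣ p ∣ → p ≡ q
        full {p = []} {[]} p⊆q eq = refl
        full {p = inside ∷ p} {outside ∷ q} p⊆q eq with () ← p⊆q Vec.here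
        full {p = inside ∷ p} {inside ∷ q} p⊆q eq =
          cong (inside ∷_) (full (Subset.drop-∷-⊆ p⊆q) (ℕ.suc-injective eq))
        full {p = outside ∷ p} {outside ∷ q} p⊆q eq = cong (outside ∷_) (full (Subset.drop-∷-⊆ p⊆q) eq)
        full {p = outside ∷ p} {inside ∷ q} p⊆q eq =
          ⊥-elim (ℕ.<-irrefl refl (ℕ.≤-trans (ℕ.≤-reflexive eq) (p⊆q⇒∣p∣≤∣q∣ (Subset.drop-∷-⊆ p⊆q))))

    length-flowers : ∀ r w → length (flowers n r w) ≡ flowerCount r n w
    length-flowers r w = begin
      length (flowers n r w)
        ≡⟨ trans (length≡∑ (flowers n r w))
            (trans (∑-concatMap (λ K → petals K r (w ∸ ∣ K ∣) K) (kernels w))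
            (∑-concatMap (choose ∅) (upTo w))) ⟩
      ∑ (upTo w) (λ s → ∑ (choose (∅ {n}) s) (λ K → ∑ (petals K r (w ∸ ∣ K ∣) K) (λ _ → 1)))
        ≡⟨ ∑-cong (upTo w) (λ s _ → trans
            (∑-cong (choose (∅ {n}) s) λ K K∈ → per-kernel s K (proj₂ (choose-sound (∅ {n}) s K∈)))
             (trans (∑-const (choose (∅ {n}) s) (packings (w ∸ s) r (n ∸ s))) (cong (_* packings (w ∸ s) r (n ∸ s))
               (trans (length-choose (∅ {n}) s) (cong (λ m → (n ∸ m) C s) (∣⊥∣≡0 n)))))) ⟩
      flowerCount r n w ∎
      where
      open ≡-Reasoning
      per-kernel : ∀ s (K : Subset n) → ∣ K ∣ ≡ s →
          ∑ (petals K r (w ∸ ∣ K ∣) K) (λ _ → 1) ≡ packings (w ∸ s) r (n ∸ s)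
      per-kernel s K refl = trans (sym (length≡∑ (petals K r (w ∸ ∣ K ∣) K))) (length-petals K r (w ∸ ∣ K ∣) K)

    module _ (r w : ℕ) (τ : Vec (Maybe (Subset n)) r) where

      perKernel : Subset n → ℕ
      perKernel K = extensions K r (w ∸ ∣ K ∣) K τ

      perSize : ℕ → ℕ
      perSize s = ∑ (choose (∅ {n}) s) perKernel

      matching : ℕ
      matching = ∑ (flowers n r w) (λ S → 𝟙 (matches? τ S))

      matching≡ : matching ≡ ∑ (upTo w) perSize
      matching≡ = trans (∑-concatMap (λ K → petals K r (w ∸ ∣ K ∣) K) (kernels w)) (∑-concatMap (choose ∅) (upTo w))

      matching≢0⇒ : matching ≢ 0 → ∃[ S ] S ∈ flowers n r w × Match τ S
      matching≢0⇒ ≢0 = let S , S∈ , 𝟙≢0 = ∑≢0⇒∃ (flowers n r w) ≢0 in S , S∈ , 𝟙≢0⇒ (matches? τ S) 𝟙≢0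

      -- The kernel lies in the prescribed edge `e`, so it is a set that avoids `∁ e`, and for each
      -- size `s` there are `w C s` of these. That `e` has `w` points is read off from a match;
      -- without one the count is 0.
      matching₁≤ : fixed τ ≡ 1 → matching ≤ edgeDegree r n w
      matching₁≤ one with matching ℕ.≟ 0
      ... | yes ≡0 = subst (_≤ edgeDegree r n w) (sym ≡0) z≤n
      ... | no  ≢0 = subst (_≤ edgeDegree r n w) (sym matching≡) (∑-mono-≤ (upTo w) λ s s∈ → begin
        ∑ (choose (∅ {n}) s) perKernel
          ≤⟨ ∑-choose-avoid ∅ (∁ e) s (λ {K} _ ≢0 x∈K x∈∁e → x∈∁p⇒x∉p x∈∁e (kernel⊆e K ≢0 x∈K)) ⟩
        ∑ (choose (∅ ∪ ∁ e) s) perKernel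
          ≤⟨ ∑≤length* (choose (∅ ∪ ∁ e) s) (λ K K∈ → ℕ.≤-trans (extensions≤ K r (w ∸ ∣ K ∣) K τ ⊆-refl)
               (ℕ.≤-reflexive (bound K s (proj₂ (choose-sound (∅ ∪ ∁ e) s K∈)) (ℕ.<⇒≤ (∈-upTo⁻ s∈))))) ⟩
        length (choose (∅ ∪ ∁ e) s) * packings (w ∸ s) (r ∸ 1) (n ∸ w)
          ≡⟨ cong (_* packings (w ∸ s) (r ∸ 1) (n ∸ w)) (trans (length-choose (∅ ∪ ∁ e) s) (cong (_C s) ∣e∣)) ⟩
        (w C s) * packings (w ∸ s) (r ∸ 1) (n ∸ w) ∎)
        where
        open ℕ.≤-Reasoning
        position = fixed≥1⇒position τ (ℕ.≤-reflexive (sym one))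
        i = proj₁ position
        e = proj₁ (proj₂ position)
        at = proj₂ (proj₂ position)
        ∣e∣≡w : ∣ e ∣ ≡ w
        ∣e∣≡w = let S , S∈ , match = matching≢0⇒ ≢0 in
          trans (cong ∣_∣ (sym (at S match))) (flowers-size S∈ i)
        ∣e∣ : n ∸ ∣ ∅ ∪ ∁ e ∣ ≡ w
        ∣e∣ = trans (cong (λ p → n ∸ ∣ p ∣) (Subset.∪-identityˡ (∁ e)))
          (trans (cong (n ∸_) (Subset.∣∁p∣≡n∸∣p∣ e)) (trans (ℕ.m∸[m∸n]≡n (∣p∣≤n e)) ∣e∣≡w))
        kernel⊆e : ∀ K → perKernel K ≢ 0 → K ⊆ e
        kernel⊆e K ≢0 = let S , S∈ , match = extensions≢0⇒ K r (w ∸ ∣ K ∣) K τ ≢0 in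
          subst (K ⊆_) (at S match) (proj₁ (petals-entry {K = K} ⊆-refl S∈ i))
        free≡r∸1 : free τ ≡ r ∸ 1
        free≡r∸1 = trans (sym (ℕ.m+n∸n≡m (free τ) 1))
            (cong (_∸ 1) (trans (cong (free τ +_) (sym one)) (free+fixed τ)))
        bound : ∀ K s → ∣ K ∣ ≡ s → s ≤ w →
          packings (w ∸ ∣ K ∣) (free τ) (n ∸ (∣ K ∣ + fixed τ * (w ∸ ∣ K ∣))) ≡ packings (w ∸ s) (r ∸ 1) (n ∸ w)
        bound K s refl s≤w = cong₂ (packings (w ∸ s)) free≡r∸1
          (cong (n ∸_) (trans (cong (λ j → s + j * (w ∸ s)) one)
            (trans (cong (s +_) (ℕ.*-identityˡ (w ∸ s))) (ℕ.m+[n∸m]≡n s≤w))))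

      -- By `extensions≤` the count is at most the product of the last `free τ` factors of a packing
      -- with `r` petals, to which `packings-tail-^` applies. The whole packing is part of a single
      -- term of T.
      perKernel^≤ : ∀ K → ∣ K ∣ < w → perKernel K ^ r ≤ flowerCount r n w ^ free τ
      perKernel^≤ K ∣K∣<w = begin
        perKernel K ^ r
          ≤⟨ ℕ.^-monoˡ-≤ r (extensions≤ K r t K τ ⊆-refl) ⟩
        packings t (free τ) (n ∸ (∣ K ∣ + fixed τ * t)) ^ r
          ≡⟨ cong₂ (λ m r → packings t (free τ) m ^ r) (sym (ℕ.∸-+-assoc n ∣ K ∣ (fixed τ * t))) (sym fixed+free) ⟩
        packings t (free τ) (n ∸ ∣ K ∣ ∸ fixed τ * t) ^ (fixed τ + free τ)
          ≤⟨ packings-tail-^ t (fixed τ) (free τ) (n ∸ ∣ K ∣) ⟩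
        packings t (fixed τ + free τ) (n ∸ ∣ K ∣) ^ free τ
          ≡⟨ cong (λ r → packings t r (n ∸ ∣ K ∣) ^ free τ) fixed+free ⟩
        packings t r (n ∸ ∣ K ∣) ^ free τ
          ≤⟨ ℕ.^-monoˡ-≤ (free τ) (begin
               packings t r (n ∸ ∣ K ∣)
                 ≡⟨ sym (ℕ.*-identityˡ _) ⟩
               1 * packings t r (n ∸ ∣ K ∣)
                 ≤⟨ ℕ.*-monoˡ-≤ (packings t r (n ∸ ∣ K ∣)) (1≤nCk (∣p∣≤n K)) ⟩
               (n C ∣ K ∣) * packings t r (n ∸ ∣ K ∣)
                 ≤⟨ term≤∑ (upTo w) {λ s → (n C s) * packings (w ∸ s) r (n ∸ s)} (∈-upTo⁺ ∣K∣<w) ⟩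
               flowerCount r n w ∎) ⟩
        flowerCount r n w ^ free τ ∎
        where
        open ℕ.≤-Reasoning
        t = w ∸ ∣ K ∣
        fixed+free : fixed τ + free τ ≡ r
        fixed+free = trans (ℕ.+-comm (fixed τ) (free τ)) (free+fixed τ)

      -- Two given edges determine the kernel.
      matching₂^≤ : 1 ≤ r → 2 ≤ fixed τ → matching ^ r ≤ flowerCount r n w ^ free τ
      matching₂^≤ (s≤s {n = r-1} _) two = subst (λ m → m ^ r ≤ flowerCount r n w ^ free τ) (sym matching≡)
        (outer (∑-single (Unique.upTo⁺ w) sameSize))
        where
        positions = fixed≥2⇒positions τ two
        i = proj₁ positions
        j = proj₁ (proj₂ positions)
        i≢j = proj₁ (proj₂ (proj₂ (proj₂ (proj₂ positions))))
        at = proj₂ (proj₂ (proj₂ (proj₂ (proj₂ positions))))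
        kernel≡ : ∀ K → perKernel K ≢ 0 → K ≡
            proj₁ (proj₂ (proj₂ positions)) ∩ proj₁ (proj₂ (proj₂ (proj₂ positions)))
        kernel≡ K ≢0 = let S , S∈ , match = extensions≢0⇒ K r (w ∸ ∣ K ∣) K τ ≢0 in
          trans (sym (petals-core {K = K} ⊆-refl S∈ i j i≢j)) (cong₂ _∩_ (proj₁ (at S match)) (proj₂ (at S match)))
        same : ∀ {K K′} → perKernel K ≢ 0 → perKernel K′ ≢ 0 → K ≡ K′
        same ≢0 ≢0′ = trans (kernel≡ _ ≢0) (sym (kernel≡ _ ≢0′))
        sameSize : ∀ {s s′} → s ∈ upTo w → s′ ∈ upTo w → perSize s ≢ 0 → perSize s′ ≢ 0 → s ≡ s′
        sameSize {s} {s′} _ _ ≢0 ≢0′ =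
          let K  , K∈  , K≢0  = ∑≢0⇒∃ (choose (∅ {n}) s) ≢0
              K′ , K′∈ , K′≢0 = ∑≢0⇒∃ (choose (∅ {n}) s′) ≢0′
          in trans (sym (proj₂ (choose-sound (∅ {n}) s K∈)))
               (trans (cong ∣_∣ (same {K} {K′} K≢0 K′≢0)) (proj₂ (choose-sound (∅ {n}) s′ K′∈)))
        inner : ∀ s → s < w → (perSize s ≡ 0 ⊎ ∃[ K ] K ∈ choose ∅ s × perSize s ≡ perKernel K) →
                perSize s ^ r ≤ flowerCount r n w ^ free τ
        inner s s<w (inj₁ ≡0) rewrite ≡0 = z≤n
        inner s s<w (inj₂ (K , K∈ , eq)) rewrite eq =
          perKernel^≤ K (subst (_< w) (sym (proj₂ (choose-sound (∅ {n}) s K∈))) s<w)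
        outer : (∑ (upTo w) perSize ≡ 0 ⊎ ∃[ s ] s ∈ upTo w × ∑ (upTo w) perSize ≡ perSize s) →
                ∑ (upTo w) perSize ^ r ≤ flowerCount r n w ^ free τ
        outer (inj₁ ≡0) rewrite ≡0 = z≤n
        outer (inj₂ (s , s∈ , eq)) rewrite eq =
          inner s (∈-upTo⁻ s∈) (∑-single (choose-unique ∅ s) λ {K} {K′} _ _ → same {K} {K′})

    -- Combines the cases j ≥ 2 and j = 1 of dʳ ≤ T^(r - j). The latter requires w ≤ n, which
    -- follows from any match; if there is none, the left side is 0.
    matching^≤ : ∀ r w (τ : Vec (Maybe (Subset n)) (suc (suc r))) → 1 ≤ fixed τ →
      matching (suc (suc r)) w τ ^ suc (suc r) ≤ length (flowers n (suc (suc r)) w) ^ free τ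
    matching^≤ r w τ 1≤fixed rewrite length-flowers (suc (suc r)) w with 2 ℕ.≤? fixed τ
    ... | yes 2≤ = matching₂^≤ (suc (suc r)) w τ (s≤s z≤n) 2≤
    ... | no  2≰ with matching (suc (suc r)) w τ ℕ.≟ 0
    ...   | yes ≡0 rewrite ≡0 = z≤n
    ...   | no  ≢0 = ℕ.≤-trans (ℕ.^-monoˡ-≤ (suc (suc r)) (matching₁≤ (suc (suc r)) w τ one))
      (ℕ.≤-trans (edgeDegree^r≤ r n w w≤n) (ℕ.≤-reflexive (cong (flowerCount (suc (suc r)) n w ^_) (sym free≡))))
      where
      one : fixed τ ≡ 1
      one = ℕ.≤-antisym (ℕ.≤-pred (ℕ.≰⇒> 2≰)) 1≤fixed
      free≡ : free τ ≡ suc r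
      free≡ = ℕ.suc-injective (trans (ℕ.+-comm 1 (free τ)) (trans (cong (free τ +_) (sym one)) (free+fixed τ)))
      w≤n : w ≤ n
      w≤n = let S , S∈ , _ = matching≢0⇒ (suc (suc r)) w τ ≢0 in
        subst (_≤ n) (flowers-size S∈ Fin.zero) (∣p∣≤n (lookup S Fin.zero))

open SunflowerCounts

-- The identity T = (r - 1)! N D

module SunflowerNumber where
  open import Data.Integer.Base using (+_)
  open import Data.Nat.Base using (_+_; _*_; _∸_; _^_; _≤_; _<_; _!)
  open Rational using (ι; ι-*; ι-pos; ι-∑; *-cancelʳ-≡)

  ι-/ : ∀ a b .{{_ : ℕ.NonZero b}} → (+ a ℚ./ b) ℚ.* ι b ≡ ι a
  ι-/ a b@(suc b-1) = ℚ.toℚᵘ-injective (ℚᵘ.≃-trans (ℚ.toℚᵘ-homo-* (+ a ℚ./ b) (ι b))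
    (ℚᵘ.≃-trans (ℚᵘ.*-cong (ℚ.toℚᵘ-fromℚᵘ (ℚᵘ.mkℚᵘ (+ a) b-1)) (ℚ.toℚᵘ-fromℚᵘ (ℚᵘ.mkℚᵘ (+ b) 0)))
    (ℚᵘ.≃-trans (ℚᵘ.*≡* eq) (ℚᵘ.≃-sym (ℚ.toℚᵘ-fromℚᵘ (ℚᵘ.mkℚᵘ (+ a) 0))))))
    where
    eq : (+ a ℤ.* + b) ℤ.* + 1 ≡ + a ℤ.* + (b * 1)
    eq = trans (ℤ.*-identityʳ (+ a ℤ.* + b)) (cong (λ m → + a ℤ.* + m) (sym (ℕ.*-identityʳ b)))

  -- Subtracting `r * s` turns the condition under which a summand of `D` is nonzero into the
  -- condition that the petals fit into the n - s points outside the kernel.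
  suc-r*w : ∀ r {s w} → s ≤ w → suc r * w ≡ r * s + (s + suc r * (w ∸ s))
  suc-r*w r {s} {w} s≤w = trans (cong (suc r *_) (sym (ℕ.m+[n∸m]≡n s≤w))) (expand r s (w ∸ s))
    where
    open ℕSolver.+-*-Solver
    expand : ∀ r s t → suc r * (s + t) ≡ r * s + (s + suc r * t)
    expand = solve 3 (λ r s t → (con 1 :+ r) :* (s :+ t) := r :* s :+ (s :+ (con 1 :+ r) :* t)) refl

  private
    -- The number of points in no edge, n - rw + (r - 1)s in the statement; throughout this part `r`
    -- is one less than the number of edges.
    spare : (r n w s : ℕ) → ℕ
    spare r n w s = (n + r * s) ∸ suc r * w

  kernelTerm-no : ∀ r n w s → n + r * s < suc r * w → kernelTerm (suc r) n w s ≡ 0ℚ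
  kernelTerm-no r n w s n<rw with suc r * w ℕ.≤? n + r * s
  ... | no  _  = refl
  ... | yes rw≤ = ⊥-elim (ℕ.<-irrefl refl (ℕ.<-≤-trans n<rw rw≤))

  -- A record rather than an equation: the normal form of a quotient in ℚ exposes a gcd.
  record IsQuotient (x : ℚ) (a b : ℕ) : Set where
    field x*b≡a : x ℚ.* ι b ≡ ι a

  kernelTerm-yes : ∀ r n w s → suc r * w ≤ n + r * s →
    IsQuotient (kernelTerm (suc r) n w s) (w ! * (n ∸ w) !) (denominator (suc r) s (w ∸ s) (spare r n w s))
  kernelTerm-yes r n w s rw≤ with suc r * w ℕ.≤? n + r * s
  ... | no  rw≰ = ⊥-elim (rw≰ rw≤)
  ... | yes _   = record { x*b≡a =
    ι-/ (w ! * (n ∸ w) !) (denominator (suc r) s (w ∸ s) (spare r n w s))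
      {{denominator≢0 (suc r) s (w ∸ s) (spare r n w s)}} }

  module _ (r n w s : ℕ) (s≤w : s ≤ w) (w≤n : w ≤ n) where
    private
      t = w ∸ s
      x = n C s
      y = packings t (suc r) (n ∸ s)

    flowerTerm-no : n + r * s < suc r * w → x * y ≡ 0
    flowerTerm-no n<rw = trans (cong (x *_) (packings≡0 t (suc r) (n ∸ s) small)) (ℕ.*-zeroʳ x)
      where
      small : n ∸ s < suc r * t
      small = subst (n ∸ s <_) (ℕ.m+n∸m≡n s (suc r * t)) (ℕ.∸-monoˡ-<
        (ℕ.+-cancelˡ-< (r * s) n (s + suc r * t) (subst₂ _<_ (ℕ.+-comm n (r * s)) (suc-r*w r s≤w) n<rw))
        (ℕ.≤-trans s≤w w≤n))

    -- Both sides equal r! n!: on the left the binomial coefficient and the packing absorb the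
    -- factorials of the denominator one after the other.
    flowerTerm-yes : suc r * w ≤ n + r * s →
      x * y * denominator (suc r) s t (spare r n w s) ≡ r ! * ((n C w) * (w ! * (n ∸ w) !))
    flowerTerm-yes rw≤ = begin
      x * y * (r ! * s ! * (t !) ^ suc r * spare r n w s !)
        ≡⟨ cong (λ m → x * y * (r ! * s ! * (t !) ^ suc r * m !)) spare≡ ⟩
      x * y * (r ! * s ! * (t !) ^ suc r * (n ∸ s ∸ suc r * t) !)
        ≡⟨ rearrange x y (r !) (s !) ((t !) ^ suc r) ((n ∸ s ∸ suc r * t) !) ⟩
      r ! * (x * (s ! * (y * ((t !) ^ suc r * (n ∸ s ∸ suc r * t) !))))
        ≡⟨ cong (λ z → r ! * (x * (s ! * z))) (packings-factorial t (suc r) (n ∸ s) fits) ⟩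
      r ! * (x * (s ! * (n ∸ s) !))
        ≡⟨ cong (r ! *_) (trans (nCk*k!*[n∸k]!≡n! (ℕ.≤-trans s≤w w≤n)) (sym (nCk*k!*[n∸k]!≡n! w≤n))) ⟩
      r ! * ((n C w) * (w ! * (n ∸ w) !)) ∎
      where
      open ≡-Reasoning
      fits : suc r * t ≤ n ∸ s
      fits = subst (_≤ n ∸ s) (ℕ.m+n∸m≡n s (suc r * t)) (ℕ.∸-monoˡ-≤ s
        (ℕ.+-cancelˡ-≤ (r * s) _ _ (subst₂ _≤_ (suc-r*w r s≤w) (ℕ.+-comm n (r * s)) rw≤)))
      spare≡ : spare r n w s ≡ n ∸ s ∸ suc r * t
      spare≡ = trans (cong₂ _∸_ (ℕ.+-comm n (r * s)) (suc-r*w r s≤w))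
        (trans (ℕ.[m+n]∸[m+o]≡n∸o (r * s) n (s + suc r * t)) (sym (ℕ.∸-+-assoc n s (suc r * t))))
      open ℕSolver.+-*-Solver
      rearrange : ∀ x y r s t m → x * y * (r * s * t * m) ≡ r * (x * (s * (y * (t * m))))
      rearrange = solve 6 (λ x y r s t m → x :* y :* (r :* s :* t :* m) := r :* (x :* (s :* (y :* (t :* m))))) refl

    flowerTerm : ι (x * y) ≡ ι (r !) ℚ.* (ι (n C w) ℚ.* kernelTerm (suc r) n w s)
    flowerTerm = by (suc r * w ℕ.≤? n + r * s)
      where
      k = kernelTerm (suc r) n w s
      b = denominator (suc r) s t (spare r n w s)
      assoc : ∀ a b c d → a ℚ.* (b ℚ.* (c ℚ.* d)) ≡ a ℚ.* (b ℚ.* c) ℚ.* d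
      assoc = solve 4 (λ a b c d → a :* (b :* (c :* d)) := a :* (b :* c) :* d) refl
        where open +-*-Solver
      by : Dec (suc r * w ≤ n + r * s) → ι (x * y) ≡ ι (r !) ℚ.* (ι (n C w) ℚ.* k)
      by (no rw≰) = trans (cong ι (flowerTerm-no n<rw)) (sym (trans
        (cong (λ k → ι (r !) ℚ.* (ι (n C w) ℚ.* k)) (kernelTerm-no r n w s n<rw))
        (trans (cong (ι (r !) ℚ.*_) (ℚ.*-zeroʳ (ι (n C w)))) (ℚ.*-zeroʳ (ι (r !))))))
        where n<rw = ℕ.≰⇒> rw≰
      by (yes rw≤) = *-cancelʳ-≡ (ι-pos (ℕ.>-nonZero⁻¹ b {{denominator≢0 (suc r) s t (spare r n w s)}})) (begin
        ι (x * y) ℚ.* ι b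
          ≡⟨ sym (ι-* (x * y) b) ⟩
        ι (x * y * b)
          ≡⟨ cong ι (flowerTerm-yes rw≤) ⟩
        ι (r ! * ((n C w) * (w ! * (n ∸ w) !)))
          ≡⟨ trans (ι-* (r !) _) (cong (ι (r !) ℚ.*_) (ι-* (n C w) (w ! * (n ∸ w) !))) ⟩
        ι (r !) ℚ.* (ι (n C w) ℚ.* ι (w ! * (n ∸ w) !))
          ≡⟨ cong (λ z → ι (r !) ℚ.* (ι (n C w) ℚ.* z)) (sym (IsQuotient.x*b≡a (kernelTerm-yes r n w s rw≤))) ⟩
        ι (r !) ℚ.* (ι (n C w) ℚ.* (k ℚ.* ι b))
          ≡⟨ assoc (ι (r !)) (ι (n C w)) k (ι b) ⟩
        ι (r !) ℚ.* (ι (n C w) ℚ.* k) ℚ.* ι b ∎)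
        where open ≡-Reasoning

  -- `N * D` counts sunflowers with one distinguished edge. The tuples also order the remaining `r`
  -- edges, hence the factor `r !`.
  flowerCount≡[r-1]!*N*D : ∀ r n w → w ≤ n →
    ι (flowerCount (suc r) n w) ≡ ι (r !) ℚ.* (N n w ℚ.* D (suc r) n w)
  flowerCount≡[r-1]!*N*D r n w w≤n = begin
    ι (flowerCount (suc r) n w)
      ≡⟨ ι-∑ (upTo w) _ ⟩
    ∑ℚ.∑ (upTo w) (λ s → ι ((n C s) * packings (w ∸ s) (suc r) (n ∸ s)))
      ≡⟨ ∑ℚ.∑-cong (upTo w) (λ s s∈ → flowerTerm r n w s (ℕ.<⇒≤ (∈-upTo⁻ s∈)) w≤n) ⟩
    ∑ℚ.∑ (upTo w) (λ s → ι (r !) ℚ.* (ι (n C w) ℚ.* kernelTerm (suc r) n w s))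
      ≡⟨ trans (sym (∑ℚ.*-distribˡ-∑ (upTo w) (ι (r !)))) (cong (ι (r !) ℚ.*_)
           (trans (sym (∑ℚ.*-distribˡ-∑ (upTo w) (ι (n C w)))) (cong (ι (n C w) ℚ.*_) (∑≡foldr (upTo w))))) ⟩
    ι (r !) ℚ.* (N n w ℚ.* D (suc r) n w) ∎
    where
    open ≡-Reasoning
    ∑≡foldr : ∀ {A : Set} {f : A → ℚ} xs → ∑ℚ.∑ xs f ≡ List.foldr ℚ._+_ 0ℚ (List.map f xs)
    ∑≡foldr []       = refl
    ∑≡foldr {f = f} (x ∷ xs) = cong (ℚ._+_ (f x)) (∑≡foldr xs)

  -- The witness is a kernel of w - 1 points with petals of one point each; it needs (w - 1) + (r +
  -- 1) points.
  1≤flowerCount : ∀ r n w → 1 ≤ w → w + r ≤ n → 1 ≤ flowerCount (suc r) n w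
  1≤flowerCount r n (suc w) _ w+r≤n = begin
    1
      ≤⟨ ℕ.*-mono-≤ (1≤nCk (ℕ.≤-trans (ℕ.m≤m+n w r) (ℕ.≤-trans (ℕ.n≤1+n (w + r)) w+r≤n)))
           (1≤packings (suc w ∸ w) (suc r) (n ∸ w) fits) ⟩
    (n C w) * packings (suc w ∸ w) (suc r) (n ∸ w)
      ≤⟨ NatSum.term≤∑ (upTo (suc w)) {λ s → (n C s) * packings (suc w ∸ s) (suc r) (n ∸ s)} (∈-upTo⁺ ℕ.≤-refl) ⟩
    flowerCount (suc r) n (suc w) ∎
    where
    open ℕ.≤-Reasoning
    fits : suc r * (suc w ∸ w) ≤ n ∸ w
    fits = begin
      suc r * (suc w ∸ w) ≡⟨ cong (suc r *_) (ℕ.m+n∸n≡m 1 w) ⟩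
      suc r * 1           ≡⟨ ℕ.*-identityʳ (suc r) ⟩
      suc r               ≡⟨ sym (ℕ.m+n∸m≡n w (suc r)) ⟩
      w + suc r ∸ w       ≤⟨ ℕ.∸-monoˡ-≤ w (subst (_≤ n) (sym (ℕ.+-suc w r)) w+r≤n) ⟩
      n ∸ w               ∎

open SunflowerNumber

-- The moment bounds for a rational edge probability

module SunflowerProbability where
  open import Data.Rational.Base using (_+_; _*_; _-_; _≤_)
  open Rational
  open ∑ℚ

  sunflowerProbability : (r n w : ℕ) → ℚ → ℚ
  sunflowerProbability r n w q =
    RandomSublist.𝔼 (_≟ˢ_ {n}) q (edges n w) (λ H → 𝟙 (containsSunflower? r H))

  seq-^ : ∀ x m k → seq (x Defs.^ m) k ≡ seq x k ^ m
  seq-^ x zero    k = refl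
  seq-^ x (suc m) k = cong (seq x k *_) (seq-^ x m k)

  seq-sumℝ : ∀ {A : Set} (f : A → ℝ) xs k → seq (sumℝ (List.map f xs)) k ≡ ∑ xs (λ x → seq (f x) k)
  seq-sumℝ f []       k = refl
  seq-sumℝ f (x ∷ xs) k = cong (ℚ._+_ (seq (f x) k)) (seq-sumℝ f xs k)

  ∑-filter : ∀ {A : Set} {E : A → Set} (E? : ∀ x → Dec (E x)) xs (f : A → ℚ) →
             ∑ (filter E? xs) f ≡ ∑ xs (λ x → f x * 𝟙 (E? x))
  ∑-filter E? []       f = refl
  ∑-filter {E = E} E? (x ∷ xs) f = by (E? x)
    where
    by : Dec (E x) → ∑ (filter E? (x ∷ xs)) f ≡ f x * 𝟙 (E? x) + ∑ xs (λ x → f x * 𝟙 (E? x))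
    by (yes e) = trans (cong (λ ys → ∑ ys f) (filter-accept E? e)) (cong₂ _+_
      (sym (trans (cong (f x *_) (𝟙-yes (E? x) e)) (ℚ.*-identityʳ (f x)))) (∑-filter E? xs f))
    by (no ¬e) = trans (cong (λ ys → ∑ ys f) (filter-reject E? ¬e)) (trans (∑-filter E? xs f)
      (trans (sym (ℚ.+-identityˡ (∑ xs (λ x → f x * 𝟙 (E? x))))) (cong (ℚ._+ ∑ xs (λ x → f x * 𝟙 (E? x)))
        (sym (trans (cong (f x *_) (𝟙-no (E? x) ¬e)) (ℚ.*-zeroʳ (f x)))))))

  -- Real operations act termwise, so each approximation of the probability is the polynomial
  -- `sunflowerProbability` at an approximation of `p`, even where this lies outside [0 , 1].
  seq-probability : ∀ r n w p k →
    seq (probability n p w (containsSunflower? r)) k ≡ sunflowerProbability r n w (seq p k)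
  seq-probability r n w p k = begin
    seq (probability n p w (containsSunflower? r)) k
      ≡⟨ seq-sumℝ _ (filter (containsSunflower? r) (sublists (edges n w))) k ⟩
    ∑ (filter (containsSunflower? r) (sublists (edges n w)))
      (λ H → seq (p Defs.^ length H) k * seq ((Defs.1ℝ Defs.- p) Defs.^ ((n C w) ℕ.∸ length H)) k)
      ≡⟨ ∑-filter (containsSunflower? r) (sublists (edges n w)) _ ⟩
    ∑ (sublists (edges n w))
      (λ H → seq (p Defs.^ length H) k * seq ((Defs.1ℝ Defs.- p) Defs.^ ((n C w) ℕ.∸ length H)) k *
             𝟙 (containsSunflower? r H))
      ≡⟨ ∑-cong (sublists (edges n w)) (λ H _ → cong (_* 𝟙 (containsSunflower? r H))
           (cong₂ _*_ (seq-^ p (length H) k) (trans (seq-^ (Defs.1ℝ Defs.- p) ((n C w) ℕ.∸ length H) k)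
             (cong (λ m → (1ℚ - seq p k) ^ (m ℕ.∸ length H)) (sym (length-edges n w)))))) ⟩
    ∑ (sublists (edges n w))
      (λ H → seq p k ^ length H * (1ℚ - seq p k) ^ (length (edges n w) ℕ.∸ length H) *
             𝟙 (containsSunflower? r H))
      ≡⟨ RandomSublist.∑-sublists _≟ˢ_ (seq p k) (edges n w) (λ H → 𝟙 (containsSunflower? r H)) ⟩
    sunflowerProbability r n w (seq p k) ∎
    where open ≡-Reasoning

  module _ (r n w : ℕ) {q : ℚ} (0≤q : 0ℚ ≤ q) (q≤1 : q ≤ 1ℚ) where
    private
      r₂ = suc (suc r)
      module M = RandomSublist.Moments (_≟ˢ_ {n}) 0≤q q≤1 (edges-unique n w) (flowers n r₂ w)
        (λ {S} S∈ → Unique-toList S (proj₁ (flowers-sunflower {w = w} S∈)))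
        (λ {S} S∈ → All-toList S λ i → ∈-edges⁺ (lookup S i) (flowers-size S∈ i))
      μ≡ : M.μ ≡ ι (flowerCount r₂ n w) * q ^ r₂
      μ≡ = cong (λ T → ι T * q ^ r₂) (length-flowers r₂ w)

    sunflowerProbability-nonNeg : 0ℚ ≤ sunflowerProbability r₂ n w q
    sunflowerProbability-nonNeg = subst (_≤ sunflowerProbability r₂ n w q)
      (RandomSublist.𝔼-const _≟ˢ_ q (edges n w) 0ℚ)
      (RandomSublist.𝔼-mono _≟ˢ_ 0≤q q≤1 (edges n w) λ H _ → 𝟙-nonNeg (containsSunflower? r₂ H))

    sunflowerProbability≤1 : sunflowerProbability r₂ n w q ≤ 1ℚ
    sunflowerProbability≤1 = subst (sunflowerProbability r₂ n w q ≤_)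
      (RandomSublist.𝔼-const _≟ˢ_ q (edges n w) 1ℚ)
      (RandomSublist.𝔼-mono _≟ˢ_ 0≤q q≤1 (edges n w) λ H _ → 𝟙≤1 (containsSunflower? r₂ H))

    sunflowerProbability≤μ : sunflowerProbability r₂ n w q ≤ ι (flowerCount r₂ n w) * q ^ r₂
    sunflowerProbability≤μ = subst (sunflowerProbability r₂ n w q ≤_) μ≡
      (M.firstMoment (containsSunflower? r₂) λ H H⊆edges (S , S⊆H , sunflower) →
        S , flowers-complete S (λ i → ∈-edges⁻ (H⊆edges (VecAll.lookup⁺ S⊆H i))) sunflower , VecAll.toList⁺ S⊆H)

    c*[1-sunflowerProbability]≤ : ∀ {c} → 1ℚ ≤ c → c ^ r₂ ≤ ι (flowerCount r₂ n w) * q ^ r₂ →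
      c * (1ℚ - sunflowerProbability r₂ n w q) ≤ ι (suc r₂ ℕ.^ r₂)
    c*[1-sunflowerProbability]≤ {c} 1≤c c^r≤ =
      M.secondMoment (containsSunflower? r₂)
        (λ H (S , S∈ , S⊆H) → S , VecAll.toList⁻ S⊆H , flowers-sunflower {w = w} S∈)
        (s≤s z≤n) (matching^≤ r w) 1≤c (subst (c ^ r₂ ≤_) (sym μ≡) c^r≤)

open SunflowerProbability

-- Clamping to the unit interval, and Lipschitz bounds

module RationalEstimates where
  open import Data.Rational.Base using (_+_; _*_; _-_; -_; _≤_; _<_; _⊔_; _⊓_; ½) renaming (∣_∣ to ∥_∥)
  open Rational
  open +-*-Solver using (solve; _:=_; _:+_; _:*_; _:-_; :-_; con)

  ∣∣≤ : ∀ {a d} → a ≤ d → - a ≤ d → ∥ a ∥ ≤ d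
  ∣∣≤ {a} {d} a≤d -a≤d with ℚ.∣p∣≡p∨∣p∣≡-p a
  ... | inj₁ eq = subst (_≤ d) (sym eq) a≤d
  ... | inj₂ eq = subst (_≤ d) (sym eq) -a≤d

  a≤∣a∣ : ∀ a → a ≤ ∥ a ∥
  a≤∣a∣ a with ℚ.≤-total 0ℚ a
  ... | inj₁ 0≤a = ℚ.≤-reflexive (sym (ℚ.0≤p⇒∣p∣≡p 0≤a))
  ... | inj₂ a≤0 = ℚ.≤-trans a≤0 (ℚ.0≤∣p∣ a)

  ∣∣-swap : ∀ a b → ∥ a - b ∥ ≡ ∥ b - a ∥
  ∣∣-swap a b = trans (sym (ℚ.∣-p∣≡∣p∣ (a - b))) (cong ∥_∥ (neg a b))
    where
    neg : ∀ a b → - (a - b) ≡ b - a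
    neg = solve 2 (λ a b → :- (a :- b) := b :- a) refl

  ∣∣≤⇒≤ : ∀ {a b d} → ∥ a - b ∥ ≤ d → a ≤ b + d
  ∣∣≤⇒≤ {a} {b} {d} close = subst (_≤ b + d) (cancel b a)
    (ℚ.+-monoʳ-≤ b (ℚ.≤-trans (a≤∣a∣ (a - b)) close))
    where
    cancel : ∀ b a → b + (a - b) ≡ a
    cancel = solve 2 (λ b a → b :+ (a :- b) := a) refl

  ∣^∣ : ∀ a m → ∥ a ^ m ∥ ≡ ∥ a ∥ ^ m
  ∣^∣ a zero    = refl
  ∣^∣ a (suc m) = trans (ℚ.∣p*q∣≡∣p∣*∣q∣ a (a ^ m)) (cong (∥ a ∥ *_) (∣^∣ a m))

  ^suc≤ : ∀ {a} m → 0ℚ ≤ a → a ≤ 1ℚ → a ^ suc m ≤ a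
  ^suc≤ {a} m 0≤a a≤1 = subst (a ^ suc m ≤_) (ℚ.*-identityʳ a) (*-monoˡ 0≤a (^≤1 m 0≤a a≤1))

  a≤a+b : ∀ {a b} → 0ℚ ≤ b → a ≤ a + b
  a≤a+b {a} {b} 0≤b = subst (_≤ a + b) (ℚ.+-identityʳ a) (ℚ.+-monoʳ-≤ a 0≤b)

  ½*-pos : ∀ {a} → 0ℚ < a → 0ℚ < ½ * a
  ½*-pos = *-pos (ℚ.positive⁻¹ ½)

  halves : ∀ a → ½ * a + ½ * a ≡ a
  halves = solve 1 (λ a → con ½ :* a :+ con ½ :* a := a) refl

  reciprocal : ∀ {a} → 0ℚ < a → ∃[ b ] 0ℚ < b × a * b ≡ 1ℚ
  reciprocal {a} 0<a = ℚ.1/ a , ℚ.positive⁻¹ (ℚ.1/ a) {{ℚ.1/pos⇒pos a}} , ℚ.*-inverseʳ a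
    where instance
      _ = ℚ.positive 0<a
      _ = ℚ.pos⇒nonZero a

  -- The witness is 1 / (1 + a / η): the summand 1 gives c ≤ 1, the summand a / η gives a c ≤ η.
  smallFactor : ∀ {a η} → 0ℚ ≤ a → 0ℚ < η → ∃[ c ] 0ℚ < c × c ≤ 1ℚ × a * c ≤ η
  smallFactor {a} {η} 0≤a 0<η =
    let e , 0<e , ηe≡1 = reciprocal 0<η
        1≤b = a≤a+b (*-nonNeg 0≤a (ℚ.<⇒≤ 0<e))
        c , 0<c , bc≡1 = reciprocal (ℚ.<-≤-trans (ℚ.positive⁻¹ 1ℚ) 1≤b)
        0≤c = ℚ.<⇒≤ 0<c
    in c , 0<c
     , subst₂ _≤_ (ℚ.*-identityˡ c) bc≡1 (*-monoʳ 0≤c 1≤b)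
     , (begin
        a * c                     ≡⟨ sym (trans (cong (_* (a * c)) ηe≡1) (ℚ.*-identityˡ (a * c))) ⟩
        η * e * (a * c)           ≡⟨ rearrange η e a c ⟩
        η * (a * e * c)           ≤⟨ *-monoˡ (ℚ.<⇒≤ 0<η) (*-monoʳ 0≤c
                                       (subst (_≤ 1ℚ + a * e) (ℚ.+-identityˡ (a * e)) (ℚ.+-monoˡ-≤ (a * e) 0≤1))) ⟩
        η * ((1ℚ + a * e) * c)    ≡⟨ trans (cong (η *_) bc≡1) (ℚ.*-identityʳ η) ⟩
        η                         ∎)
    where
    open ℚ.≤-Reasoning
    rearrange : ∀ η e a c → η * e * (a * c) ≡ η * (a * e * c)
    rearrange = solve 4 (λ η e a c → η :* e :* (a :* c) := η :* (a :* e :* c)) refl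

  largeFactor : ∀ {a η} → 0ℚ ≤ a → 0ℚ < η → ∃[ c ] 1ℚ ≤ c × a ≤ c * η
  largeFactor {a} {η} 0≤a 0<η =
    let e , 0<e , ηe≡1 = reciprocal 0<η in
    1ℚ + a * e , a≤a+b (*-nonNeg 0≤a (ℚ.<⇒≤ 0<e)) ,
    subst (a ≤_) (trans (cong (λ z → η + a * z) (sym ηe≡1)) (rearrange η a e))
      (subst₂ _≤_ (ℚ.+-identityˡ a) (cong (ℚ._+_ η) (sym (ℚ.*-identityʳ a))) (ℚ.+-monoˡ-≤ a (ℚ.<⇒≤ 0<η)))
    where
    rearrange : ∀ η a e → η + a * (η * e) ≡ (1ℚ + a * e) * η
    rearrange = solve 3 (λ η a e → η :+ a :* (η :* e) := (con 1ℚ :+ a :* e) :* η) refl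

  -- The rational approximations of a real number in [0 , 1] may leave [0 , 1].
  clamp : ℚ → ℚ
  clamp a = 0ℚ ⊔ (a ⊓ 1ℚ)

  0≤clamp : ∀ a → 0ℚ ≤ clamp a
  0≤clamp a = ℚ.p≤p⊔q 0ℚ (a ⊓ 1ℚ)

  clamp≤1 : ∀ a → clamp a ≤ 1ℚ
  clamp≤1 a = ℚ.⊔-lub 0≤1 (ℚ.p⊓q≤q a 1ℚ)

  clamp≤ : ∀ {a b} → 0ℚ ≤ b → a ≤ b → clamp a ≤ b
  clamp≤ {a} 0≤b a≤b = ℚ.⊔-lub 0≤b (ℚ.≤-trans (ℚ.p⊓q≤p a 1ℚ) a≤b)

  -- An approximation `a` of a number in [0 , 1] may exceed 1 and be cut down. A factor 2 is
  -- sacrificed: a ≤ 2 forces b ≤ 1, so `b` survives the cut.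
  ≤clamp : ∀ {a b} → 0ℚ ≤ b → b + b ≤ a → a ≤ 1ℚ + 1ℚ → b ≤ clamp a
  ≤clamp {a} {b} 0≤b b+b≤a a≤2 = ℚ.≤-trans (ℚ.⊓-glb (ℚ.≤-trans (a≤a+b 0≤b) b+b≤a) b≤1) (ℚ.p≤q⊔p 0ℚ (a ⊓ 1ℚ))
    where
    b≤1 : b ≤ 1ℚ
    b≤1 = subst₂ _≤_ (half+ b) (half+ 1ℚ) (*-monoˡ (ℚ.<⇒≤ (ℚ.positive⁻¹ ½)) (ℚ.≤-trans b+b≤a a≤2))
      where
      half+ : ∀ b → ½ * (b + b) ≡ b
      half+ = solve 1 (λ b → con ½ :* (b :+ b) := b) refl

  clamp-close : ∀ {a d} → 0ℚ ≤ d → 0ℚ ≤ a + d → a ≤ 1ℚ + d → ∥ a - clamp a ∥ ≤ d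
  clamp-close {a} {d} 0≤d 0≤a+d a≤1+d = ∣∣≤
    (subtract (ℚ.≤-trans low (ℚ.+-monoˡ-≤ d (ℚ.p≤q⊔p 0ℚ (a ⊓ 1ℚ)))))
    (subst (_≤ d) (neg (clamp a) a) (subtract (ℚ.⊔-lub 0≤a+d (ℚ.≤-trans (ℚ.p⊓q≤p a 1ℚ) (a≤a+b 0≤d)))))
    where
    neg : ∀ a b → a - b ≡ - (b - a)
    neg = solve 2 (λ a b → a :- b := :- (b :- a)) refl
    cancel : ∀ b d → b + d - b ≡ d
    cancel = solve 2 (λ b d → b :+ d :- b := d) refl
    subtract : ∀ {a b} → a ≤ b + d → a - b ≤ d
    subtract {a} {b} le = subst (a - b ≤_) (cancel b d) (ℚ.+-monoˡ-≤ (- b) le)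
    low : a ≤ (a ⊓ 1ℚ) + d
    low with ℚ.⊓-sel a 1ℚ
    ... | inj₁ eq = subst (λ z → a ≤ z + d) (sym eq) (a≤a+b 0≤d)
    ... | inj₂ eq = subst (λ z → a ≤ z + d) (sym eq) a≤1+d

  -- The domain is [-2 , 2], which leaves room for approximations slightly outside [0 , 1]. The size
  -- bound is carried along because the product rule needs it.
  record Lipschitz (f : ℚ → ℚ) : Set where
    field
      constant : ℚ
      bounded  : ∀ {a} → ∥ a ∥ ≤ 1ℚ + 1ℚ → ∥ f a ∥ ≤ constant
      steep    : ∀ {a b} → ∥ a ∥ ≤ 1ℚ + 1ℚ → ∥ b ∥ ≤ 1ℚ + 1ℚ → ∥ f a - f b ∥ ≤ constant * ∥ a - b ∥

    constant-nonNeg : 0ℚ ≤ constant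
    constant-nonNeg = ℚ.≤-trans (ℚ.0≤∣p∣ (f 0ℚ)) (bounded (+-nonNeg 0≤1 0≤1))

  open Lipschitz

  const-Lipschitz : ∀ c → Lipschitz (λ _ → c)
  const-Lipschitz c .constant = ∥ c ∥
  const-Lipschitz c .bounded _ = ℚ.≤-refl
  const-Lipschitz c .steep {a} {b} _ _ = subst (_≤ ∥ c ∥ * ∥ a - b ∥)
    (cong ∥_∥ (sym (ℚ.+-inverseʳ c))) (*-nonNeg (ℚ.0≤∣p∣ c) (ℚ.0≤∣p∣ (a - b)))

  id-Lipschitz : Lipschitz (λ a → a)
  id-Lipschitz .constant = 1ℚ + 1ℚ
  id-Lipschitz .bounded a≤2 = a≤2
  id-Lipschitz .steep {a} {b} _ _ = subst (_≤ (1ℚ + 1ℚ) * ∥ a - b ∥) (ℚ.*-identityˡ ∥ a - b ∥)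
    (*-monoʳ (ℚ.0≤∣p∣ (a - b)) (a≤a+b {1ℚ} {1ℚ} 0≤1))

  neg-Lipschitz : ∀ {f} → Lipschitz f → Lipschitz (λ a → - f a)
  neg-Lipschitz F .constant = constant F
  neg-Lipschitz {f} F .bounded {a} a≤2 = subst (_≤ constant F) (sym (ℚ.∣-p∣≡∣p∣ (f a))) (bounded F a≤2)
  neg-Lipschitz {f} F .steep {a} {b} a≤2 b≤2 = subst (_≤ constant F * ∥ a - b ∥)
    (trans (sym (ℚ.∣-p∣≡∣p∣ (f a - f b))) (cong ∥_∥ (ℚ.neg-distrib-+ (f a) (- f b)))) (steep F a≤2 b≤2)

  +-Lipschitz : ∀ {f g} → Lipschitz f → Lipschitz g → Lipschitz (λ a → f a + g a)
  +-Lipschitz F G .constant = constant F + constant G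
  +-Lipschitz {f} {g} F G .bounded {a} a≤2 =
    ℚ.≤-trans (ℚ.∣p+q∣≤∣p∣+∣q∣ (f a) (g a)) (ℚ.+-mono-≤ (bounded F a≤2) (bounded G a≤2))
  +-Lipschitz {f} {g} F G .steep {a} {b} a≤2 b≤2 = begin
    ∥ (f a + g a) - (f b + g b) ∥                         ≡⟨ cong ∥_∥ (regroup (f a) (g a) (f b) (g b)) ⟩
    ∥ (f a - f b) + (g a - g b) ∥                         ≤⟨ ℚ.∣p+q∣≤∣p∣+∣q∣ (f a - f b) (g a - g b) ⟩
    ∥ f a - f b ∥ + ∥ g a - g b ∥                         ≤⟨ ℚ.+-mono-≤ (steep F a≤2 b≤2) (steep G a≤2 b≤2) ⟩
    constant F * ∥ a - b ∥ + constant G * ∥ a - b ∥       ≡⟨ sym (ℚ.*-distribʳ-+ ∥ a - b ∥ (constant F) (constant G)) ⟩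
    (constant F + constant G) * ∥ a - b ∥                 ∎
    where
    open ℚ.≤-Reasoning
    regroup : ∀ a b c d → (a + b) - (c + d) ≡ (a - c) + (b - d)
    regroup = solve 4 (λ a b c d → (a :+ b) :- (c :+ d) := (a :- c) :+ (b :- d)) refl

  *-Lipschitz : ∀ {f g} → Lipschitz f → Lipschitz g → Lipschitz (λ a → f a * g a)
  *-Lipschitz F G .constant = constant F * constant G + constant G * constant F
  *-Lipschitz {f} {g} F G .bounded {a} a≤2 = ℚ.≤-trans
    (subst (_≤ constant F * constant G) (sym (ℚ.∣p*q∣≡∣p∣*∣q∣ (f a) (g a)))
      (*-mono (ℚ.0≤∣p∣ (f a)) (ℚ.0≤∣p∣ (g a)) (bounded F a≤2) (bounded G a≤2)))
    (a≤a+b (*-nonNeg (constant-nonNeg G) (constant-nonNeg F)))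
  *-Lipschitz {f} {g} F G .steep {a} {b} a≤2 b≤2 = begin
    ∥ f a * g a - f b * g b ∥
      ≡⟨ cong ∥_∥ (regroup (f a) (g a) (f b) (g b)) ⟩
    ∥ f a * (g a - g b) + g b * (f a - f b) ∥
      ≤⟨ ℚ.∣p+q∣≤∣p∣+∣q∣ (f a * (g a - g b)) (g b * (f a - f b)) ⟩
    ∥ f a * (g a - g b) ∥ + ∥ g b * (f a - f b) ∥
      ≡⟨ cong₂ _+_ (ℚ.∣p*q∣≡∣p∣*∣q∣ (f a) (g a - g b)) (ℚ.∣p*q∣≡∣p∣*∣q∣ (g b) (f a - f b)) ⟩
    ∥ f a ∥ * ∥ g a - g b ∥ + ∥ g b ∥ * ∥ f a - f b ∥
      ≤⟨ ℚ.+-mono-≤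
           (*-mono (ℚ.0≤∣p∣ (f a)) (ℚ.0≤∣p∣ (g a - g b)) (bounded F a≤2) (steep G a≤2 b≤2))
           (*-mono (ℚ.0≤∣p∣ (g b)) (ℚ.0≤∣p∣ (f a - f b)) (bounded G b≤2) (steep F a≤2 b≤2)) ⟩
    constant F * (constant G * ∥ a - b ∥) + constant G * (constant F * ∥ a - b ∥)
      ≡⟨ collect (constant F) (constant G) ∥ a - b ∥ ⟩
    (constant F * constant G + constant G * constant F) * ∥ a - b ∥ ∎
    where
    open ℚ.≤-Reasoning
    regroup : ∀ a b c d → a * b - c * d ≡ a * (b - d) + d * (a - c)
    regroup = solve 4 (λ a b c d → a :* b :- c :* d := a :* (b :- d) :+ d :* (a :- c)) refl
    collect : ∀ m n d → m * (n * d) + n * (m * d) ≡ (m * n + n * m) * d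
    collect = solve 3 (λ m n d → m :* (n :* d) :+ n :* (m :* d) := (m :* n :+ n :* m) :* d) refl

  -- The recursion for `𝔼` presents it as a polynomial in `q`, assembled by sums and products.
  𝔼-Lipschitz : ∀ {A : Set} (_≟_ : ∀ (x y : A) → Dec (x ≡ y)) L (f : List A → ℚ) →
                Lipschitz (λ q → RandomSublist.𝔼 _≟_ q L f)
  𝔼-Lipschitz _≟_ []      f = const-Lipschitz (f [])
  𝔼-Lipschitz _≟_ (x ∷ L) f = +-Lipschitz
    (*-Lipschitz (+-Lipschitz (const-Lipschitz 1ℚ) (neg-Lipschitz id-Lipschitz)) (𝔼-Lipschitz _≟_ L f))
    (*-Lipschitz id-Lipschitz (𝔼-Lipschitz _≟_ L (f ∘ (x ∷_))))

open RationalEstimates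

-- From inequalities between reals to their approximations

module RealSequences where
  open import Data.Rational.Base using (_+_; _*_; _-_; -_; _≤_; _<_; ½) renaming (∣_∣ to ∥_∥)
  open Rational
  open +-*-Solver using (solve; _:=_; _:+_; _:*_; _:-_; :-_; con)
  open Lipschitz

  infixr 4 _&_
  _&_ : ∀ {P Q : ℕ → Set} → Eventually P → Eventually Q → Eventually (λ n → P n × Q n)
  (M , p) & (N , q) = M ℕ.⊔ N , λ n n≥ →
    p n (ℕ.m⊔n≤o⇒m≤o M N n≥) , q n (ℕ.m⊔n≤o⇒n≤o M N n≥)

  eventually : ∀ {P Q : ℕ → Set} → (∀ n → P n → Q n) → Eventually P → Eventually Q
  eventually f (M , p) = M , λ n n≥ → f n (p n n≥)

  atPrecision : ∀ {x y ε} → x Defs.≤ y → 0ℚ < ε → Eventually (λ k → seq x k ≤ seq y k + ε)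
  atPrecision {ε = ε} x≤y 0<ε = x≤y ε {{ℚ.positive 0<ε}}

  moveʳ : ∀ {a b d} → a ≤ b + d → a - d ≤ b
  moveʳ {a} {b} {d} le = subst (a - d ≤_) (cancel b d) (ℚ.+-monoˡ-≤ (- d) le)
    where
    cancel : ∀ b d → b + d - d ≡ b
    cancel = solve 2 (λ b d → b :+ d :- d := b) refl

  +-cancelʳ-≤ : ∀ {a b} d → a + d ≤ b + d → a ≤ b
  +-cancelʳ-≤ {a} {b} d le = subst (_≤ b) (cancel a d) (moveʳ le)
    where
    cancel : ∀ a d → a + d - d ≡ a
    cancel = solve 2 (λ a d → a :+ d :- d := a) refl

  close⇒⟶ : ∀ {x l ε} → 0ℚ < ε →
    Eventually (λ k → l ≤ seq x k + ½ * ε × seq x k ≤ l + ½ * ε) →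
    (fromℚ l Defs.- fromℚ ε Defs.< x) × (x Defs.< fromℚ l Defs.+ fromℚ ε)
  close⇒⟶ {x} {l} {ε} 0<ε ev =
    (½ * ε , ℚ.positive (½*-pos 0<ε) , eventually (λ k (low , _) →
      subst (_≤ seq x k) (below l ε) (moveʳ low)) ev) ,
    (½ * ε , ℚ.positive (½*-pos 0<ε) , eventually (λ k (_ , high) →
      subst (seq x k + ½ * ε ≤_) (above l ε) (ℚ.+-monoˡ-≤ (½ * ε) high)) ev)
    where
    below : ∀ l ε → l - ½ * ε ≡ l - ε + ½ * ε
    below = solve 2 (λ l ε → l :- con ½ :* ε := l :- ε :+ con ½ :* ε) refl
    above : ∀ l ε → l + ½ * ε + ½ * ε ≡ l + ε
    above = solve 2 (λ l ε → l :+ con ½ :* ε :+ con ½ :* ε := l :+ ε) refl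

  -- The lower bound δ lets additive errors be absorbed into multiples of θ. It is chosen with δ ≤ 1
  -- and V δ ≤ 1/4: an approximation t of θ with -δ ≤ t ≤ δ would make t^(r + 1) V at most 1/4,
  -- although it is at least 1/2.
  root-bounds : ∀ {r V θ} → 0ℚ < V → IsInverseRoot (suc r) V θ →
    ∃[ δ ] 0ℚ < δ × Eventually (λ k →
      δ ≤ seq θ k × ½ ≤ seq θ k ^ suc r * V × seq θ k ^ suc r * V ≤ 1ℚ + 1ℚ)
  root-bounds {r} {V} {θ} 0<V (0≤θ , ≤1 , 1≤) = δ , 0<δ ,
    eventually bounds
        (atPrecision {0ℝ} {θ} 0≤θ 0<δ & atPrecision {x} {1ℝ} ≤1 (ℚ.positive⁻¹ 1ℚ) &
        atPrecision {1ℝ} {x} 1≤ (ℚ.positive⁻¹ ½))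
    where
    choice = smallFactor (ℚ.<⇒≤ 0<V) (½*-pos (ℚ.positive⁻¹ ½))
    δ = proj₁ choice
    0<δ = proj₁ (proj₂ choice)
    δ≤1 = proj₁ (proj₂ (proj₂ choice))
    Vδ≤¼ = proj₂ (proj₂ (proj₂ choice))
    x = θ Defs.^ suc r Defs.* fromℚ V
    seq-x : ∀ k → seq x k ≡ seq θ k ^ suc r * V
    seq-x k = cong (_* V) (seq-^ θ (suc r) k)
    bounds : ∀ k → (0ℚ ≤ seq θ k + δ) × (seq x k ≤ 1ℚ + 1ℚ) × (1ℚ ≤ seq x k + ½) →
             δ ≤ seq θ k × ½ ≤ seq θ k ^ suc r * V × seq θ k ^ suc r * V ≤ 1ℚ + 1ℚ
    bounds k (0≤t+δ , x≤2 , 1≤x+½) = δ≤t , ½≤ , subst (_≤ 1ℚ + 1ℚ) (seq-x k) x≤2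
      where
      t = seq θ k
      ½≤ : ½ ≤ t ^ suc r * V
      ½≤ = subst (½ ≤_) (seq-x k) (moveʳ 1≤x+½)
      small : t ≤ δ → t ^ suc r * V ≤ ½ * ½
      small t≤δ = begin
        t ^ suc r * V            ≤⟨ *-monoʳ (ℚ.<⇒≤ 0<V) (a≤∣a∣ (t ^ suc r)) ⟩
        ∥ t ^ suc r ∥ * V        ≡⟨ cong (_* V) (∣^∣ t (suc r)) ⟩
        ∥ t ∥ ^ suc r * V        ≤⟨ *-monoʳ (ℚ.<⇒≤ 0<V) (^-mono (suc r) (ℚ.0≤∣p∣ t) ∣t∣≤δ) ⟩
        δ ^ suc r * V            ≤⟨ *-monoʳ (ℚ.<⇒≤ 0<V) (^suc≤ r (ℚ.<⇒≤ 0<δ) δ≤1) ⟩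
        δ * V                    ≡⟨ ℚ.*-comm δ V ⟩
        V * δ                    ≤⟨ Vδ≤¼ ⟩
        ½ * ½                    ∎
        where
        open ℚ.≤-Reasoning
        cancel : ∀ t d → t + d - t ≡ d
        cancel = solve 2 (λ t d → t :+ d :- t := d) refl
        ∣t∣≤δ : ∥ t ∥ ≤ δ
        ∣t∣≤δ = ∣∣≤ t≤δ (subst₂ _≤_ (ℚ.+-identityˡ (- t)) (cancel t δ) (ℚ.+-monoˡ-≤ (- t) 0≤t+δ))
      δ≤t : δ ≤ t
      δ≤t with ℚ.≤-total δ t
      ... | inj₁ δ≤t = δ≤t
      ... | inj₂ t≤δ = ⊥-elim (ℚ.<-irrefl refl (ℚ.<-≤-trans ¼<½ (ℚ.≤-trans ½≤ (small t≤δ))))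
        where
        ¼<½ : ½ * ½ < ½
        ¼<½ = ℚ.*<* (ℤ.+<+ (s≤s (s≤s (s≤s z≤n))))

  -- The Lipschitz constant dictates how near to [0 , 1] the approximation must come; a distance of
  -- at most 1 also keeps it in [-2 , 2].
  clamped : ∀ {f} → Lipschitz f → ∀ {p} → 0ℝ Defs.≤ p → p Defs.≤ 1ℝ → ∀ {η} → 0ℚ < η →
    Eventually (λ k → ∥ f (seq p k) - f (clamp (seq p k)) ∥ ≤ η × seq p k ≤ 1ℚ + 1ℚ)
  clamped {f} F {p} 0≤p p≤1 {η} 0<η = eventually bounds (atPrecision {0ℝ} {p} 0≤p 0<d & atPrecision {p} {1ℝ} p≤1 0<d)
    where
    choice = smallFactor (constant-nonNeg F) 0<η
    d = proj₁ choice
    0<d = proj₁ (proj₂ choice)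
    d≤1 = proj₁ (proj₂ (proj₂ choice))
    Md≤η = proj₂ (proj₂ (proj₂ choice))
    bounds : ∀ k → (0ℚ ≤ seq p k + d) × (seq p k ≤ 1ℚ + d) →
             ∥ f (seq p k) - f (clamp (seq p k)) ∥ ≤ η × seq p k ≤ 1ℚ + 1ℚ
    bounds k (0≤a+d , a≤1+d) =
      ℚ.≤-trans (steep F (∣∣≤ a≤2 -a≤2) (∣∣≤ c≤2 -c≤2))
        (ℚ.≤-trans (*-monoˡ (constant-nonNeg F) (clamp-close (ℚ.<⇒≤ 0<d) 0≤a+d a≤1+d)) Md≤η) , a≤2
      where
      a = seq p k
      a≤2 : a ≤ 1ℚ + 1ℚ
      a≤2 = ℚ.≤-trans a≤1+d (ℚ.+-monoʳ-≤ 1ℚ d≤1)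
      c≤2 : clamp a ≤ 1ℚ + 1ℚ
      c≤2 = ℚ.≤-trans (clamp≤1 a) (a≤a+b {1ℚ} {1ℚ} 0≤1)
      neg≤ : ∀ {b} → 0ℚ ≤ b + d → - b ≤ 1ℚ + 1ℚ
      neg≤ {b} 0≤b+d = ℚ.≤-trans
        (subst₂ _≤_ (ℚ.+-identityˡ (- b)) (cancel b d) (ℚ.+-monoˡ-≤ (- b) 0≤b+d))
        (ℚ.≤-trans d≤1 (a≤a+b {1ℚ} {1ℚ} 0≤1))
        where
        cancel : ∀ t d → t + d - t ≡ d
        cancel = solve 2 (λ t d → t :+ d :- t := d) refl
      -a≤2 : - a ≤ 1ℚ + 1ℚ
      -a≤2 = neg≤ 0≤a+d
      -c≤2 : - clamp a ≤ 1ℚ + 1ℚ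
      -c≤2 = neg≤ (+-nonNeg (0≤clamp a) (ℚ.<⇒≤ 0<d))

  module _ {r : ℕ} {V : ℚ} {θ p : ℝ} (0<V : 0ℚ < V) (root : IsInverseRoot (suc r) V θ) where

    -- With error c δ ≤ c t the clamped value is at most 2 c t, where t approximates θ. Then t^(r +
    -- 1) V ≤ 2, and (2c)^(r + 1) ≤ 2c because 2c ≤ 1.
    clamp-upper : ∀ {c} → 0ℚ < c → c + c ≤ 1ℚ → p Defs.≤ fromℚ c Defs.* θ →
      Eventually (λ k → clamp (seq p k) ^ suc r * V ≤ (c + c) * (1ℚ + 1ℚ))
    clamp-upper {c} 0<c 2c≤1 p≤cθ = eventually bound (ev & atPrecision {p} {fromℚ c Defs.* θ} p≤cθ (*-pos 0<c 0<δ))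
      where
      choice = root-bounds {r} {V} {θ} 0<V root
      δ = proj₁ choice
      0<δ = proj₁ (proj₂ choice)
      ev = proj₂ (proj₂ choice)
      0≤2c : 0ℚ ≤ c + c
      0≤2c = +-nonNeg (ℚ.<⇒≤ 0<c) (ℚ.<⇒≤ 0<c)
      bound : ∀ k → ((δ ≤ seq θ k × ½ ≤ seq θ k ^ suc r * V × seq θ k ^ suc r * V ≤ 1ℚ + 1ℚ) ×
                     seq p k ≤ c * seq θ k + c * δ) →
              clamp (seq p k) ^ suc r * V ≤ (c + c) * (1ℚ + 1ℚ)
      bound k ((δ≤t , _ , tV≤2) , p≤) = begin
        clamp (seq p k) ^ suc r * V
          ≤⟨ *-monoʳ (ℚ.<⇒≤ 0<V) (^-mono (suc r) (0≤clamp (seq p k)) q≤) ⟩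
        ((c + c) * t) ^ suc r * V
          ≡⟨ trans (cong (_* V) (^-distrib-* (c + c) t (suc r))) (ℚ.*-assoc ((c + c) ^ suc r) (t ^ suc r) V) ⟩
        (c + c) ^ suc r * (t ^ suc r * V)
          ≤⟨ *-mono (^-nonNeg (suc r) 0≤2c) (*-nonNeg (^-nonNeg (suc r) 0≤t) (ℚ.<⇒≤ 0<V))
               (^suc≤ r 0≤2c 2c≤1) tV≤2 ⟩
        (c + c) * (1ℚ + 1ℚ) ∎
        where
        open ℚ.≤-Reasoning
        t = seq θ k
        0≤t : 0ℚ ≤ t
        0≤t = ℚ.≤-trans (ℚ.<⇒≤ 0<δ) δ≤t
        q≤ : clamp (seq p k) ≤ (c + c) * t
        q≤ = clamp≤ (*-nonNeg 0≤2c 0≤t) (ℚ.≤-trans p≤ (subst (c * t + c * δ ≤_)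
          (sym (ℚ.*-distribʳ-+ t c c)) (ℚ.+-monoʳ-≤ (c * t) (*-monoˡ (ℚ.<⇒≤ 0<c) δ≤t))))

    -- The factor 6c is 3b with b = 2c. One b t is lost to the error b δ, and the remaining 2 b t is
    -- halved by clamping. Finally b = 2c compensates for the lower bound 1/2 on t^(r + 1) V.
    clamp-lower : ∀ {c} → 0ℚ < c → Eventually (λ k → seq p k ≤ 1ℚ + 1ℚ) →
      fromℚ ((c + c) + ((c + c) + (c + c))) Defs.* θ Defs.≤ p →
      Eventually (λ k → c ^ suc r ≤ clamp (seq p k) ^ suc r * V)
    clamp-lower {c} 0<c p≤2 cθ≤p = eventually bound (ev & p≤2 &
        atPrecision {fromℚ (b + (b + b)) Defs.* θ} {p} cθ≤p (*-pos 0<b 0<δ))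
      where
      choice = root-bounds {r} {V} {θ} 0<V root
      δ = proj₁ choice
      0<δ = proj₁ (proj₂ choice)
      ev = proj₂ (proj₂ choice)
      b = c + c
      0<b : 0ℚ < b
      0<b = ℚ.+-mono-< 0<c 0<c
      bound : ∀ k → ((δ ≤ seq θ k × ½ ≤ seq θ k ^ suc r * V × seq θ k ^ suc r * V ≤ 1ℚ + 1ℚ) ×
                     seq p k ≤ 1ℚ + 1ℚ × (b + (b + b)) * seq θ k ≤ seq p k + b * δ) →
              c ^ suc r ≤ clamp (seq p k) ^ suc r * V
      bound k ((δ≤t , ½≤tV , _) , p≤2 , bt≤) = begin
        c ^ suc r
          ≡⟨ halve c (c ^ r) ⟩
        b * c ^ r * ½
          ≤⟨ *-mono (*-nonNeg 0≤b (^-nonNeg r 0≤c)) (ℚ.<⇒≤ (ℚ.positive⁻¹ ½))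
               (*-monoˡ 0≤b (^-mono r 0≤c (a≤a+b 0≤c))) ½≤tV ⟩
        b ^ suc r * (t ^ suc r * V)
          ≡⟨ sym (trans (cong (_* V) (^-distrib-* b t (suc r))) (ℚ.*-assoc (b ^ suc r) (t ^ suc r) V)) ⟩
        (b * t) ^ suc r * V
          ≤⟨ *-monoʳ (ℚ.<⇒≤ 0<V) (^-mono (suc r) (*-nonNeg 0≤b 0≤t) ≤q) ⟩
        clamp (seq p k) ^ suc r * V ∎
        where
        open ℚ.≤-Reasoning
        t = seq θ k
        0≤c : 0ℚ ≤ c
        0≤c = ℚ.<⇒≤ 0<c
        0≤b : 0ℚ ≤ b
        0≤b = ℚ.<⇒≤ 0<b
        0≤t : 0ℚ ≤ t
        0≤t = ℚ.≤-trans (ℚ.<⇒≤ 0<δ) δ≤t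
        halve : ∀ c x → c * x ≡ (c + c) * x * ½
        halve = solve 2 (λ c x → c :* x := (c :+ c) :* x :* con ½) refl
        triple : ∀ b t → (b + (b + b)) * t ≡ b * t + b * t + b * t
        triple = solve 2 (λ b t → (b :+ (b :+ b)) :* t := b :* t :+ b :* t :+ b :* t) refl
        ≤q : b * t ≤ clamp (seq p k)
        ≤q = ≤clamp (*-nonNeg 0≤b 0≤t)
          (+-cancelʳ-≤ (b * t) (subst (_≤ seq p k + b * t) (triple b t)
            (ℚ.≤-trans bt≤ (ℚ.+-monoʳ-≤ (seq p k) (*-monoˡ 0≤b δ≤t))))) p≤2

open RealSequences

-- Bounds on the edge size w

module EdgeSizes where
  open import Data.Integer.Base using (+_)
  open import Data.Rational.Base using (_+_; _*_; _-_; -_; _≤_; _<_; ½)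
  open Rational
  open +-*-Solver using (solve; _:=_; _:+_; _:*_; _:-_; :-_; con)

  -- Archimedean property: ε times its own denominator is its numerator, a positive integer.
  1≤*denominator : ∀ ε → .{{ℚ.Positive ε}} → ∃[ u ] 1ℚ ≤ ε * ι (suc u)
  1≤*denominator ε@(ℚ.mkℚ (+ suc k) u _) = u ,
    subst (1ℚ ≤_) (trans (sym (ι-/ (suc k) (suc u))) (cong (_* ι (suc u)) (ℚ.↥p/↧p≡p ε)))
        (ι-mono {1} {suc k} (s≤s z≤n))

  -- With x = n - s, the size of `n` gives n ≤ 2x and 2ᵘ < x, hence nᵘ ≤ 2ᵘ xᵘ < x xᵘ.
  n^u<[n∸s]^[1+u] : ∀ u s n → suc (2 ℕ.^ u ℕ.+ s) ℕ.+ s ℕ.≤ n → n ℕ.^ u ℕ.< (n ℕ.∸ s) ℕ.^ suc u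
  n^u<[n∸s]^[1+u] u s n large = begin-strict
    n ℕ.^ u                        ≤⟨ ℕ.^-monoˡ-≤ u n≤2x ⟩
    (2 ℕ.* x) ℕ.^ u                ≡⟨ ^-distribʳ-* u 2 x ⟩
    2 ℕ.^ u ℕ.* x ℕ.^ u            <⟨ ℕ.*-monoˡ-< (x ℕ.^ u) {{ℕ.m^n≢0 x u {{ℕ.>-nonZero (ℕ.≤-trans (s≤s z≤n) bound)}}}}
                                        (ℕ.≤-trans (s≤s (ℕ.m≤m+n (2 ℕ.^ u) s)) bound) ⟩
    x ℕ.* x ℕ.^ u                  ∎
    where
    open ℕ.≤-Reasoning
    x = n ℕ.∸ s
    bound : suc (2 ℕ.^ u ℕ.+ s) ℕ.≤ x
    bound = subst (ℕ._≤ x) (ℕ.m+n∸n≡m (suc (2 ℕ.^ u ℕ.+ s)) s) (ℕ.∸-monoˡ-≤ s large)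
    n≤2x : n ℕ.≤ 2 ℕ.* x
    n≤2x = begin
      n                ≡⟨ sym (ℕ.m∸n+n≡m (ℕ.≤-trans (ℕ.m≤n+m s (suc (2 ℕ.^ u ℕ.+ s))) large)) ⟩
      x ℕ.+ s          ≤⟨ ℕ.+-monoʳ-≤ x (ℕ.≤-trans (ℕ.≤-trans (ℕ.m≤n+m s (2 ℕ.^ u)) (ℕ.n≤1+n _)) bound) ⟩
      x ℕ.+ x          ≡⟨ cong (x ℕ.+_) (sym (ℕ.+-identityʳ x)) ⟩
      2 ℕ.* x          ∎

  eventually-witness : ∀ {P : ℕ → Set} → Eventually P → ∃[ k ] P k
  eventually-witness (M , p) = M , p M ℕ.≤-refl

  module _ {α : ℝ} {n w : ℕ} .{{_ : ℕ.NonZero n}} (rounded : IsRoundedPower n α w) where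
    private
      y = proj₁ rounded
      power = proj₁ (proj₂ rounded)
      y-1<w = proj₁ (proj₂ (proj₂ rounded))
      w<y+1 = proj₂ (proj₂ (proj₂ rounded))

    -- The exponent 0 / 1 lies below α, so y ≥ n⁰ = 1, and `w` exceeds y - 1 by some positive ε.
    -- Working to precision ε / 2 leaves w ≥ ε / 2 > 0.
    1≤w : fromℚ ½ Defs.< α → 1 ℕ.≤ w
    1≤w (e , e>0 , ½<α) = ℕ.≰⇒> λ w≤0 →
      ℚ.<-irrefl refl (ℚ.<-≤-trans (½*-pos 0<ε) (ℚ.≤-trans ½ε≤w (ι-mono w≤0)))
      where
      ε = proj₁ y-1<w
      0<ε : 0ℚ < ε
      0<ε = ℚ.positive⁻¹ ε {{proj₁ (proj₂ y-1<w)}}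
      0<α : fromℚ (+ 0 ℚ./ 1) Defs.< α
      0<α = e , e>0 , eventually (λ k → ℚ.≤-trans (ℚ.+-monoˡ-≤ e (ℚ.<⇒≤ (ℚ.positive⁻¹ ½)))) ½<α
      found = eventually-witness
        (atPrecision {fromℕ (n ℕ.^ 0)} {y Defs.^ 1} (IsPower.lower power 0 1 0<α) (½*-pos 0<ε) & proj₂ (proj₂ y-1<w))
      k = proj₁ found
      at = proj₂ found
      collect : ∀ ε → 1ℚ - ½ * ε + (- 1ℚ + ε) ≡ ½ * ε
      collect = solve 1 (λ ε → con 1ℚ :- con ½ :* ε :+ (:- con 1ℚ :+ ε) := con ½ :* ε) refl
      regroup : ∀ y ε → y * 1ℚ + (- 1ℚ + ε) ≡ y - 1ℚ + ε
      regroup = solve 2 (λ y ε → y :* con 1ℚ :+ (:- con 1ℚ :+ ε) := y :- con 1ℚ :+ ε) refl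
      ½ε≤w : ½ * ε ≤ ι w
      ½ε≤w = ℚ.≤-trans
        (subst₂ _≤_ (collect ε) (regroup (seq y k) ε)
            (ℚ.+-monoˡ-≤ (- 1ℚ + ε) (moveʳ {1ℚ} {seq y k * 1ℚ} {½ * ε} (proj₁ at)))) (proj₂ at)

    -- If w > n - s, then y ≥ n - s up to rounding and y^(u + 1) ≥ (n - s)^(u + 1) ≥ nᵘ + 1, against
    -- y^(u + 1) ≤ nᵘ. The gap between integers makes precision 1/2 sufficient.
    w+s≤n : ∀ {u} → α Defs.< fromℚ (+ u ℚ./ suc u) → ∀ s → suc (2 ℕ.^ u ℕ.+ s) ℕ.+ s ℕ.≤ n → w ℕ.+ s ℕ.≤ n
    w+s≤n {u} α<u/v s large = ℕ.≮⇒≥ tooBig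
      where
      x = n ℕ.∸ s
      s≤n : s ℕ.≤ n
      s≤n = ℕ.≤-trans (ℕ.m≤n+m s (suc (2 ℕ.^ u ℕ.+ s))) large
      ε = proj₁ w<y+1
      found = eventually-witness
        (atPrecision {y Defs.^ suc u} {fromℕ (n ℕ.^ u)} (IsPower.upper power u (suc u) α<u/v) (ℚ.positive⁻¹ ½)
            & proj₂ (proj₂ w<y+1))
      k = proj₁ found
      at = proj₂ found
      tooBig : ¬ (n ℕ.< w ℕ.+ s)
      tooBig n<w+s = ℚ.<-irrefl refl (ℚ.<-≤-trans ι+½<ι+1
          (ℚ.≤-trans n^u+1≤y^v (subst (_≤ ι (n ℕ.^ u) + ½) (seq-^ y (suc u) k) (proj₁ at))))
        where
        x<w : suc x ℕ.≤ w
        x<w = ℕ.+-cancelʳ-≤ s (suc x) w (subst (ℕ._≤ w ℕ.+ s) (cong suc (sym (ℕ.m∸n+n≡m s≤n))) n<w+s)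
        x≤y : ι x ≤ seq y k
        x≤y = +-cancelʳ-≤ 1ℚ (begin
          ι x + 1ℚ          ≡⟨ ℚ.+-comm (ι x) 1ℚ ⟩
          1ℚ + ι x          ≡⟨ sym (ι-+ 1 x) ⟩
          ι (suc x)         ≤⟨ ι-mono x<w ⟩
          ι w               ≤⟨ a≤a+b (ℚ.<⇒≤ (ℚ.positive⁻¹ ε {{proj₁ (proj₂ w<y+1)}})) ⟩
          ι w + ε           ≤⟨ proj₂ at ⟩
          seq y k + 1ℚ      ∎)
          where open ℚ.≤-Reasoning
        n^u+1≤y^v : ι (n ℕ.^ u) + 1ℚ ≤ seq y k ^ suc u
        n^u+1≤y^v = begin
          ι (n ℕ.^ u) + 1ℚ    ≡⟨ ℚ.+-comm (ι (n ℕ.^ u)) 1ℚ ⟩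
          1ℚ + ι (n ℕ.^ u)    ≡⟨ sym (ι-+ 1 (n ℕ.^ u)) ⟩
          ι (suc (n ℕ.^ u))   ≤⟨ ι-mono (n^u<[n∸s]^[1+u] u s n large) ⟩
          ι (x ℕ.^ suc u)     ≡⟨ ι-^ x (suc u) ⟩
          ι x ^ suc u         ≤⟨ ^-mono (suc u) (ι-nonNeg x) x≤y ⟩
          seq y k ^ suc u     ∎
          where open ℚ.≤-Reasoning
        ι+½<ι+1 : ι (n ℕ.^ u) + ½ < ι (n ℕ.^ u) + 1ℚ
        ι+½<ι+1 = ℚ.+-monoʳ-< (ι (n ℕ.^ u)) (ℚ.*<* (ℤ.+<+ (s≤s (s≤s z≤n))))

  -- If α ≤ 1 - ε, any u with 1 / (u + 1) ≤ ε / 2 leaves a gap of ε / 2. Fractions of the form u /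
  -- (u + 1) are those that `n^u<[n∸s]^[1+u]` can handle.
  exponent<1 : ∀ {α} → α Defs.< 1ℝ → ∃[ u ] α Defs.< fromℚ (+ u ℚ./ suc u)
  exponent<1 {α} (ε , ε>0 , α<1) = u , ½ * ε , ℚ.positive 0<½ε ,
    eventually (λ k α+ε≤1 → ℚ.≤-trans
        (+-cancelʳ-≤ (½ * ε) (subst₂ _≤_ (split (seq α k) ε) (sym (rejoin ε)) α+ε≤1))
        1-½ε≤) α<1
    where
    0<½ε : 0ℚ < ½ * ε
    0<½ε = ½*-pos (ℚ.positive⁻¹ ε {{ε>0}})
    unit = 1≤*denominator (½ * ε) {{ℚ.positive 0<½ε}}
    u = proj₁ unit
    v = ι (suc u)
    split : ∀ a ε → a + ε ≡ a + ½ * ε + ½ * ε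
    split = solve 2 (λ a ε → a :+ ε := a :+ con ½ :* ε :+ con ½ :* ε) refl
    rejoin : ∀ ε → 1ℚ - ½ * ε + ½ * ε ≡ 1ℚ
    rejoin = solve 1 (λ ε → con 1ℚ :- con ½ :* ε :+ con ½ :* ε := con 1ℚ) refl
    1-½ε≤ : 1ℚ - ½ * ε ≤ + u ℚ./ suc u
    1-½ε≤ = ℚ.*-cancelʳ-≤-pos v {{ℚ.positive (ι-pos {suc u} (s≤s z≤n))}} (begin
      (1ℚ - ½ * ε) * v          ≡⟨ expand (½ * ε) v ⟩
      v - ½ * ε * v             ≤⟨ moveʳ (subst (_≤ ι u + ½ * ε * v)
                                     (trans (ℚ.+-comm (ι u) 1ℚ) (sym (ι-+ 1 u))) (ℚ.+-monoʳ-≤ (ι u) (proj₂ unit))) ⟩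
      ι u                       ≡⟨ sym (ι-/ u (suc u)) ⟩
      (+ u ℚ./ suc u) * v       ∎)
      where
      open ℚ.≤-Reasoning
      expand : ∀ e v → (1ℚ - e) * v ≡ v - e * v
      expand = solve 2 (λ e v → (con 1ℚ :- e) :* v := v :- e :* v) refl

  1≤w&w+s≤n : ∀ {α} {w : ℕ → ℕ} → fromℚ ½ Defs.< α → α Defs.< 1ℝ →
    (∀ n → .{{ℕ.NonZero n}} → IsRoundedPower n α (w n)) → ∀ s →
    Eventually (λ n → 1 ℕ.≤ w n × w n ℕ.+ s ℕ.≤ n)
  1≤w&w+s≤n {α} {w} ½<α α<1 rounded s = suc (2 ℕ.^ u ℕ.+ s) ℕ.+ s , λ n large →
    let instance n≢0 = ℕ.>-nonZero (ℕ.≤-trans (s≤s z≤n) large) in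
    1≤w (rounded n) ½<α , w+s≤n (rounded n) {u} (proj₂ (exponent<1 {α} α<1)) s large
    where u = proj₁ (exponent<1 {α} α<1)

open EdgeSizes

-- The two limits

module Thresholds where
  open import Data.Rational.Base using (_+_; _*_; _-_; _≤_; _<_; ½) renaming (∣_∣ to ∥_∥)
  open Rational
  open +-*-Solver using (solve; _:=_; _:+_; _:*_; _:-_; con)

  -- Of the tolerance ε, one quarter pays for clamping and one for the estimate at the clamped
  -- value; the remaining half is the gap that a strict inequality of reals demands.
  clamped⇒⟶ : ∀ {f} → Lipschitz f → ∀ {P p} → (∀ k → seq P k ≡ f (seq p k)) →
    0ℝ Defs.≤ p → p Defs.≤ 1ℝ → ∀ {l ε} → 0ℚ < ε →
    Eventually (λ k → l ≤ f (clamp (seq p k)) + ½ * (½ * ε) × f (clamp (seq p k)) ≤ l + ½ * (½ * ε)) →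
    (fromℚ l Defs.- fromℚ ε Defs.< P) × (P Defs.< fromℚ l Defs.+ fromℚ ε)
  clamped⇒⟶ {f} F {P} {p} seq-P 0≤p p≤1 {l} {ε} 0<ε near =
    close⇒⟶ {P} {l} {ε} 0<ε (eventually bounds (near & clamped F {p} 0≤p p≤1 (½*-pos (½*-pos 0<ε))))
    where
    η = ½ * (½ * ε)
    widen : ∀ {a b c} → a ≤ b + η → b ≤ c + η → a ≤ c + ½ * ε
    widen {a} {b} {c} a≤ b≤ = subst (a ≤_)
      (trans (ℚ.+-assoc c η η) (cong (ℚ._+_ c) (halves (½ * ε)))) (ℚ.≤-trans a≤ (ℚ.+-monoˡ-≤ η b≤))
    bounds : ∀ k → (l ≤ f (clamp (seq p k)) + η × f (clamp (seq p k)) ≤ l + η) ×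
                   (∥ f (seq p k) - f (clamp (seq p k)) ∥ ≤ η × seq p k ≤ 1ℚ + 1ℚ) →
             l ≤ seq P k + ½ * ε × seq P k ≤ l + ½ * ε
    bounds k ((low , high) , close , _) = subst (λ z → l ≤ z + ½ * ε × z ≤ l + ½ * ε) (sym (seq-P k))
      (widen {l} {f q} {f (seq p k)} low (∣∣≤⇒≤ {f q} (subst (_≤ η) (∣∣-swap (f (seq p k)) (f q)) close)) ,
       widen {f (seq p k)} {f q} {l} (∣∣≤⇒≤ {f (seq p k)} close) high)
      where q = clamp (seq p k)

  module _ (r n w : ℕ) (1≤w : 1 ℕ.≤ w) (fits : w ℕ.+ suc r ℕ.≤ n) where
    private
      r₂ = suc (suc r)
      F = ι (suc r ℕ.!)
      V = N n w * D r₂ n w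
      f = sunflowerProbability r₂ n w
      T≡F*V : ι (flowerCount r₂ n w) ≡ F * V
      T≡F*V = flowerCount≡[r-1]!*N*D (suc r) n w (ℕ.≤-trans (ℕ.m≤m+n w (suc r)) fits)
      1≤F : 1ℚ ≤ F
      1≤F = ι-mono (ℕ.1≤n! (suc r))
      0<F : 0ℚ < F
      0<F = ℚ.<-≤-trans (ℚ.positive⁻¹ 1ℚ) 1≤F
      0≤F : 0ℚ ≤ F
      0≤F = ℚ.<⇒≤ 0<F
      T*q^r : ∀ q → ι (flowerCount r₂ n w) * q ^ r₂ ≡ F * (q ^ r₂ * V)
      T*q^r q = trans (cong (_* q ^ r₂) T≡F*V) (rearrange F V (q ^ r₂))
        where
        rearrange : ∀ f v q → f * v * q ≡ f * (q * v)
        rearrange = solve 3 (λ f v q → f :* v :* q := f :* (q :* v)) refl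
      f-Lipschitz : Lipschitz f
      f-Lipschitz = 𝔼-Lipschitz _≟ˢ_ (edges n w) (λ H → ∑ℚ.𝟙 (containsSunflower? r₂ H))

    -- Discharges the condition under which θ is assumed to be the inverse root.
    0<N*D : 0ℚ < V
    0<N*D = ℚ.*-cancelˡ-<-nonNeg F {{ℚ.nonNegative 0≤F}} (subst₂ _<_ (sym (ℚ.*-zeroʳ F)) T≡F*V
      (ι-pos (1≤flowerCount (suc r) n w 1≤w fits)))

    module _ {θ p : ℝ} (root : IsInverseRoot r₂ V θ) (0≤p : 0ℝ Defs.≤ p) (p≤1 : p Defs.≤ 1ℝ)
             {ε : ℚ} (0<ε : 0ℚ < ε) where
      private
        η = ½ * (½ * ε)
        0<η : 0ℚ < η
        0<η = ½*-pos (½*-pos 0<ε)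
        P = probability n p w (containsSunflower? r₂)
        q : ℕ → ℚ
        q k = clamp (seq p k)

      near-zero : ∀ {c} → 0ℚ < c → c + c ≤ 1ℚ → F * ((c + c) * (1ℚ + 1ℚ)) ≤ η → p Defs.≤ fromℚ c Defs.* θ →
        (0ℝ Defs.- fromℚ ε Defs.< P) × (P Defs.< 0ℝ Defs.+ fromℚ ε)
      near-zero {c} 0<c 2c≤1 small p≤cθ = clamped⇒⟶ f-Lipschitz {P} {p} (seq-probability r₂ n w p) 0≤p p≤1 {0ℚ} {ε} 0<ε
        (eventually bounds (clamp-upper {suc r} {V} {θ} {p} 0<N*D root 0<c 2c≤1 p≤cθ))
        where
        bounds : ∀ k → q k ^ r₂ * V ≤ (c + c) * (1ℚ + 1ℚ) → 0ℚ ≤ f (q k) + η × f (q k) ≤ 0ℚ + η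
        bounds k qV≤ =
          +-nonNeg (sunflowerProbability-nonNeg r n w (0≤clamp (seq p k)) (clamp≤1 (seq p k))) (ℚ.<⇒≤ 0<η) ,
          (begin
            f (q k)                             ≤⟨ sunflowerProbability≤μ r n w (0≤clamp (seq p k)) (clamp≤1 (seq p k)) ⟩
            ι (flowerCount r₂ n w) * q k ^ r₂   ≡⟨ T*q^r (q k) ⟩
            F * (q k ^ r₂ * V)                  ≤⟨ *-monoˡ 0≤F qV≤ ⟩
            F * ((c + c) * (1ℚ + 1ℚ))           ≤⟨ small ⟩
            η                                   ≡⟨ sym (ℚ.+-identityˡ η) ⟩
            0ℚ + η                              ∎)
          where open ℚ.≤-Reasoning

      -- As (r - 1)! ≥ 1, the lower bound on qʳ N D is also one on μ, and the second moment bound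
      -- gives c (1 - f q) ≤ c η.
      near-one : ∀ {c} → 1ℚ ≤ c → ι (suc r₂ ℕ.^ r₂) ≤ c * η →
        fromℚ ((c + c) + ((c + c) + (c + c))) Defs.* θ Defs.≤ p →
        (1ℝ Defs.- fromℚ ε Defs.< P) × (P Defs.< 1ℝ Defs.+ fromℚ ε)
      near-one {c} 1≤c K≤cη cθ≤p = clamped⇒⟶ f-Lipschitz {P} {p} (seq-probability r₂ n w p) 0≤p p≤1 {1ℚ} {ε} 0<ε
        (eventually bounds (clamp-lower {suc r} {V} {θ} {p} 0<N*D root 0<c
            (eventually (λ _ → proj₂) (clamped f-Lipschitz {p} 0≤p p≤1 0<η)) cθ≤p))
        where
        0<c : 0ℚ < c
        0<c = ℚ.<-≤-trans (ℚ.positive⁻¹ 1ℚ) 1≤c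
        bounds : ∀ k → c ^ r₂ ≤ q k ^ r₂ * V → 1ℚ ≤ f (q k) + η × f (q k) ≤ 1ℚ + η
        bounds k c^r≤qV =
          subst₂ _≤_ (cancel 1ℚ (f (q k))) (ℚ.+-comm η (f (q k))) (ℚ.+-monoˡ-≤ (f (q k)) 1-f≤η) ,
          ℚ.≤-trans (sunflowerProbability≤1 r n w (0≤clamp (seq p k)) (clamp≤1 (seq p k))) (a≤a+b (ℚ.<⇒≤ 0<η))
          where
          open ℚ.≤-Reasoning
          cancel : ∀ a b → a - b + b ≡ a
          cancel = solve 2 (λ a b → a :- b :+ b := a) refl
          c^r≤ : c ^ r₂ ≤ ι (flowerCount r₂ n w) * q k ^ r₂
          c^r≤ = begin
            c ^ r₂                              ≤⟨ c^r≤qV ⟩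
            q k ^ r₂ * V                        ≡⟨ sym (ℚ.*-identityˡ (q k ^ r₂ * V)) ⟩
            1ℚ * (q k ^ r₂ * V)                 ≤⟨ *-monoʳ (*-nonNeg (^-nonNeg r₂ (0≤clamp (seq p k))) (ℚ.<⇒≤ 0<N*D)) 1≤F ⟩
            F * (q k ^ r₂ * V)                  ≡⟨ sym (T*q^r (q k)) ⟩
            ι (flowerCount r₂ n w) * q k ^ r₂   ∎
          1-f≤η : 1ℚ - f (q k) ≤ η
          1-f≤η = ℚ.*-cancelˡ-≤-pos c {{ℚ.positive 0<c}} (ℚ.≤-trans
            (c*[1-sunflowerProbability]≤ r n w (0≤clamp (seq p k)) (clamp≤1 (seq p k)) 1≤c c^r≤) K≤cη)

  module _ (r : ℕ) {w : ℕ → ℕ} (large : Eventually (λ n → 1 ℕ.≤ w n × w n ℕ.+ suc r ℕ.≤ n))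
    {θ : ℕ → ℝ}
    (roots : ∀ n → 0ℚ < N n (w n) * D (suc (suc r)) n (w n) →
             IsInverseRoot (suc (suc r)) (N n (w n) * D (suc (suc r)) n (w n)) (θ n))
    {p : ℕ → ℝ} (0≤p≤1 : ∀ n → 0ℝ Defs.≤ p n × p n Defs.≤ 1ℝ) where

    private
      P : ℕ → ℝ
      P n = probability n (p n) (w n) (containsSunflower? (suc (suc r)))

    probability⟶0 : p ∈o θ → P ⟶ 0ℝ
    probability⟶0 p∈oθ ε =
      go (smallFactor (*-nonNeg (ι-nonNeg (suc r ℕ.!)) (+-nonNeg 0≤1 0≤1)) (½*-pos (½*-pos 0<ε)))
      where
      0<ε : 0ℚ < ε
      0<ε = ℚ.positive⁻¹ ε
      F = ι (suc r ℕ.!)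
      rearrange : ∀ f t x → f * t * x ≡ f * ((½ * x + ½ * x) * t)
      rearrange = solve 3 (λ f t x → f :* t :* x := f :* ((con ½ :* x :+ con ½ :* x) :* t)) refl
      go : ∃[ x ] 0ℚ < x × x ≤ 1ℚ × F * (1ℚ + 1ℚ) * x ≤ ½ * (½ * ε) →
           Eventually (λ n → (0ℝ Defs.- fromℚ ε Defs.< P n) × (P n Defs.< 0ℝ Defs.+ fromℚ ε))
      -- With c = x / 2 the quantity c + c, which `near-zero` wants to be at most 1, is just `x`.
      go (x , 0<x , x≤1 , small) = eventually
        {λ n → (1 ℕ.≤ w n × w n ℕ.+ suc r ℕ.≤ n) × p n Defs.≤ fromℚ (½ * x) Defs.* θ n}
        {λ n → (0ℝ Defs.- fromℚ ε Defs.< P n) × (P n Defs.< 0ℝ Defs.+ fromℚ ε)}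
        (λ n ((1≤w , fits) , p≤cθ) →
          near-zero r n (w n) 1≤w fits {θ n} {p n} (roots n (0<N*D r n (w n) 1≤w fits))
            (proj₁ (0≤p≤1 n)) (proj₂ (0≤p≤1 n)) {ε} 0<ε {½ * x} (½*-pos 0<x)
            (subst (_≤ 1ℚ) (sym (halves x)) x≤1)
            (subst (_≤ ½ * (½ * ε)) (rearrange F (1ℚ + 1ℚ) x) small) p≤cθ)
        (large & p∈oθ (½ * x) {{ℚ.positive (½*-pos 0<x)}})

    probability⟶1 : p ∈ω θ → P ⟶ 1ℝ
    probability⟶1 p∈ωθ ε =
      go (largeFactor (ι-nonNeg (suc (suc (suc r)) ℕ.^ suc (suc r))) (½*-pos (½*-pos 0<ε)))
      where
      0<ε : 0ℚ < ε
      0<ε = ℚ.positive⁻¹ ε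
      go : ∃[ c ] 1ℚ ≤ c × ι (suc (suc (suc r)) ℕ.^ suc (suc r)) ≤ c * (½ * (½ * ε)) →
           Eventually (λ n → (1ℝ Defs.- fromℚ ε Defs.< P n) × (P n Defs.< 1ℝ Defs.+ fromℚ ε))
      go (c , 1≤c , K≤cη) = eventually
        {λ n → (1 ℕ.≤ w n × w n ℕ.+ suc r ℕ.≤ n) ×
               fromℚ ((c + c) + ((c + c) + (c + c))) Defs.* θ n Defs.≤ p n}
        {λ n → (1ℝ Defs.- fromℚ ε Defs.< P n) × (P n Defs.< 1ℝ Defs.+ fromℚ ε)}
        (λ n ((1≤w , fits) , cθ≤p) →
          near-one r n (w n) 1≤w fits {θ n} {p n} (roots n (0<N*D r n (w n) 1≤w fits))
            (proj₁ (0≤p≤1 n)) (proj₂ (0≤p≤1 n)) {ε} 0<ε {c} 1≤c K≤cη cθ≤p)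
        (large & p∈ωθ ((c + c) + ((c + c) + (c + c))) {{ℚ.positive (ℚ.+-mono-< 0<b (ℚ.+-mono-< 0<b 0<b))}})
        where
        0<c : 0ℚ < c
        0<c = ℚ.<-≤-trans (ℚ.positive⁻¹ 1ℚ) 1≤c
        0<b : 0ℚ < c + c
        0<b = ℚ.+-mono-< 0<c 0<c

open Thresholds

open import Defs
open import Data.Nat.Base as ℕ using (ℕ; NonZero)
open import Data.Product.Base using (_×_)
open import Data.Rational.Base as ℚ using (0ℚ; ½)

proposition1p2 : (r : ℕ) → 2 ℕ.≤ r →
    (α : ℝ) → fromℚ ½ < α → α < 1ℝ →
    (w : ℕ → ℕ) → (∀ n → .{{NonZero n}} → IsRoundedPower n α (w n)) →
    (θ : ℕ → ℝ) →
    (∀ n → 0ℚ ℚ.< N n (w n) ℚ.* D r n (w n) → IsInverseRoot r (N n (w n) ℚ.* D r n (w n)) (θ n)) →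
    (p : ℕ → ℝ) → (∀ n → 0ℝ ≤ p n × p n ≤ 1ℝ) →
    (p ∈o θ → (λ n → probability n (p n) (w n) (containsSunflower? r)) ⟶ 0ℝ) ×
    (p ∈ω θ → (λ n → probability n (p n) (w n) (containsSunflower? r)) ⟶ 1ℝ)
proposition1p2 (suc (suc r)) (s≤s (s≤s z≤n)) α ½<α α<1 w rounded θ roots p 0≤p≤1 =
  probability⟶0 r {w} large {θ} roots {p} 0≤p≤1 , probability⟶1 r {w} large {θ} roots {p} 0≤p≤1
  where
  large : Eventually (λ n → 1 ℕ.≤ w n × w n ℕ.+ suc r ℕ.≤ n)
  -- There are `suc (suc r)` edges, so w + (r + 1) ≤ n is the room needed by a kernel of w - 1
  -- points with one-point petals.
  large = 1≤w&w+s≤n {α} {w} ½<α α<1 rounded (suc r)
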